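{- For every integer $n\ge1$, the image-size polynomial $M_n(t)=\sum_{\mathbf w\in\mathrm{PF}_n}t^{|\mathrm{im}(\mathbf w)|-1}$ satisfies $$M_n(t)=\sum_{j=0}^{n-1}\binom nj\left\{\begin{matrix}n\\ j+1\end{matrix}\right\}j!\,t^j.$$ Moreover, $M_n(t)$ has $n-1$ simple zeros, all of which are negative (real).
   Context: A parking function of length $n$ is a word $\mathbf w=(w_1,\dots,w_n)\in[n]^n$, $[n]=\{1,\dots,n\}$, whose nondecreasing rearrangement $b_1\le\dots\le b_n$ satisfies $b_i\le i$ for all $i$; $\mathrm{PF}_n$ is the set of these. $\mathrm{im}(\mathbf w)=\{w_1,\dots,w_n\}$ is the set of distinct letters of $\mathbf w$. $\left\{\begin{matrix}n\\ k\end{matrix}\right\}$ is the Stirling number of the second kind, the number of partitions of $[n]$ into $k$ nonempty blocks. -}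

module Defs where

open import Algebra.Bundles.Raw using (RawRing)
import Algebra.Definitions.RawSemiring as RawSemiringDefs
open import Data.Fin.Base using (Fin; toℕ)
open import Data.Fin.Properties using (all?)
open import Data.Fin.Subset
  using (Subset; inside; outside; _∈_; _∩_; ⁅_⁆; ⋃; ∣_∣; Nonempty; Empty)
open import Data.Fin.Subset.Properties using (_∈?_; nonempty?)
open import Data.List.Base
  using (List; []; _∷_; _++_; [_]; map; concatMap; filter; foldr; length;
         replicate; upTo; applyUpTo; allFin)
import Data.List.Sort.InsertionSort as InsertionSort
open import Data.List.Relation.Binary.Pointwise using (Pointwise)
import Data.List.Relation.Binary.Pointwise as Pointwise
open import Data.List.Relation.Unary.All using (All)
import Data.List.Relation.Unary.All as All
open import Data.List.Relation.Unary.AllPairs using (AllPairs; allPairs?)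
open import Data.List.Relation.Unary.Any using (Any)
import Data.List.Relation.Unary.Any as Any
open import Data.Nat.Base as ℕ using (ℕ; zero; suc; _∸_; _⊔_; _!)
import Data.Nat.Properties as ℕ
open import Data.Nat.Combinatorics using (_C_)
open import Data.Product.Base using (Σ; ∃; _×_; _,_; proj₁; proj₂)
open import Data.Rational.Base as ℚ
  using (ℚ; 0ℚ; 1ℚ; ½; Positive; positive)
import Data.Rational.Properties as ℚ
open import Data.Rational.Solver using (module +-*-Solver)
open import Data.Sum.Base using (_⊎_)
open import Data.Vec.Base as Vec using (Vec; []; _∷_; toList)
open import Level using (0ℓ)
open import Relation.Binary.PropositionalEquality
  using (_≡_; _≢_; refl; sym; trans; cong; cong₂; subst)
open import Relation.Nullary.Decidable using (Dec; ¬?; _×-dec_)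

vectors : ∀ {A : Set} → List A → (n : ℕ) → List (Vec A n)
vectors xs zero    = [ [] ]
vectors xs (suc n) = concatMap (λ x → map (x ∷_) (vectors xs n)) xs

subsequences : ∀ {A : Set} → List A → List (List A)
subsequences []       = [ [] ]
subsequences (x ∷ xs) = subsequences xs ++ map (x ∷_) (subsequences xs)

-- The element i of Fin n stands for the letter suc (toℕ i) of {1,…,n}.
Word : ℕ → Set
Word n = Vec (Fin n) n

letters : ∀ {n} → Word n → List ℕ
letters w = map (λ i → suc (toℕ i)) (toList w)

open InsertionSort ℕ.≤-decTotalOrder public using (sort)

IsParking : ∀ {n} → Word n → Set
IsParking {n} w = Pointwise ℕ._≤_ (sort (letters w)) (applyUpTo suc n)

isParking? : ∀ {n} (w : Word n) → Dec (IsParking w)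
isParking? {n} w =
  Pointwise.decidable ℕ._≤?_ (sort (letters w)) (applyUpTo suc n)

PF : (n : ℕ) → List (Word n)
PF n = filter isParking? (vectors (allFin n) n)

image : ∀ {n} → Word n → Subset n
image w = ⋃ (map ⁅_⁆ (toList w))

-- A set of blocks is a subsequence of the repetition-free list of all
-- subsets of Fin n, so each set partition is counted exactly once.
IsPartition : (n k : ℕ) → List (Subset n) → Set
IsPartition n k bs =
  length bs ≡ k ×
  All Nonempty bs ×
  AllPairs (λ p q → Empty (p ∩ q)) bs ×
  (∀ (i : Fin n) → Any (i ∈_) bs)

isPartition? : ∀ n k (bs : List (Subset n)) → Dec (IsPartition n k bs)
isPartition? n k bs =
  (length bs ℕ.≟ k) ×-dec
  All.all? nonempty? bs ×-dec
  allPairs? (λ p q → ¬? (nonempty? (p ∩ q))) bs ×-dec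
  all? (λ i → Any.any? (i ∈?_) bs)

setPartitions : (n k : ℕ) → List (List (Subset n))
setPartitions n k =
  filter (isPartition? n k)
         (subsequences (vectors (outside ∷ inside ∷ []) n))

stirling₂ : ℕ → ℕ → ℕ
stirling₂ n k = length (setPartitions n k)

-- Coefficients are listed from the constant term upwards; trailing zeros
-- are allowed, so equality of polynomials is _≋_ and not _≡_.
Poly : Set
Poly = List ℕ

coeff : Poly → ℕ → ℕ
coeff []      _       = 0
coeff (a ∷ p) zero    = a
coeff (a ∷ p) (suc k) = coeff p k

infix 4 _≋_
_≋_ : Poly → Poly → Set
p ≋ q = ∀ k → coeff p k ≡ coeff q k

infixl 6 _⊕_
_⊕_ : Poly → Poly → Poly
[]      ⊕ q       = q
(a ∷ p) ⊕ []      = a ∷ p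
(a ∷ p) ⊕ (b ∷ q) = (a ℕ.+ b) ∷ (p ⊕ q)

sumPoly : List Poly → Poly
sumPoly = foldr _⊕_ []

monomial : ℕ → ℕ → Poly
monomial c k = replicate k 0 ++ [ c ]

-- (a + t p)′ = p + t p′
derivative : Poly → Poly
derivative []      = []
derivative (a ∷ p) = p ⊕ (0 ∷ derivative p)

module _ (R : RawRing 0ℓ 0ℓ) where
  open RawRing R
  open RawSemiringDefs rawSemiring using () renaming (_×_ to _·_)

  eval : Poly → Carrier → Carrier
  eval []      x = 0#
  eval (a ∷ p) x = a · 1# + x * eval p x

M : ℕ → Poly
M n = sumPoly (map (λ w → monomial 1 (∣ image w ∣ ∸ 1)) (PF n))

imageSizeFormula : ℕ → Poly
imageSizeFormula n =
  sumPoly (map (λ j → monomial ((n C j) ℕ.* stirling₂ n (suc j) ℕ.* j !) j)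
               (upTo n))

IsCauchy : (ℕ → ℚ) → Set
IsCauchy x = ∀ ε → 0ℚ ℚ.< ε →
  ∃ λ N → ∀ m n → N ℕ.≤ m → N ℕ.≤ n → ℚ.∣ x m ℚ.- x n ∣ ℚ.< ε

-- Equality of reals is _≃_ below, not _≡_.
record ℝ : Set where
  constructor mkℝ
  field
    seq    : ℕ → ℚ
    cauchy : IsCauchy seq

open ℝ public

open +-*-Solver

half-pos : ∀ {ε} → 0ℚ ℚ.< ε → 0ℚ ℚ.< ε ℚ.* ½
half-pos {ε} 0<ε =
  subst (ℚ._< ε ℚ.* ½) (ℚ.*-zeroˡ ½) (ℚ.*-monoˡ-<-pos ½ 0<ε)

half+half : ∀ ε → ε ℚ.* ½ ℚ.+ ε ℚ.* ½ ≡ ε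
half+half ε =
  trans (sym (ℚ.*-distribˡ-+ ε ½ ½)) (ℚ.*-identityʳ ε)

quotient : ∀ {ε B} → 0ℚ ℚ.< ε → 0ℚ ℚ.< B →
           ∃ λ δ → 0ℚ ℚ.< δ × B ℚ.* δ ≡ ε
quotient {ε} {B} 0<ε 0<B = δ , 0<δ , eq
  where
  instance
    _ = positive 0<B
    _ = ℚ.pos⇒nonZero B
    _ = ℚ.1/pos⇒pos B
  δ : ℚ
  δ = ℚ.1/ B ℚ.* ε
  0<δ : 0ℚ ℚ.< δ
  0<δ = subst (ℚ._< δ) (ℚ.*-zeroʳ (ℚ.1/ B)) (ℚ.*-monoʳ-<-pos (ℚ.1/ B) 0<ε)
  eq : B ℚ.* δ ≡ ε
  eq = trans (sym (ℚ.*-assoc B (ℚ.1/ B) ε))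
             (trans (cong (ℚ._* ε) (ℚ.*-inverseʳ B)) (ℚ.*-identityˡ ε))

bounded : ∀ {x} → IsCauchy x →
          ∃ λ B → 0ℚ ℚ.< B × ∃ λ N → ∀ n → N ℕ.≤ n → ℚ.∣ x n ∣ ℚ.< B
bounded {x} cx with cx 1ℚ (ℚ.positive⁻¹ 1ℚ)
... | N , h = B , 0<B , N , bound
  where
  B : ℚ
  B = 1ℚ ℚ.+ ℚ.∣ x N ∣
  bound : ∀ n → N ℕ.≤ n → ℚ.∣ x n ∣ ℚ.< B
  bound n N≤n = begin-strict
    ℚ.∣ x n ∣
      ≡⟨ cong ℚ.∣_∣ (solve 2 (λ a b → a := (a :- b) :+ b) refl (x n) (x N)) ⟩
    ℚ.∣ (x n ℚ.- x N) ℚ.+ x N ∣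
      ≤⟨ ℚ.∣p+q∣≤∣p∣+∣q∣ (x n ℚ.- x N) (x N) ⟩
    ℚ.∣ x n ℚ.- x N ∣ ℚ.+ ℚ.∣ x N ∣
      <⟨ ℚ.+-monoˡ-< ℚ.∣ x N ∣ (h n N N≤n ℕ.≤-refl) ⟩
    B ∎
    where open ℚ.≤-Reasoning
  0<B : 0ℚ ℚ.< B
  0<B = ℚ.≤-<-trans (ℚ.0≤∣p∣ (x N)) (bound N ℕ.≤-refl)

abstract
  +-cauchy : ∀ {x y} → IsCauchy x → IsCauchy y →
             IsCauchy (λ n → x n ℚ.+ y n)
  +-cauchy {x} {y} cx cy ε 0<ε
    with cx (ε ℚ.* ½) (half-pos 0<ε) | cy (ε ℚ.* ½) (half-pos 0<ε)
  ... | N , h | N′ , h′ = N ⊔ N′ , λ m n p q → begin-strict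
    ℚ.∣ (x m ℚ.+ y m) ℚ.- (x n ℚ.+ y n) ∣
      ≡⟨ cong ℚ.∣_∣ (solve 4 (λ a b c d →
           (a :+ b) :- (c :+ d) := (a :- c) :+ (b :- d)) refl
           (x m) (y m) (x n) (y n)) ⟩
    ℚ.∣ (x m ℚ.- x n) ℚ.+ (y m ℚ.- y n) ∣
      ≤⟨ ℚ.∣p+q∣≤∣p∣+∣q∣ (x m ℚ.- x n) (y m ℚ.- y n) ⟩
    ℚ.∣ x m ℚ.- x n ∣ ℚ.+ ℚ.∣ y m ℚ.- y n ∣
      <⟨ ℚ.+-mono-<
           (h  m n (ℕ.m⊔n≤o⇒m≤o N N′ p) (ℕ.m⊔n≤o⇒m≤o N N′ q))
           (h′ m n (ℕ.m⊔n≤o⇒n≤o N N′ p) (ℕ.m⊔n≤o⇒n≤o N N′ q)) ⟩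
    ε ℚ.* ½ ℚ.+ ε ℚ.* ½
      ≡⟨ half+half ε ⟩
    ε ∎
    where open ℚ.≤-Reasoning

  neg-cauchy : ∀ {x} → IsCauchy x → IsCauchy (λ n → ℚ.- x n)
  neg-cauchy {x} cx ε 0<ε with cx ε 0<ε
  ... | N , h = N , λ m n p q → begin-strict
    ℚ.∣ (ℚ.- x m) ℚ.- (ℚ.- x n) ∣
      ≡⟨ cong ℚ.∣_∣ (solve 2 (λ a b → (:- a) :- (:- b) := b :- a) refl
           (x m) (x n)) ⟩
    ℚ.∣ x n ℚ.- x m ∣
      <⟨ h n m q p ⟩
    ε ∎
    where open ℚ.≤-Reasoning

*-split : ∀ a b c d →
  a ℚ.* b ℚ.- c ℚ.* d ≡ a ℚ.* (b ℚ.- d) ℚ.+ d ℚ.* (a ℚ.- c)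
*-split = solve 4 (λ a b c d →
  a :* b :- c :* d := a :* (b :- d) :+ d :* (a :- c)) refl

*-bound : ∀ {B δ} → 0ℚ ℚ.< B → ∀ u v → ℚ.∣ u ∣ ℚ.< B → ℚ.∣ v ∣ ℚ.< δ →
          ℚ.∣ u ℚ.* v ∣ ℚ.< B ℚ.* δ
*-bound {B} {δ} 0<B u v u<B v<δ = begin-strict
  ℚ.∣ u ℚ.* v ∣
    ≡⟨ ℚ.∣p*q∣≡∣p∣*∣q∣ u v ⟩
  ℚ.∣ u ∣ ℚ.* ℚ.∣ v ∣
    ≤⟨ ℚ.*-monoʳ-≤-nonNeg ℚ.∣ v ∣ {{ℚ.∣-∣-nonNeg v}} (ℚ.<⇒≤ u<B) ⟩
  B ℚ.* ℚ.∣ v ∣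
    <⟨ ℚ.*-monoʳ-<-pos B {{positive 0<B}} v<δ ⟩
  B ℚ.* δ ∎
  where open ℚ.≤-Reasoning

*-close : ∀ {x y : ℕ → ℚ} {ε B B′ δ δ′ K K′ N N′} →
  0ℚ ℚ.< B → 0ℚ ℚ.< B′ → B ℚ.* δ ≡ ε ℚ.* ½ → B′ ℚ.* δ′ ≡ ε ℚ.* ½ →
  (∀ n → K ℕ.≤ n → ℚ.∣ x n ∣ ℚ.< B) →
  (∀ n → K′ ℕ.≤ n → ℚ.∣ y n ∣ ℚ.< B′) →
  (∀ m n → N ℕ.≤ m → N ℕ.≤ n → ℚ.∣ y m ℚ.- y n ∣ ℚ.< δ) →
  (∀ m n → N′ ℕ.≤ m → N′ ℕ.≤ n → ℚ.∣ x m ℚ.- x n ∣ ℚ.< δ′) →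
  ∀ m n → K ⊔ K′ ⊔ (N ⊔ N′) ℕ.≤ m → K ⊔ K′ ⊔ (N ⊔ N′) ℕ.≤ n →
  ℚ.∣ x m ℚ.* y m ℚ.- x n ℚ.* y n ∣ ℚ.< ε
*-close {x} {y} {ε} {B} {B′} {δ} {δ′} {K} {K′} {N} {N′}
        0<B 0<B′ e e′ b b′ h h′ m n p q = begin-strict
  ℚ.∣ x m ℚ.* y m ℚ.- x n ℚ.* y n ∣
    ≡⟨ cong ℚ.∣_∣ (*-split (x m) (y m) (x n) (y n)) ⟩
  ℚ.∣ x m ℚ.* (y m ℚ.- y n) ℚ.+ y n ℚ.* (x m ℚ.- x n) ∣
    ≤⟨ ℚ.∣p+q∣≤∣p∣+∣q∣ (x m ℚ.* (y m ℚ.- y n)) (y n ℚ.* (x m ℚ.- x n)) ⟩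
  ℚ.∣ x m ℚ.* (y m ℚ.- y n) ∣ ℚ.+ ℚ.∣ y n ℚ.* (x m ℚ.- x n) ∣
    <⟨ ℚ.+-mono-<
         (*-bound 0<B (x m) (y m ℚ.- y n)
           (b m (ℕ.m⊔n≤o⇒m≤o K K′ (left p)))
           (h m n (ℕ.m⊔n≤o⇒m≤o N N′ (right p)) (ℕ.m⊔n≤o⇒m≤o N N′ (right q))))
         (*-bound 0<B′ (y n) (x m ℚ.- x n)
           (b′ n (ℕ.m⊔n≤o⇒n≤o K K′ (left q)))
           (h′ m n (ℕ.m⊔n≤o⇒n≤o N N′ (right p)) (ℕ.m⊔n≤o⇒n≤o N N′ (right q)))) ⟩
  B ℚ.* δ ℚ.+ B′ ℚ.* δ′
    ≡⟨ cong₂ ℚ._+_ e e′ ⟩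
  ε ℚ.* ½ ℚ.+ ε ℚ.* ½
    ≡⟨ half+half ε ⟩
  ε ∎
  where
  open ℚ.≤-Reasoning
  left : ∀ {n} → K ⊔ K′ ⊔ (N ⊔ N′) ℕ.≤ n → K ⊔ K′ ℕ.≤ n
  left = ℕ.m⊔n≤o⇒m≤o (K ⊔ K′) (N ⊔ N′)
  right : ∀ {n} → K ⊔ K′ ⊔ (N ⊔ N′) ℕ.≤ n → N ⊔ N′ ℕ.≤ n
  right = ℕ.m⊔n≤o⇒n≤o (K ⊔ K′) (N ⊔ N′)

abstract
  *-cauchy : ∀ {x y} → IsCauchy x → IsCauchy y →
             IsCauchy (λ n → x n ℚ.* y n)
  *-cauchy {x} {y} cx cy ε 0<ε =
    let B  , 0<B  , K  , b  = bounded cx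
        B′ , 0<B′ , K′ , b′ = bounded cy
        δ  , 0<δ  , e       = quotient (half-pos 0<ε) 0<B
        δ′ , 0<δ′ , e′      = quotient (half-pos 0<ε) 0<B′
        N  , h              = cy δ 0<δ
        N′ , h′             = cx δ′ 0<δ′
    in K ⊔ K′ ⊔ (N ⊔ N′) ,
       *-close {x} {y} {ε} {B} {B′} {δ} {δ′} {K} {K′} {N} {N′}
               0<B 0<B′ e e′ b b′ h h′

fromℚ : ℚ → ℝ
fromℚ q = mkℝ (λ _ → q) λ ε 0<ε → 0 , λ _ _ _ _ →
  subst (λ d → ℚ.∣ d ∣ ℚ.< ε) (sym (ℚ.+-inverseʳ q)) 0<ε

infix 4 _≃_ _<_ _#_

_≃_ : ℝ → ℝ → Set
x ≃ y = ∀ ε → 0ℚ ℚ.< ε →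
  ∃ λ N → ∀ n → N ℕ.≤ n → ℚ.∣ seq x n ℚ.- seq y n ∣ ℚ.< ε

_<_ : ℝ → ℝ → Set
x < y = ∃ λ ε → 0ℚ ℚ.< ε ×
  ∃ λ N → ∀ n → N ℕ.≤ n → seq x n ℚ.+ ε ℚ.< seq y n

-- Constructive form of x ≠ y.
_#_ : ℝ → ℝ → Set
x # y = x < y ⊎ y < x

0ℝ 1ℝ : ℝ
0ℝ = fromℚ 0ℚ
1ℝ = fromℚ 1ℚ

ℝ-rawRing : RawRing 0ℓ 0ℓ
ℝ-rawRing = record
  { Carrier = ℝ
  ; _≈_     = _≃_
  ; _+_     = λ x y → mkℝ (λ n → seq x n ℚ.+ seq y n)
                          (+-cauchy {seq x} {seq y} (cauchy x) (cauchy y))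
  ; _*_     = λ x y → mkℝ (λ n → seq x n ℚ.* seq y n)
                          (*-cauchy {seq x} {seq y} (cauchy x) (cauchy y))
  ; -_      = λ x → mkℝ (λ n → ℚ.- seq x n)
                        (neg-cauchy {seq x} (cauchy x))
  ; 0#      = 0ℝ
  ; 1#      = 1ℝ
  }

record ℂ : Set where
  constructor _+i_
  field
    re : ℝ
    im : ℝ

open ℂ public

fromℝ : ℝ → ℂ
fromℝ x = x +i 0ℝ

ℂ-rawRing : RawRing 0ℓ 0ℓ
ℂ-rawRing = record
  { Carrier = ℂ
  ; _≈_     = λ z w → re z ≃ re w × im z ≃ im w
  ; _+_     = λ z w → (re z + re w) +i (im z + im w)
  ; _*_     = λ z w → (re z * re w + (- (im z * im w))) +i
                      (re z * im w + im z * re w)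
  ; -_      = λ z → (- re z) +i (- im z)
  ; 0#      = fromℝ 0ℝ
  ; 1#      = fromℝ 1ℝ
  }
  where open RawRing ℝ-rawRing using (_+_; _*_; -_)

-- Multiplicity one, expressed by non-vanishing of the derivative.
IsSimpleZero : Poly → ℝ → Set
IsSimpleZero p x =
  eval ℝ-rawRing p x ≃ 0ℝ × eval ℝ-rawRing (derivative p) x # 0ℝ

-- The complex zeros of p are exactly m distinct numbers, all of which are
-- real, negative and simple.
HasSimpleNegativeZeros : ℕ → Poly → Set
HasSimpleNegativeZeros m p = Σ (Fin m → ℝ) λ α →
  (∀ i j → i ≢ j → α i # α j) ×
  (∀ i → IsSimpleZero p (α i)) ×
  (∀ i → α i < 0ℝ) ×
  (∀ z → eval ℂ-rawRing p z ≈ 0# → ∃ λ i → z ≈ fromℝ (α i))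
  where open RawRing ℂ-rawRing using (_≈_; 0#)

-- Coefficients.  Let a word of length n over m letters, with n + a = m + 1, park with slack a when,
-- reading the letters in order, the a spare cars plus the occurrences seen so far never run out;
-- parking functions are the case m = n, a = 1.  Removing the occurrences of the first letter gives
-- a recursion for the number of such words with k + 1 distinct letters, and it is solved by
-- a · m(m−1)⋯(m−k+1) · S(n, k+1): the terms of the recursion count the set partitions into k + 1
-- blocks with a marked block or with a marked element.
--
-- Zeros.  For fixed n let B_r(t) = Σ_j n(n−1)⋯(n−j+1) S(r, j+1) t^j, so that M_n = B_n.  With
-- W = t B_r one has B_{r+1} = (1 − t) W′ + (1 + n) W.  If the zeros of W are real, simple and
-- nonpositive, then at them B_{r+1} has the sign of W′, which alternates; together with the sign at
-- −∞ this gives r sign changes of B_{r+1} on the negative axis.  The zeros are located by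
-- bisection, and the complex zeros are read off the factorisation into linear factors.

module Submission where

open import Defs
open import Algebra.Bundles using (CommutativeRing)
open import Data.Nat.Base using (ℕ; suc; _≤_; _∸_)
import Data.Nat.Properties as ℕ
open import Data.Product.Base using (_×_; _,_)
open import Level using (0ℓ)
import Relation.Binary.PropositionalEquality as ≡

-- The slack is there because parking functions alone are not closed under deleting a letter. If the
-- first of `suc m` letters occurs `i` times, the other `m` letters carry a problem of the same kind
-- with slack `s + i` in place of `suc s`, and the relation between length, slack and alphabet
-- persists. The factor `s + i` of the inductive value is then what separates the two kinds of
-- marking. For the zeros, `n` is held fixed so that only the Stirling triangle moves from one row
-- to the next, while the falling factorials stay constant. The obstacle there is constructive: the
-- sign of a real number cannot be decided, and a vanishing product does not reveal which factor
-- vanishes. Sign changes are therefore recorded at rational points, where values are exact.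
-- Bisection turns them into roots whose order comes with rational margins, and sufficiently late
-- approximants of these roots are the rational points for the next row. For a complex number, the
-- distance between two real roots decides from which of them it is apart, and the corresponding
-- factor can be cancelled.

module Counting where

  open import Data.Bool.Base using (true; false; if_then_else_)
  open import Data.Fin.Base using (Fin; zero; suc; toℕ)
  open import Data.Fin.Subset
    using (Subset; Side; inside; outside; _∈_; _∩_; _∪_; ⋃; ⁅_⁆; ∣_∣; Nonempty; Empty)
  import Data.Fin.Subset.Properties as Subset
  open import Data.List.Base as List
    using (List; []; _∷_; _++_; [_]; map; concatMap; filter; length; allFin; upTo; applyUpTo)
  open import Data.List.Properties using (map-++; map-∘; map-tabulate; map-upTo; length-map; ++-identityʳ)
  open import Data.List.Relation.Binary.Permutation.Propositional
    using (_↭_; ↭-refl; ↭-sym; ↭-trans; ↭-reflexive; prep; swap; refl; trans; ↭⇒↭ₛ)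
  import Data.List.Relation.Binary.Permutation.Propositional.Properties as Perm
  import Data.List.Relation.Binary.Permutation.Setoid.Properties as PermSetoid
  open import Data.List.Relation.Binary.Pointwise as Pointwise using (Pointwise; []; _∷_)
  open import Data.List.Relation.Unary.All as All using (All; []; _∷_)
  import Data.List.Relation.Unary.All.Properties as All
  open import Data.List.Relation.Unary.AllPairs as AllPairs using (AllPairs; []; _∷_)
  import Data.List.Relation.Unary.AllPairs.Properties as AllPairs
  open import Data.List.Relation.Unary.Any as Any using (Any; here; there)
  import Data.List.Relation.Unary.Any.Properties as Any
  import Data.List.Relation.Unary.Linked.Properties as Linked
  import Data.List.Relation.Unary.Sorted.TotalOrder.Properties as Sorted
  import Data.List.Sort.InsertionSort.Properties as InsertionSort
  open import Data.Nat.Base as ℕ using (ℕ; zero; suc; _+_; _*_; _∸_; _!; z≤n; s≤s)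
  open import Data.Nat.Combinatorics using (_C_; nCk≡nPk/k!)
  open import Data.Nat.Combinatorics.Base using (_P′_)
  open import Data.Nat.Combinatorics.Specification
    using (nP′k≡n!/[n∸k]!; nPk≡n!/[n∸k]!; nP′k≡n[n∸1P′k∸1]; k!∣nP′k)
  open import Data.Nat.DivMod using (m/n*n≡m; /-congˡ)
  open import Data.Nat.ListAction using (sum)
  open import Data.Nat.ListAction.Properties using (sum-++)
  import Data.Nat.Properties as ℕ
  open import Data.Nat.Tactic.RingSolver using (solve-∀)
  open import Data.Product.Base using (∃; _×_; _,_; proj₁)
  open import Data.Vec.Base as Vec using (Vec; []; _∷_; here; there; replicate; updateAt; toList)
  open import Data.Vec.Properties using (map-replicate)
  open import Function.Base using (_∘_; id)
  open import Function.Bundles using (_⇔_; mk⇔; Equivalence)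
  open import Relation.Binary.PropositionalEquality
    using (_≡_; refl; sym; cong; cong₂; subst; setoid; resp₂; module ≡-Reasoning)
    renaming (trans to ≡-trans)
  open import Relation.Nullary using (¬_; contradiction)
  open import Relation.Nullary.Decidable using (Dec; yes; no; does; ¬?; does-⇔; dec-false)
  open import Relation.Unary using (Decidable)

  -- Finite sums and Iverson brackets

  private
    variable
      A B : Set
      P Q : Set

  ∑ : (A → ℕ) → List A → ℕ
  ∑ f xs = sum (map f xs)

  ∑-cong : {f g : A → ℕ} → (∀ x → f x ≡ g x) → ∀ xs → ∑ f xs ≡ ∑ g xs
  ∑-cong f≗g []       = refl
  ∑-cong f≗g (x ∷ xs) = cong₂ _+_ (f≗g x) (∑-cong f≗g xs)

  ∑-++ : (f : A → ℕ) → ∀ xs ys → ∑ f (xs ++ ys) ≡ ∑ f xs + ∑ f ys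
  ∑-++ f xs ys = ≡-trans (cong sum (map-++ f xs ys)) (sum-++ (map f xs) (map f ys))

  ∑-map : (f : B → ℕ) (g : A → B) → ∀ xs → ∑ f (map g xs) ≡ ∑ (f ∘ g) xs
  ∑-map f g xs = cong sum (sym (map-∘ xs))

  ∑-concatMap : (f : B → ℕ) (g : A → List B) →
                ∀ xs → ∑ f (concatMap g xs) ≡ ∑ (λ x → ∑ f (g x)) xs
  ∑-concatMap f g []       = refl
  ∑-concatMap f g (x ∷ xs) =
    ≡-trans (∑-++ f (g x) (concatMap g xs)) (cong (∑ f (g x) +_) (∑-concatMap f g xs))

  ∑-+ : (f g : A → ℕ) → ∀ xs → ∑ (λ x → f x + g x) xs ≡ ∑ f xs + ∑ g xs
  ∑-+ f g []       = refl
  ∑-+ f g (x ∷ xs) = ≡-trans (cong (f x + g x +_) (∑-+ f g xs)) (medial (f x) (g x) (∑ f xs) (∑ g xs))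
    where
    medial : ∀ a b c d → (a + b) + (c + d) ≡ (a + c) + (b + d)
    medial = solve-∀

  ∑-*ˡ : ∀ c (f : A → ℕ) → ∀ xs → ∑ (λ x → c * f x) xs ≡ c * ∑ f xs
  ∑-*ˡ c f []       = sym (ℕ.*-zeroʳ c)
  ∑-*ˡ c f (x ∷ xs) = ≡-trans (cong (c * f x +_) (∑-*ˡ c f xs)) (sym (ℕ.*-distribˡ-+ c (f x) (∑ f xs)))

  ∑-zero : {f : A → ℕ} → (∀ x → f x ≡ 0) → ∀ xs → ∑ f xs ≡ 0
  ∑-zero f≗0 []       = refl
  ∑-zero f≗0 (x ∷ xs) = cong₂ _+_ (f≗0 x) (∑-zero f≗0 xs)

  ⟦_⟧ : Dec P → ℕ
  ⟦ P? ⟧ = if does P? then 1 else 0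

  ⟦⟧-⇔ : P ⇔ Q → (P? : Dec P) (Q? : Dec Q) → ⟦ P? ⟧ ≡ ⟦ Q? ⟧
  ⟦⟧-⇔ P⇔Q P? Q? = cong (if_then 1 else 0) (does-⇔ P⇔Q P? Q?)

  ⟦⟧-false : (P? : Dec P) → ¬ P → ⟦ P? ⟧ ≡ 0
  ⟦⟧-false P? ¬p = cong (if_then 1 else 0) (dec-false P? ¬p)

  -- Lets `length bs` be replaced by the constant `k` in front of the indicator of being a partition
  -- into `k` blocks.
  *-⟦⟧-cong : ∀ {a b} (P? : Dec P) → (P → a ≡ b) → a * ⟦ P? ⟧ ≡ b * ⟦ P? ⟧
  *-⟦⟧-cong         (yes p) a≡b = cong (_* 1) (a≡b p)
  *-⟦⟧-cong {a = a} {b} (no _)  _   = ≡-trans (ℕ.*-zeroʳ a) (sym (ℕ.*-zeroʳ b))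

  ∑-filter : {P : A → Set} (P? : Decidable P) (f : A → ℕ) → ∀ xs →
             ∑ f (filter P? xs) ≡ ∑ (λ x → ⟦ P? x ⟧ * f x) xs
  ∑-filter P? f []       = refl
  ∑-filter P? f (x ∷ xs) with does (P? x)
  ... | true  = cong₂ _+_ (sym (ℕ.*-identityˡ (f x))) (∑-filter P? f xs)
  ... | false = ∑-filter P? f xs

  length-filter-∑ : {P : A → Set} (P? : Decidable P) → ∀ xs →
                    length (filter P? xs) ≡ ∑ (λ x → ⟦ P? x ⟧) xs
  length-filter-∑ P? []       = refl
  length-filter-∑ P? (x ∷ xs) with does (P? x)
  ... | true  = cong suc (length-filter-∑ P? xs)
  ... | false = length-filter-∑ P? xs

  -- Sums over the subsequences of a list

  ∑-subsequences-∷ : (F : List A → ℕ) → ∀ x xs →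
    ∑ F (subsequences (x ∷ xs)) ≡ ∑ F (subsequences xs) + ∑ (F ∘ (x ∷_)) (subsequences xs)
  ∑-subsequences-∷ F x xs =
    ≡-trans (∑-++ F (subsequences xs) _) (cong (∑ F (subsequences xs) +_) (∑-map F (x ∷_) (subsequences xs)))

  ∑-subsequences-++ : (F : List A → ℕ) → ∀ xs ys →
    ∑ F (subsequences (xs ++ ys)) ≡ ∑ (λ as → ∑ (λ bs → F (as ++ bs)) (subsequences ys)) (subsequences xs)
  ∑-subsequences-++ F []       ys = sym (ℕ.+-identityʳ _)
  ∑-subsequences-++ F (x ∷ xs) ys = begin
    ∑ F (subsequences (x ∷ xs ++ ys))
      ≡⟨ ∑-subsequences-∷ F x (xs ++ ys) ⟩
    ∑ F (subsequences (xs ++ ys)) + ∑ (F ∘ (x ∷_)) (subsequences (xs ++ ys))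
      ≡⟨ cong₂ _+_ (∑-subsequences-++ F xs ys) (∑-subsequences-++ (F ∘ (x ∷_)) xs ys) ⟩
    ∑ G (subsequences xs) + ∑ (G ∘ (x ∷_)) (subsequences xs)
      ≡⟨ ∑-subsequences-∷ G x xs ⟨
    ∑ G (subsequences (x ∷ xs)) ∎
    where
    open ≡-Reasoning
    G : _ → ℕ
    G as = ∑ (λ bs → F (as ++ bs)) (subsequences ys)

  ∑-subsequences-map : (F : List B → ℕ) (g : A → B) → ∀ xs →
    ∑ F (subsequences (map g xs)) ≡ ∑ (F ∘ map g) (subsequences xs)
  ∑-subsequences-map F g []       = refl
  ∑-subsequences-map F g (x ∷ xs) = begin
    ∑ F (subsequences (map g (x ∷ xs)))
      ≡⟨ ∑-subsequences-∷ F (g x) (map g xs) ⟩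
    ∑ F (subsequences (map g xs)) + ∑ (F ∘ (g x ∷_)) (subsequences (map g xs))
      ≡⟨ cong₂ _+_ (∑-subsequences-map F g xs) (∑-subsequences-map (F ∘ (g x ∷_)) g xs) ⟩
    ∑ (F ∘ map g) (subsequences xs) + ∑ (F ∘ map g ∘ (x ∷_)) (subsequences xs)
      ≡⟨ ∑-subsequences-∷ (F ∘ map g) x xs ⟨
    ∑ (F ∘ map g) (subsequences (x ∷ xs)) ∎
    where open ≡-Reasoning

  ∑-subsequences-[] : (F : List A → ℕ) → (∀ x xs → F (x ∷ xs) ≡ 0) →
                      ∀ xs → ∑ F (subsequences xs) ≡ F []
  ∑-subsequences-[] F F0 []       = ℕ.+-identityʳ (F [])
  ∑-subsequences-[] F F0 (x ∷ xs) = begin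
    ∑ F (subsequences (x ∷ xs))
      ≡⟨ ∑-subsequences-∷ F x xs ⟩
    ∑ F (subsequences xs) + ∑ (F ∘ (x ∷_)) (subsequences xs)
      ≡⟨ cong₂ _+_ (∑-subsequences-[] F F0 xs) (∑-zero (F0 x) (subsequences xs)) ⟩
    F [] + 0
      ≡⟨ ℕ.+-identityʳ (F []) ⟩
    F [] ∎
    where open ≡-Reasoning

  -- Serves for the blocks that contain `zero`: a partition has exactly one of them, so the sum over
  -- lists of such blocks becomes a sum over single blocks.
  ∑-subsequences-singletons : (F : List A → ℕ) → F [] ≡ 0 → (∀ x y xs → F (x ∷ y ∷ xs) ≡ 0) →
                              ∀ xs → ∑ F (subsequences xs) ≡ ∑ (F ∘ [_]) xs
  ∑-subsequences-singletons F F[] F0 []       = cong (_+ 0) F[]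
  ∑-subsequences-singletons F F[] F0 (x ∷ xs) = begin
    ∑ F (subsequences (x ∷ xs))
      ≡⟨ ∑-subsequences-∷ F x xs ⟩
    ∑ F (subsequences xs) + ∑ (F ∘ (x ∷_)) (subsequences xs)
      ≡⟨ cong₂ _+_ (∑-subsequences-singletons F F[] F0 xs)
                   (∑-subsequences-[] (F ∘ (x ∷_)) (F0 x) xs) ⟩
    ∑ (F ∘ [_]) xs + F [ x ]
      ≡⟨ ℕ.+-comm _ (F [ x ]) ⟩
    ∑ (F ∘ [_]) (x ∷ xs) ∎
    where open ≡-Reasoning

  -- Both sides count the subsequences with one marked entry.
  ∑-subsequences-marked : (F : List A → ℕ) →
    (∀ {xs ys} → xs ↭ ys → F xs ≡ F ys) → (∀ x xs → F (x ∷ x ∷ xs) ≡ 0) → ∀ xs →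
    ∑ (λ bs → length bs * F bs) (subsequences xs) ≡ ∑ (λ d → ∑ (F ∘ (d ∷_)) (subsequences xs)) xs
  ∑-subsequences-marked F F-↭ F-dup []       = refl
  ∑-subsequences-marked F F-↭ F-dup (x ∷ xs) = begin
    ∑ (λ bs → length bs * F bs) (subsequences (x ∷ xs))
      ≡⟨ ∑-subsequences-∷ _ x xs ⟩
    ∑ (λ bs → length bs * F bs) (subsequences xs) +
    ∑ (λ bs → F (x ∷ bs) + length bs * F (x ∷ bs)) (subsequences xs)
      ≡⟨ cong₂ _+_ (∑-subsequences-marked F F-↭ F-dup xs)
                   (∑-+ (F ∘ (x ∷_)) _ (subsequences xs)) ⟩
    X + (Y + ∑ (λ bs → length bs * F (x ∷ bs)) (subsequences xs))
      -- The induction hypothesis is used a second time, for `F` with `x` already inserted.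
      -- Vanishing on a repeated entry then requires `x` to be permuted behind the two copies.
      ≡⟨ cong (λ z → X + (Y + z))
           (∑-subsequences-marked (F ∘ (x ∷_)) (F-↭ ∘ prep x)
             (λ y ys → ≡-trans (F-↭ (trans (swap x y ↭-refl) (prep y (swap x y ↭-refl)))) (F-dup y _)) xs) ⟩
    X + (Y + Z)
      ≡⟨ rearrange X Y Z ⟩
    (Y + 0) + (X + Z)
      -- The zero comes from the lists in which the marked entry `x` is picked once more.
      ≡⟨ cong₂ _+_ (cong (Y +_) (∑-zero (F-dup x) (subsequences xs)))
                   (∑-+ (λ d → ∑ (F ∘ (d ∷_)) (subsequences xs)) _ xs) ⟨
    (Y + ∑ (λ bs → F (x ∷ x ∷ bs)) (subsequences xs)) +
    ∑ (λ d → ∑ (F ∘ (d ∷_)) (subsequences xs) + ∑ (λ bs → F (x ∷ d ∷ bs)) (subsequences xs)) xs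
      ≡⟨ cong₂ _+_ (∑-subsequences-∷ (F ∘ (x ∷_)) x xs)
           (∑-cong (λ d → ≡-trans (∑-subsequences-∷ (F ∘ (d ∷_)) x xs)
             (cong (∑ (F ∘ (d ∷_)) (subsequences xs) +_)
               (∑-cong (λ bs → F-↭ (swap d x ↭-refl)) (subsequences xs)))) xs) ⟨
    ∑ (λ d → ∑ (F ∘ (d ∷_)) (subsequences (x ∷ xs))) (x ∷ xs) ∎
    where
    open ≡-Reasoning
    X Y Z : ℕ
    X = ∑ (λ d → ∑ (F ∘ (d ∷_)) (subsequences xs)) xs
    Y = ∑ (F ∘ (x ∷_)) (subsequences xs)
    Z = ∑ (λ d → ∑ (λ bs → F (x ∷ d ∷ bs)) (subsequences xs)) xs
    rearrange : ∀ a b c → a + (b + c) ≡ (b + 0) + (a + c)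
    rearrange = solve-∀

  -- The recursion of the Stirling numbers of the second kind

  allSubsets : ∀ n → List (Subset n)
  allSubsets = vectors (outside ∷ inside ∷ [])

  partitionWeight : ∀ n → ℕ → List (Subset n) → ℕ
  partitionWeight n k bs = ⟦ isPartition? n k bs ⟧

  stirling₂-∑ : ∀ n k → stirling₂ n k ≡ ∑ (partitionWeight n k) (subsequences (allSubsets n))
  stirling₂-∑ n k = length-filter-∑ (isPartition? n k) (subsequences (allSubsets n))

  Disjoint : ∀ {n} → Subset n → Subset n → Set
  Disjoint p q = Empty (p ∩ q)

  Disjoint-sym : ∀ {n} {p q : Subset n} → Disjoint p q → Disjoint q p
  Disjoint-sym {p = p} {q} e (x , x∈) = e (x , subst (x ∈_) (Subset.∩-comm q p) x∈)

  IsPartition-resp-↭ : ∀ {n k bs cs} → bs ↭ cs → IsPartition n k bs → IsPartition n k cs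
  IsPartition-resp-↭ p (len , ne , dis , cov) =
    ≡-trans (sym (Perm.↭-length p)) len ,
    Perm.All-resp-↭ p ne ,
    PermSetoid.AllPairs-resp-↭ (setoid _) Disjoint-sym (resp₂ Disjoint) (↭⇒↭ₛ p) dis ,
    λ i → Perm.Any-resp-↭ p (cov i)

  partitionWeight-≡0 : ∀ n k bs → ¬ IsPartition n k bs → partitionWeight n k bs ≡ 0
  partitionWeight-≡0 n k bs = ⟦⟧-false (isPartition? n k bs)

  partitionWeight-↭ : ∀ n k {bs cs} → bs ↭ cs → partitionWeight n k bs ≡ partitionWeight n k cs
  partitionWeight-↭ n k p =
    ⟦⟧-⇔ (mk⇔ (IsPartition-resp-↭ p) (IsPartition-resp-↭ (↭-sym p))) (isPartition? n k _) (isPartition? n k _)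

  -- A nonempty block is not disjoint from itself. This supplies the vanishing hypothesis of
  -- `∑-subsequences-marked`.
  partitionWeight-dup : ∀ n k b bs → partitionWeight n k (b ∷ b ∷ bs) ≡ 0
  partitionWeight-dup n k b bs = partitionWeight-≡0 n k (b ∷ b ∷ bs)
    λ { (_ , ((x , x∈b) ∷ _) , ((b∩b ∷ _) ∷ _) , _) → b∩b (x , Subset.x∈p∩q⁺ (x∈b , x∈b)) }

  length*partitionWeight : ∀ {n} k bs → length bs * partitionWeight n k bs ≡ k * partitionWeight n k bs
  length*partitionWeight k bs = *-⟦⟧-cong (isPartition? _ k bs) proj₁

  -- The blocks of a partition of Fin (suc n) are d ∪ {zero} and the sets of cs.
  module _ {n : ℕ} (d : Subset n) (cs : List (Subset n)) where

    with-zero : List (Subset (suc n))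
    with-zero = (inside ∷ d) ∷ map (outside ∷_) cs

    private
      -- The set `d` is exempt from nonemptiness, since `zero` already makes its extension nonempty.
      -- This freedom is the source of the two terms of the recursion.
      Core : ℕ → Set
      Core k = length cs ≡ k × All Nonempty cs × All (Disjoint d) cs × AllPairs Disjoint cs ×
               (∀ i → Any (i ∈_) (d ∷ cs))

      lift : ∀ {i} → Any (i ∈_) (d ∷ cs) → Any (suc i ∈_) with-zero
      lift (here i∈d)  = here (there i∈d)
      lift (there any) = there (Any.map⁺ (Any.map there any))

      unlift : ∀ {i} → Any (suc i ∈_) with-zero → Any (i ∈_) (d ∷ cs)
      unlift (here (there i∈d)) = here i∈d
      unlift (there any)        = there (Any.map (λ { (there i∈b) → i∈b }) (Any.map⁻ any))

      to-core : ∀ {k} → IsPartition (suc n) (suc k) with-zero → Core k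
      to-core (len , (_ ∷ ne) , (d# ∷ dis) , cov) =
        ≡-trans (sym (length-map _ cs)) (ℕ.suc-injective len) ,
        All.map (λ { (suc i , there i∈b) → i , i∈b }) (All.map⁻ ne) ,
        All.map (λ { e (i , i∈) → e (suc i , there i∈) }) (All.map⁻ d#) ,
        AllPairs.map (λ { e (i , i∈) → e (suc i , there i∈) }) (AllPairs.map⁻ dis) ,
        λ i → unlift (cov (suc i))

      from-core : ∀ {k} → Core k → IsPartition (suc n) (suc k) with-zero
      from-core (len , ne , d# , dis , cov) =
        cong suc (≡-trans (length-map _ cs) len) ,
        ((zero , here) ∷ All.map⁺ (All.map (λ { (i , i∈b) → suc i , there i∈b }) ne)) ,
        (All.map⁺ (All.map (λ { e (suc i , there i∈) → e (i , i∈) }) d#) ∷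
         AllPairs.map⁺ (AllPairs.map (λ { e (suc i , there i∈) → e (i , i∈) }) dis)) ,
        λ { zero → here here ; (suc i) → lift (cov i) }

    with-zero-nonempty : ∀ {k} → Nonempty d →
      IsPartition (suc n) (suc k) with-zero ⇔ IsPartition n (suc k) (d ∷ cs)
    with-zero-nonempty ne-d = mk⇔
      (λ p → let (len , ne , d# , dis , cov) = to-core p in
             cong suc len , ne-d ∷ ne , d# ∷ dis , cov)
      (λ { (len , (_ ∷ ne) , (d# ∷ dis) , cov) →
           from-core (ℕ.suc-injective len , ne , d# , dis , cov) })

    with-zero-empty : ∀ {k} → Empty d →
      IsPartition (suc n) (suc k) with-zero ⇔ IsPartition n k cs
    with-zero-empty e-d = mk⇔
      (λ p → let (len , ne , d# , dis , cov) = to-core p in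
             len , ne , dis , λ i → drop (cov i))
      (λ { (len , ne , dis , cov) →
           from-core (len , ne ,
             All.universal (λ q (i , i∈) → e-d (i , proj₁ (Subset.x∈p∩q⁻ d q i∈))) cs ,
             dis , λ i → there (cov i)) })
      where
      drop : ∀ {i} → Any (i ∈_) (d ∷ cs) → Any (i ∈_) cs
      drop (here i∈d)  = contradiction (_ , i∈d) e-d
      drop (there any) = any

    -- If `d` is nonempty, deleting `zero` keeps the number of blocks; if `d` is empty, `zero` was a
    -- block of its own and one block disappears. In each case the other summand vanishes.
    with-zero-weight : ∀ k → partitionWeight (suc n) (suc k) with-zero ≡
      ⟦ ¬? (Subset.nonempty? d) ⟧ * partitionWeight n k cs + partitionWeight n (suc k) (d ∷ cs)
    with-zero-weight k = by-cases (Subset.nonempty? d)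
      where
      open ≡-Reasoning
      by-cases : (d? : Dec (Nonempty d)) → partitionWeight (suc n) (suc k) with-zero ≡
        ⟦ ¬? d? ⟧ * partitionWeight n k cs + partitionWeight n (suc k) (d ∷ cs)
      by-cases (yes ne-d) = ⟦⟧-⇔ (with-zero-nonempty ne-d) (isPartition? _ _ _) (isPartition? _ _ _)
      by-cases (no e-d) = begin
        partitionWeight (suc n) (suc k) with-zero
          ≡⟨ ⟦⟧-⇔ (with-zero-empty e-d) (isPartition? _ _ _) (isPartition? _ _ _) ⟩
        partitionWeight n k cs
          ≡⟨ ℕ.*-identityˡ _ ⟨
        1 * partitionWeight n k cs
          ≡⟨ ℕ.+-identityʳ _ ⟨
        1 * partitionWeight n k cs + 0
          ≡⟨ cong (1 * partitionWeight n k cs +_)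
               (partitionWeight-≡0 n (suc k) (d ∷ cs) (λ { (_ , (ne-d ∷ _) , _) → e-d ne-d })) ⟨
        1 * partitionWeight n k cs + partitionWeight n (suc k) (d ∷ cs) ∎

  allSubsets-suc : ∀ n → allSubsets (suc n) ≡
                   map (outside ∷_) (allSubsets n) ++ map (inside ∷_) (allSubsets n)
  allSubsets-suc n = cong (map (outside ∷_) (allSubsets n) ++_) (++-identityʳ _)

  ∑-allSubsets-suc : ∀ {n} (f : Subset (suc n) → ℕ) →
    ∑ f (allSubsets (suc n)) ≡ ∑ (f ∘ (outside ∷_)) (allSubsets n) + ∑ (f ∘ (inside ∷_)) (allSubsets n)
  ∑-allSubsets-suc {n} f = begin
    ∑ f (allSubsets (suc n))
      ≡⟨ cong (∑ f) (allSubsets-suc n) ⟩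
    ∑ f (map (outside ∷_) (allSubsets n) ++ map (inside ∷_) (allSubsets n))
      ≡⟨ ∑-++ f (map (outside ∷_) (allSubsets n)) _ ⟩
    ∑ f (map (outside ∷_) (allSubsets n)) + ∑ f (map (inside ∷_) (allSubsets n))
      ≡⟨ cong₂ _+_ (∑-map f (outside ∷_) (allSubsets n)) (∑-map f (inside ∷_) (allSubsets n)) ⟩
    _ ∎
    where open ≡-Reasoning

  count-empty : ∀ n → ∑ (λ d → ⟦ ¬? (Subset.nonempty? d) ⟧) (allSubsets n) ≡ 1
  count-empty zero    = refl
  count-empty (suc n) = begin
    ∑ (λ d → ⟦ ¬? (Subset.nonempty? d) ⟧) (allSubsets (suc n))
      ≡⟨ ∑-allSubsets-suc {n} _ ⟩
    ∑ (λ d → ⟦ ¬? (Subset.nonempty? (outside ∷ d)) ⟧) (allSubsets n) +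
    ∑ (λ d → ⟦ ¬? (Subset.nonempty? (inside ∷ d)) ⟧) (allSubsets n)
      ≡⟨ cong₂ _+_
           (∑-cong (λ d → ⟦⟧-⇔ (mk⇔ (λ e (i , i∈) → e (suc i , there i∈))
                                    (λ { e (suc i , there i∈) → e (i , i∈) }))
                                (¬? (Subset.nonempty? (outside ∷ d))) (¬? (Subset.nonempty? d)))
                   (allSubsets n))
           (∑-zero (λ d → ⟦⟧-false (¬? (Subset.nonempty? (inside ∷ d))) (λ e → e (zero , here)))
                   (allSubsets n)) ⟩
    ∑ (λ d → ⟦ ¬? (Subset.nonempty? d) ⟧) (allSubsets n) + 0
      ≡⟨ cong (_+ 0) (count-empty n) ⟩
    1 ∎
    where open ≡-Reasoning

  ∑-swap : (f : A → B → ℕ) → ∀ xs ys →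
           ∑ (λ x → ∑ (f x) ys) xs ≡ ∑ (λ y → ∑ (λ x → f x y) xs) ys
  ∑-swap f []       ys = sym (∑-zero (λ _ → refl) ys)
  ∑-swap f (x ∷ xs) ys =
    ≡-trans (cong (∑ (f x) ys +_) (∑-swap f xs ys)) (sym (∑-+ (f x) _ ys))

  -- The subsets of `Fin (suc n)` either avoid or contain `zero`, and a partition uses exactly one
  -- `inside ∷ d` of the second kind. The empty `d` yields the first term. Summing the other term
  -- over all `d` counts partitions of `Fin n` with a marked block, hence the factor `suc k`.
  stirling₂-suc-suc : ∀ n k → stirling₂ (suc n) (suc k) ≡ stirling₂ n k + suc k * stirling₂ n (suc k)
  stirling₂-suc-suc n k = begin
    stirling₂ (suc n) (suc k)
      ≡⟨ stirling₂-∑ (suc n) (suc k) ⟩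
    ∑ W (subsequences (allSubsets (suc n)))
      ≡⟨ cong (∑ W ∘ subsequences) (allSubsets-suc n) ⟩
    ∑ W (subsequences (map (outside ∷_) L ++ map (inside ∷_) L))
      ≡⟨ ∑-subsequences-++ W (map (outside ∷_) L) _ ⟩
    ∑ (λ as → ∑ (λ bs → W (as ++ bs)) (subsequences (map (inside ∷_) L)))
      (subsequences (map (outside ∷_) L))
      ≡⟨ ∑-subsequences-map _ (outside ∷_) L ⟩
    ∑ (λ cs → ∑ (λ bs → W (map (outside ∷_) cs ++ bs)) (subsequences (map (inside ∷_) L)))
      (subsequences L)
      ≡⟨ ∑-cong (λ cs → one-inside cs) (subsequences L) ⟩
    ∑ (λ cs → ∑ (λ d → ⟦ ¬? (Subset.nonempty? d) ⟧ * V k cs + V (suc k) (d ∷ cs)) L)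
      (subsequences L)
      ≡⟨ ∑-swap (λ cs d → ⟦ ¬? (Subset.nonempty? d) ⟧ * V k cs + V (suc k) (d ∷ cs)) (subsequences L) L ⟩
    ∑ (λ d → ∑ (λ cs → ⟦ ¬? (Subset.nonempty? d) ⟧ * V k cs + V (suc k) (d ∷ cs)) (subsequences L)) L
      ≡⟨ ∑-cong (λ d → ≡-trans (∑-+ (λ cs → ⟦ ¬? (Subset.nonempty? d) ⟧ * V k cs) _ (subsequences L))
           (cong (_+ ∑ (V (suc k) ∘ (d ∷_)) (subsequences L))
             (≡-trans (∑-*ˡ ⟦ ¬? (Subset.nonempty? d) ⟧ (V k) (subsequences L))
                      (ℕ.*-comm ⟦ ¬? (Subset.nonempty? d) ⟧ _)))) L ⟩
    ∑ (λ d → ∑ (V k) (subsequences L) * ⟦ ¬? (Subset.nonempty? d) ⟧ +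
             ∑ (V (suc k) ∘ (d ∷_)) (subsequences L)) L
      ≡⟨ ∑-+ (λ d → ∑ (V k) (subsequences L) * ⟦ ¬? (Subset.nonempty? d) ⟧) _ L ⟩
    ∑ (λ d → ∑ (V k) (subsequences L) * ⟦ ¬? (Subset.nonempty? d) ⟧) L +
    ∑ (λ d → ∑ (V (suc k) ∘ (d ∷_)) (subsequences L)) L
      ≡⟨ cong₂ _+_
           (≡-trans (∑-*ˡ (∑ (V k) (subsequences L)) _ L)
             (≡-trans (cong (∑ (V k) (subsequences L) *_) (count-empty n)) (ℕ.*-identityʳ _)))
           (sym (∑-subsequences-marked (V (suc k)) (partitionWeight-↭ n (suc k)) (partitionWeight-dup n (suc k)) L)) ⟩
    ∑ (V k) (subsequences L) + ∑ (λ bs → length bs * V (suc k) bs) (subsequences L)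
      ≡⟨ cong₂ _+_ (sym (stirling₂-∑ n k))
           (≡-trans (∑-cong (length*partitionWeight (suc k)) (subsequences L))
             (≡-trans (∑-*ˡ (suc k) (V (suc k)) (subsequences L))
                      (cong (suc k *_) (sym (stirling₂-∑ n (suc k)))))) ⟩
    stirling₂ n k + suc k * stirling₂ n (suc k) ∎
    where
    open ≡-Reasoning
    L = allSubsets n
    W : List (Subset (suc n)) → ℕ
    W = partitionWeight (suc n) (suc k)
    V : ℕ → List (Subset n) → ℕ
    V = partitionWeight n
    none : ∀ cs → W (map (outside ∷_) cs ++ []) ≡ 0
    none cs = partitionWeight-≡0 (suc n) (suc k) (map (outside ∷_) cs ++ []) λ (_ , _ , _ , cov) →
      uncovered (subst (Any (zero ∈_)) (++-identityʳ _) (cov zero))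
      where
      uncovered : ¬ Any (zero ∈_) (map (outside ∷_) cs)
      uncovered any with Any.satisfied (Any.map⁻ any)
      ... | _ , ()
    two : ∀ cs a b bs → W (map (outside ∷_) cs ++ map (inside ∷_) (a ∷ b ∷ bs)) ≡ 0
    two cs a b bs = ≡-trans (partitionWeight-↭ (suc n) (suc k) (Perm.++-comm (map (outside ∷_) cs) _))
      (partitionWeight-≡0 (suc n) (suc k) (map (inside ∷_) (a ∷ b ∷ bs) ++ map (outside ∷_) cs)
        λ { (_ , _ , ((a#b ∷ _) ∷ _) , _) → a#b (zero , here) })
    one-inside : ∀ cs → ∑ (λ bs → W (map (outside ∷_) cs ++ bs)) (subsequences (map (inside ∷_) L)) ≡
                 ∑ (λ d → ⟦ ¬? (Subset.nonempty? d) ⟧ * V k cs + V (suc k) (d ∷ cs)) L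
    one-inside cs = begin
      ∑ (λ bs → W (map (outside ∷_) cs ++ bs)) (subsequences (map (inside ∷_) L))
        ≡⟨ ∑-subsequences-map _ (inside ∷_) L ⟩
      ∑ (λ bs → W (map (outside ∷_) cs ++ map (inside ∷_) bs)) (subsequences L)
        ≡⟨ ∑-subsequences-singletons _ (none cs) (two cs) L ⟩
      ∑ (λ d → W (map (outside ∷_) cs ++ [ inside ∷ d ])) L
        ≡⟨ ∑-cong (λ d → ≡-trans (partitionWeight-↭ (suc n) (suc k) (Perm.++-comm (map (outside ∷_) cs) _))
                                 (with-zero-weight d cs k)) L ⟩
      _ ∎

  stirling₂-zero-suc : ∀ k → stirling₂ 0 (suc k) ≡ 0
  stirling₂-zero-suc k = ≡-trans (stirling₂-∑ 0 (suc k))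
    (≡-trans (cong (_+ 0) (⟦⟧-false (isPartition? 0 (suc k) ([] ∷ [])) λ { (_ , ((() , _) ∷ _) , _) }))
             refl)

  stirling₂-suc-zero : ∀ n → stirling₂ (suc n) 0 ≡ 0
  stirling₂-suc-zero n = ≡-trans (stirling₂-∑ (suc n) 0)
    (∑-zero (λ bs → ⟦⟧-false (isPartition? (suc n) 0 bs) (uncovered bs)) (subsequences (allSubsets (suc n))))
    where
    uncovered : ∀ bs → ¬ IsPartition (suc n) 0 bs
    uncovered [] (_ , _ , _ , cov) with () ← cov zero

  -- Binomial convolutions and Stirling numbers

  -- binomialSum n f = Σ_i (n choose i) · f i (n − i)
  binomialSum : ℕ → (ℕ → ℕ → ℕ) → ℕ
  binomialSum zero    f = f 0 0
  binomialSum (suc n) f = binomialSum n (f ∘ suc) + binomialSum n (λ i j → f i (suc j))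

  binomialSum-cong : ∀ n {f g} → (∀ i j → i + j ≡ n → f i j ≡ g i j) → binomialSum n f ≡ binomialSum n g
  binomialSum-cong zero    f≗g = f≗g 0 0 refl
  binomialSum-cong (suc n) f≗g = cong₂ _+_
    (binomialSum-cong n (λ i j eq → f≗g (suc i) j (cong suc eq)))
    (binomialSum-cong n (λ i j eq → f≗g i (suc j) (≡-trans (ℕ.+-suc i j) (cong suc eq))))

  binomialSum-+ : ∀ n f g → binomialSum n (λ i j → f i j + g i j) ≡ binomialSum n f + binomialSum n g
  binomialSum-+ zero    f g = refl
  binomialSum-+ (suc n) f g =
    ≡-trans (cong₂ _+_ (binomialSum-+ n _ _) (binomialSum-+ n _ _))
            (medial (binomialSum n (f ∘ suc)) (binomialSum n (g ∘ suc)) _ _)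
    where
    medial : ∀ a b c d → (a + b) + (c + d) ≡ (a + c) + (b + d)
    medial = solve-∀

  binomialSum-*ˡ : ∀ n c f → binomialSum n (λ i j → c * f i j) ≡ c * binomialSum n f
  binomialSum-*ˡ zero    c f = refl
  binomialSum-*ˡ (suc n) c f =
    ≡-trans (cong₂ _+_ (binomialSum-*ˡ n c _) (binomialSum-*ˡ n c _))
            (sym (ℕ.*-distribˡ-+ c (binomialSum n (f ∘ suc)) _))

  binomialSum-0 : ∀ n {f} → (∀ i j → f i j ≡ 0) → binomialSum n f ≡ 0
  binomialSum-0 zero    f≗0 = f≗0 0 0
  binomialSum-0 (suc n) f≗0 =
    cong₂ _+_ (binomialSum-0 n (λ i → f≗0 (suc i))) (binomialSum-0 n (λ i j → f≗0 i (suc j)))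

  ∑-binomialSum : ∀ n (f : A → ℕ → ℕ → ℕ) xs →
    ∑ (λ x → binomialSum n (f x)) xs ≡ binomialSum n (λ i j → ∑ (λ x → f x i j) xs)
  ∑-binomialSum n f []       = sym (binomialSum-0 n (λ _ _ → refl))
  ∑-binomialSum n f (x ∷ xs) =
    ≡-trans (cong (binomialSum n (f x) +_) (∑-binomialSum n f xs)) (sym (binomialSum-+ n (f x) _))

  positivePart : (ℕ → ℕ → ℕ) → ℕ → ℕ → ℕ
  positivePart f zero    j = 0
  positivePart f (suc i) j = f (suc i) j

  binomialSum-split : ∀ n f → binomialSum n f ≡ f 0 n + binomialSum n (positivePart f)
  binomialSum-split zero    f = sym (ℕ.+-identityʳ _)
  binomialSum-split (suc n) f = begin
    binomialSum n (f ∘ suc) + binomialSum n (λ i j → f i (suc j))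
      ≡⟨ cong (binomialSum n (f ∘ suc) +_) (binomialSum-split n _) ⟩
    binomialSum n (f ∘ suc) + (f 0 (suc n) + binomialSum n (positivePart (λ i j → f i (suc j))))
      ≡⟨ rearrange (binomialSum n (f ∘ suc)) (f 0 (suc n)) _ ⟩
    f 0 (suc n) + (binomialSum n (f ∘ suc) + binomialSum n (positivePart (λ i j → f i (suc j))))
      ≡⟨ cong (λ z → f 0 (suc n) + (binomialSum n (f ∘ suc) + z))
           (binomialSum-cong n λ { zero j _ → refl ; (suc i) j _ → refl }) ⟩
    f 0 (suc n) + binomialSum (suc n) (positivePart f) ∎
    where
    open ≡-Reasoning
    rearrange : ∀ a b c → a + (b + c) ≡ b + (a + c)
    rearrange = solve-∀

  -- This is the absorption identity: `i` times the binomial coefficient of `suc n` over `i` equals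
  -- `suc n` times that of `n` over `i − 1`.
  binomialSum-weighted : ∀ n g →
    binomialSum (suc n) (λ i j → i * g i j) ≡ suc n * binomialSum n (g ∘ suc)
  binomialSum-weighted zero    g = base (g 1 0)
    where
    base : ∀ a → (a + 0) + 0 ≡ a + 0
    base = solve-∀
  binomialSum-weighted (suc n) g = begin
    binomialSum (suc n) (λ i j → g (suc i) j + i * g (suc i) j) +
    binomialSum (suc n) (λ i j → i * g i (suc j))
      ≡⟨ cong₂ _+_ (≡-trans (binomialSum-+ (suc n) (g ∘ suc) (λ i j → i * g (suc i) j))
                            (cong (binomialSum (suc n) (g ∘ suc) +_) (binomialSum-weighted n (g ∘ suc))))
                   (binomialSum-weighted n (λ i j → g i (suc j))) ⟩
    ((a + b) + suc n * a) + suc n * b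
      ≡⟨ collect n a b ⟩
    suc (suc n) * (a + b) ∎
    where
    open ≡-Reasoning
    a b : ℕ
    a = binomialSum n (λ i → g (suc (suc i)))
    b = binomialSum n (λ i j → g (suc i) (suc j))
    collect : ∀ n a b → ((a + b) + (1 + n) * a) + (1 + n) * b ≡ (2 + n) * (a + b)
    collect = solve-∀

  -- Combinatorially, the block of one extra element takes `i` of the `n` other elements, and the
  -- remaining `j` are partitioned into `k` blocks. The proof compares Pascal's rule inside
  -- `binomialSum` with the Stirling recursion.
  stirling₂-binomialSum : ∀ n k → stirling₂ (suc n) (suc k) ≡ binomialSum n (λ _ j → stirling₂ j k)
  stirling₂-binomialSum zero    k = begin
    stirling₂ 1 (suc k)
      ≡⟨ stirling₂-suc-suc 0 k ⟩
    stirling₂ 0 k + suc k * stirling₂ 0 (suc k)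
      ≡⟨ cong (λ z → stirling₂ 0 k + suc k * z) (stirling₂-zero-suc k) ⟩
    stirling₂ 0 k + suc k * 0
      ≡⟨ cong (stirling₂ 0 k +_) (ℕ.*-zeroʳ (suc k)) ⟩
    stirling₂ 0 k + 0
      ≡⟨ ℕ.+-identityʳ _ ⟩
    stirling₂ 0 k ∎
    where open ≡-Reasoning
  stirling₂-binomialSum (suc n) k = begin
    stirling₂ (suc (suc n)) (suc k)
      ≡⟨ stirling₂-suc-suc (suc n) k ⟩
    stirling₂ (suc n) k + suc k * stirling₂ (suc n) (suc k)
      -- One of the `suc k` copies is split off, so that the two summands match the two halves of
      -- Pascal's rule.
      ≡⟨ rearrange (stirling₂ (suc n) k) k (stirling₂ (suc n) (suc k)) ⟩
    stirling₂ (suc n) (suc k) + (stirling₂ (suc n) k + k * stirling₂ (suc n) (suc k))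
      ≡⟨ cong₂ _+_ (stirling₂-binomialSum n k) (shifted k) ⟩
    binomialSum n (λ _ j → stirling₂ j k) + binomialSum n (λ _ j → stirling₂ (suc j) k) ∎
    where
    open ≡-Reasoning
    rearrange : ∀ a k b → a + (1 + k) * b ≡ b + (a + k * b)
    rearrange = solve-∀
    shifted : ∀ k → stirling₂ (suc n) k + k * stirling₂ (suc n) (suc k) ≡
                    binomialSum n (λ _ j → stirling₂ (suc j) k)
    shifted zero    = ≡-trans (≡-trans (ℕ.+-identityʳ _) (stirling₂-suc-zero n))
                              (sym (binomialSum-0 n (λ _ → stirling₂-suc-zero)))
    shifted (suc k) = begin
      stirling₂ (suc n) (suc k) + suc k * stirling₂ (suc n) (suc (suc k))
        ≡⟨ cong₂ (λ a b → a + suc k * b) (stirling₂-binomialSum n k) (stirling₂-binomialSum n (suc k)) ⟩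
      binomialSum n (λ _ j → stirling₂ j k) + suc k * binomialSum n (λ _ j → stirling₂ j (suc k))
        ≡⟨ cong (binomialSum n (λ _ j → stirling₂ j k) +_) (binomialSum-*ˡ n (suc k) _) ⟨
      binomialSum n (λ _ j → stirling₂ j k) + binomialSum n (λ _ j → suc k * stirling₂ j (suc k))
        ≡⟨ binomialSum-+ n _ _ ⟨
      binomialSum n (λ _ j → stirling₂ j k + suc k * stirling₂ j (suc k))
        ≡⟨ binomialSum-cong n (λ _ j _ → stirling₂-suc-suc j k) ⟨
      binomialSum n (λ _ j → stirling₂ (suc j) (suc k)) ∎

  -- A partition together with one of its blocks.
  stirling₂-marked-block : ∀ n k →
    binomialSum n (positivePart (λ _ j → stirling₂ j k)) ≡ suc k * stirling₂ n (suc k)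
  stirling₂-marked-block n k = ℕ.+-cancelˡ-≡ (stirling₂ n k) _ _ (begin
    stirling₂ n k + binomialSum n (positivePart (λ _ j → stirling₂ j k))
      ≡⟨ binomialSum-split n _ ⟨
    binomialSum n (λ _ j → stirling₂ j k)
      ≡⟨ stirling₂-binomialSum n k ⟨
    stirling₂ (suc n) (suc k)
      ≡⟨ stirling₂-suc-suc n k ⟩
    stirling₂ n k + suc k * stirling₂ n (suc k) ∎)
    where open ≡-Reasoning

  -- A partition together with one of its elements, counted through the block of that element.
  stirling₂-marked-element : ∀ n k →
    binomialSum n (λ i j → i * stirling₂ j k) ≡ n * stirling₂ n (suc k)
  stirling₂-marked-element zero    k = refl
  stirling₂-marked-element (suc n) k =
    ≡-trans (binomialSum-weighted n (λ _ j → stirling₂ j k))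
            (cong (suc n *_) (sym (stirling₂-binomialSum n k)))

  -- Occurrence vectors and the slack recursion

  content : ∀ {m n} → Vec (Fin m) n → Vec ℕ m
  content []      = replicate _ 0
  content (x ∷ w) = updateAt (content w) x suc

  words : ∀ m n → List (Vec (Fin m) n)
  words m = vectors (allFin m)

  ∑-content : ∀ m n → (Vec ℕ m → ℕ) → ℕ
  ∑-content m n F = ∑ (F ∘ content) (words m n)

  ∑-content-suc : ∀ m n F →
    ∑-content m (suc n) F ≡ ∑ (λ x → ∑-content m n (λ c → F (updateAt c x suc))) (allFin m)
  ∑-content-suc m n F =
    ≡-trans (∑-concatMap (F ∘ content) (λ x → map (x ∷_) (words m n)) (allFin m))
            (∑-cong (λ x → ∑-map (F ∘ content) (x ∷_) (words m n)) (allFin m))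

  ∑-allFin-suc : ∀ m (f : Fin (suc m) → ℕ) → ∑ f (allFin (suc m)) ≡ f zero + ∑ (f ∘ suc) (allFin m)
  ∑-allFin-suc m f = cong (f zero +_)
    (≡-trans (cong (∑ f) (sym (map-tabulate id suc))) (∑-map f suc (allFin m)))

  -- Removing the letter 1, which occurs i times.
  ∑-content-remove : ∀ m n F →
    ∑-content (suc m) n F ≡ binomialSum n (λ i j → ∑-content m j (λ c → F (i ∷ c)))
  ∑-content-remove m zero    F = refl
  ∑-content-remove m (suc n) F = begin
    ∑-content (suc m) (suc n) F
      ≡⟨ ∑-content-suc (suc m) n F ⟩
    ∑ (λ x → ∑-content (suc m) n (λ c → F (updateAt c x suc))) (allFin (suc m))
      -- Whether the first position of the word carries the removed letter is the choice made by
      -- Pascal's rule in `binomialSum`.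
      ≡⟨ ∑-allFin-suc m _ ⟩
    ∑-content (suc m) n (λ c → F (updateAt c zero suc)) +
    ∑ (λ x → ∑-content (suc m) n (λ c → F (updateAt c (suc x) suc))) (allFin m)
      ≡⟨ cong₂ _+_ (∑-content-remove m n (λ c → F (updateAt c zero suc)))
           (∑-cong (λ x → ∑-content-remove m n (λ c → F (updateAt c (suc x) suc))) (allFin m)) ⟩
    binomialSum n (λ i j → ∑-content m j (λ c → F (suc i ∷ c))) +
    ∑ (λ x → binomialSum n (λ i j → ∑-content m j (λ c → F (i ∷ updateAt c x suc)))) (allFin m)
      ≡⟨ cong (binomialSum n (λ i j → ∑-content m j (λ c → F (suc i ∷ c))) +_)
           (≡-trans (∑-binomialSum n _ (allFin m))
                    (binomialSum-cong n (λ i j _ → sym (∑-content-suc m j (F ∘ (i ∷_)))))) ⟩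
    binomialSum (suc n) (λ i j → ∑-content m j (λ c → F (i ∷ c))) ∎
    where open ≡-Reasoning

  -- parkingWeight a k c is 1 if the support of c has size k and a parking process that starts with
  -- a free cars (counting one for the current spot) never runs out of cars before the letters end.
  parkingWeight : ∀ {m} → ℕ → ℕ → Vec ℕ m → ℕ
  parkingWeight zero    k       c           = 0
  parkingWeight (suc s) zero    []          = 1
  parkingWeight (suc s) (suc k) []          = 0
  parkingWeight (suc s) k       (zero ∷ c)  = parkingWeight s k c
  parkingWeight (suc s) zero    (suc i ∷ c) = 0
  parkingWeight (suc s) (suc k) (suc i ∷ c) = parkingWeight (s + suc i) k c

  parkingCount : ℕ → ℕ → ℕ → ℕ → ℕ
  parkingCount m a n k = ∑-content m n (parkingWeight a k)

  parkingCount-slackless : ∀ m n k → parkingCount m 0 n k ≡ 0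
  parkingCount-slackless m n k = ∑-zero (λ _ → refl) (words m n)

  -- The term in which the first letter does not occur costs one car and leaves `k` unchanged, so it
  -- is again a `parkingCount`. The case distinction on `k` lets `parkingWeight` compute.
  parkingCount-remove : ∀ m s n k → parkingCount (suc m) (suc s) n k ≡
    parkingCount m s n k +
    binomialSum n (positivePart (λ i j → ∑-content m j (λ c → parkingWeight (suc s) k (i ∷ c))))
  parkingCount-remove m s n zero = ≡-trans (∑-content-remove m n (parkingWeight (suc s) zero))
    (binomialSum-split n (λ i j → ∑-content m j (λ c → parkingWeight (suc s) zero (i ∷ c))))
  parkingCount-remove m s n (suc k) = ≡-trans (∑-content-remove m n (parkingWeight (suc s) (suc k)))
    (binomialSum-split n (λ i j → ∑-content m j (λ c → parkingWeight (suc s) (suc k) (i ∷ c))))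

  -- Only the empty word has no letters. The indicator of `n = 0` is written as `stirling₂ n 0`, the
  -- form in which `stirling₂-marked-block` takes it up.
  parkingCount-empty : ∀ m s n → n + s ≡ m → parkingCount m (suc s) n 0 ≡ stirling₂ n 0
  parkingCount-empty zero    s       zero    eq   = refl
  parkingCount-empty (suc m) s       n       eq   = begin
    parkingCount (suc m) (suc s) n 0
      ≡⟨ parkingCount-remove m s n 0 ⟩
    parkingCount m s n 0 +
    binomialSum n (positivePart (λ i j → ∑-content m j (λ c → parkingWeight (suc s) 0 (i ∷ c))))
      ≡⟨ cong₂ _+_ (rest s eq)
           (binomialSum-0 n λ { zero j → refl ; (suc i) j → ∑-zero (λ _ → refl) (words m j) }) ⟩
    stirling₂ n 0 + 0
      ≡⟨ ℕ.+-identityʳ _ ⟩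
    stirling₂ n 0 ∎
    where
    open ≡-Reasoning
    rest : ∀ s → n + s ≡ suc m → parkingCount m s n 0 ≡ stirling₂ n 0
    rest zero    eq rewrite ≡-trans (sym (ℕ.+-identityʳ n)) eq =
      ≡-trans (parkingCount-slackless m (suc m) 0) (sym (stirling₂-suc-zero m))
    rest (suc s) eq = parkingCount-empty m s n (ℕ.suc-injective (≡-trans (sym (ℕ.+-suc n s)) eq))

  -- The definition of `_P′_` splits off the smallest factor; this splits off the largest.
  P′-suc-suc : ∀ m k → (suc m P′ suc k) ≡ suc m * (m P′ k)
  P′-suc-suc m k = nP′k≡n[n∸1P′k∸1] (suc m) (suc k)

  P′>≡0 : ∀ {m k} → m ℕ.< k → (m P′ k) ≡ 0
  P′>≡0 {zero}  {suc k} m<k = cong (_* (0 P′ k)) (ℕ.0∸n≡0 k)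
  P′>≡0 {suc m} {suc k} m<k =
    ≡-trans (P′-suc-suc m k) (≡-trans (cong (suc m *_) (P′>≡0 (ℕ.s<s⁻¹ m<k))) (ℕ.*-zeroʳ (suc m)))

  -- Truncated subtraction does no harm, because `m P′ k` vanishes as soon as `k` exceeds `m`.
  [m∸k]*mP′k+k*mP′k : ∀ m k → (m ∸ k) * (m P′ k) + k * (m P′ k) ≡ m * (m P′ k)
  [m∸k]*mP′k+k*mP′k m k with k ℕ.≤? m
  ... | yes k≤m = ≡-trans (sym (ℕ.*-distribʳ-+ (m P′ k) (m ∸ k) k)) (cong (_* (m P′ k)) (ℕ.m∸n+n≡m k≤m))
  ... | no  k≰m rewrite P′>≡0 (ℕ.≰⇒> k≰m) =
    ≡-trans (cong₂ _+_ (ℕ.*-zeroʳ (m ∸ k)) (ℕ.*-zeroʳ k)) (sym (ℕ.*-zeroʳ m))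

  -- Induction on the number of letters. When the first letter occurs `i ≥ 1` times, the rest
  -- contributes a multiple of `s + i`. The part with `s` sums to `stirling₂-marked-block`, the part
  -- with `i` to `stirling₂-marked-element`.
  parkingCount-formula : ∀ m a n k → n + a ≡ suc m →
    parkingCount m a n (suc k) ≡ a * ((m P′ k) * stirling₂ n (suc k))
  parkingCount-formula m       zero    n       k eq = parkingCount-slackless m n (suc k)
  parkingCount-formula zero    (suc s) zero    k eq =
    sym (≡-trans (cong (λ z → suc s * ((0 P′ k) * z)) (stirling₂-zero-suc k))
          (≡-trans (cong (suc s *_) (ℕ.*-zeroʳ (0 P′ k))) (ℕ.*-zeroʳ (suc s))))
  parkingCount-formula zero    (suc s) (suc n) k eq with () ← ≡-trans (sym (ℕ.+-suc n s)) (ℕ.suc-injective eq)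
  parkingCount-formula (suc m) (suc s) n       k eq = begin
    parkingCount (suc m) (suc s) n (suc k)
      ≡⟨ parkingCount-remove m s n (suc k) ⟩
    parkingCount m s n (suc k) +
    binomialSum n (positivePart (λ i j → ∑-content m j (λ c → parkingWeight (suc s) (suc k) (i ∷ c))))
      ≡⟨ cong₂ _+_ (parkingCount-formula m s n k n+s≡1+m)
           (binomialSum-cong n λ { zero j _ → refl ; (suc i) j _ → refl }) ⟩
    s * ((m P′ k) * stirling₂ n (suc k)) +
    binomialSum n (positivePart (λ i j → parkingCount m (s + i) j k))
      ≡⟨ used k ⟩
    suc s * ((suc m P′ k) * stirling₂ n (suc k)) ∎
    where
    open ≡-Reasoning
    n+s≡1+m : n + s ≡ suc m
    n+s≡1+m = ℕ.suc-injective (≡-trans (sym (ℕ.+-suc n s)) eq)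
    slack : ∀ i j → i + j ≡ n → j + (s + i) ≡ suc m
    slack i j i+j≡n = ≡-trans (rearrange i j s) (≡-trans (cong (_+ s) i+j≡n) n+s≡1+m)
      where
      rearrange : ∀ i j s → j + (s + i) ≡ (i + j) + s
      rearrange = solve-∀
    used : ∀ k → s * ((m P′ k) * stirling₂ n (suc k)) +
                 binomialSum n (positivePart (λ i j → parkingCount m (s + i) j k)) ≡
                 suc s * ((suc m P′ k) * stirling₂ n (suc k))
    -- Here the first letter is the only one that occurs, so the remaining count has support size
    -- zero. The induction hypothesis speaks of `suc k` only, and `parkingCount-empty` takes its
    -- place.
    used zero    = begin
      s * (1 * stirling₂ n 1) + binomialSum n (positivePart (λ i j → parkingCount m (s + i) j 0))
        ≡⟨ cong (s * (1 * stirling₂ n 1) +_) (binomialSum-cong n all-used) ⟩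
      s * (1 * stirling₂ n 1) + binomialSum n (positivePart (λ _ j → stirling₂ j 0))
        ≡⟨ cong (s * (1 * stirling₂ n 1) +_) (stirling₂-marked-block n 0) ⟩
      s * (1 * stirling₂ n 1) + 1 * stirling₂ n 1
        ≡⟨ ℕ.+-comm (s * (1 * stirling₂ n 1)) _ ⟩
      suc s * (1 * stirling₂ n 1) ∎
      where
      all-used : ∀ i j → i + j ≡ n → positivePart (λ i j → parkingCount m (s + i) j 0) i j ≡
                                     positivePart (λ _ j → stirling₂ j 0) i j
      all-used zero    j _     = refl
      all-used (suc i) j i+j≡n = ≡-trans
        (cong (λ a → parkingCount m a j 0) (ℕ.+-suc s i))
        (parkingCount-empty m (s + i) j
          (ℕ.suc-injective (≡-trans (≡-trans (sym (ℕ.+-suc j (s + i))) (cong (j +_) (sym (ℕ.+-suc s i))))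
                                    (slack (suc i) j i+j≡n))))
    used (suc k) = begin
      s * ((m P′ suc k) * S) + binomialSum n (positivePart (λ i j → parkingCount m (s + i) j (suc k)))
        ≡⟨ cong (s * ((m P′ suc k) * S) +_) (binomialSum-cong n expand) ⟩
      s * ((m P′ suc k) * S) +
      binomialSum n (λ i j → (s * (m P′ k)) * positivePart (λ _ j → stirling₂ j (suc k)) i j +
                             (m P′ k) * (i * stirling₂ j (suc k)))
        ≡⟨ cong (s * ((m P′ suc k) * S) +_)
             (≡-trans (binomialSum-+ n _ _) (cong₂ _+_ (binomialSum-*ˡ n (s * (m P′ k)) _) (binomialSum-*ˡ n (m P′ k) _))) ⟩
      s * ((m P′ suc k) * S) +
      ((s * (m P′ k)) * binomialSum n (positivePart (λ _ j → stirling₂ j (suc k))) +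
       (m P′ k) * binomialSum n (λ i j → i * stirling₂ j (suc k)))
        ≡⟨ cong₂ (λ x y → s * ((m P′ suc k) * S) + ((s * (m P′ k)) * x + (m P′ k) * y))
             (stirling₂-marked-block n (suc k)) (stirling₂-marked-element n (suc k)) ⟩
      s * ((m ∸ k) * (m P′ k) * S) + ((s * (m P′ k)) * ((2 + k) * S) + (m P′ k) * (n * S))
        ≡⟨ collect s (m ∸ k) (m P′ k) S k n ⟩
      (s * ((m ∸ k) * (m P′ k) + k * (m P′ k)) + (2 * s + n) * (m P′ k)) * S
        ≡⟨ cong (λ z → (s * z + (2 * s + n) * (m P′ k)) * S) ([m∸k]*mP′k+k*mP′k m k) ⟩
      (s * (m * (m P′ k)) + (2 * s + n) * (m P′ k)) * S
        ≡⟨ collect′ s m (m P′ k) S n ⟩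
      (s * (1 + m) + (n + s)) * ((m P′ k) * S)
        -- The relation between length, slack and alphabet turns `n + s` into one more copy of
        -- `1 + m`, which produces the factor `suc s`.
        ≡⟨ cong (λ z → (s * (1 + m) + z) * ((m P′ k) * S)) n+s≡1+m ⟩
      (s * (1 + m) + (1 + m)) * ((m P′ k) * S)
        ≡⟨ collect″ s m (m P′ k) S ⟩
      suc s * ((1 + m) * (m P′ k) * S)
        ≡⟨ cong (λ z → suc s * (z * S)) (P′-suc-suc m k) ⟨
      suc s * ((suc m P′ suc k) * S) ∎
      where
      S : ℕ
      S = stirling₂ n (suc (suc k))
      distribute : ∀ s i p x → (s + i) * (p * x) ≡ (s * p) * x + p * (i * x)
      distribute = solve-∀
      expand : ∀ i j → i + j ≡ n → positivePart (λ i j → parkingCount m (s + i) j (suc k)) i j ≡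
        (s * (m P′ k)) * positivePart (λ _ j → stirling₂ j (suc k)) i j + (m P′ k) * (i * stirling₂ j (suc k))
      expand zero    j _     = sym (cong₂ _+_ (ℕ.*-zeroʳ (s * (m P′ k))) (ℕ.*-zeroʳ (m P′ k)))
      expand (suc i) j i+j≡n = ≡-trans (parkingCount-formula m (s + suc i) j k (slack (suc i) j i+j≡n))
                                       (distribute s (suc i) (m P′ k) (stirling₂ j (suc k)))
      collect : ∀ s d p S k n → s * (d * p * S) + ((s * p) * ((2 + k) * S) + p * (n * S)) ≡
                                (s * (d * p + k * p) + (2 * s + n) * p) * S
      collect = solve-∀
      collect′ : ∀ s m p S n → (s * (m * p) + (2 * s + n) * p) * S ≡ (s * (1 + m) + (n + s)) * (p * S)
      collect′ = solve-∀
      collect″ : ∀ s m p S → (s * (1 + m) + (1 + m)) * (p * S) ≡ (1 + s) * ((1 + m) * p * S)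
      collect″ = solve-∀

  -- Parking functions in terms of occurrence vectors

  occurs : ℕ → Side
  occurs zero    = outside
  occurs (suc _) = inside

  support : ∀ {m} → Vec ℕ m → Subset m
  support = Vec.map occurs

  support-update : ∀ {m} (c : Vec ℕ m) x → support (updateAt c x suc) ≡ ⁅ x ⁆ ∪ support c
  support-update (i ∷ c) zero    = cong (inside ∷_) (sym (Subset.∪-identityˡ (support c)))
  support-update (i ∷ c) (suc x) = cong (occurs i ∷_) (support-update c x)

  support-content : ∀ {m n} (w : Vec (Fin m) n) → ⋃ (map ⁅_⁆ (toList w)) ≡ support (content w)
  support-content []      = sym (map-replicate occurs 0 _)
  support-content (x ∷ w) = ≡-trans (cong (⁅ x ⁆ ∪_) (support-content w)) (sym (support-update (content w) x))

  -- This is the nondecreasing word with occurrence vector `c` whose letters are numbered from `ℓ`.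
  expand : ∀ {m} → ℕ → Vec ℕ m → List ℕ
  expand ℓ []      = []
  expand ℓ (i ∷ c) = List.replicate i ℓ ++ expand (suc ℓ) c

  expand-zeros : ∀ ℓ m → expand ℓ (replicate m 0) ≡ []
  expand-zeros ℓ zero    = refl
  expand-zeros ℓ (suc m) = expand-zeros (suc ℓ) m

  expand-update : ∀ {m} ℓ (c : Vec ℕ m) x → ℓ + toℕ x ∷ expand ℓ c ↭ expand ℓ (updateAt c x suc)
  expand-update ℓ (i ∷ c) zero    = ↭-reflexive (cong (_∷ expand ℓ (i ∷ c)) (ℕ.+-identityʳ ℓ))
  expand-update ℓ (i ∷ c) (suc x) = ↭-trans
    (↭-reflexive (cong (_∷ expand ℓ (i ∷ c)) (ℕ.+-suc ℓ (toℕ x))))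
    (↭-trans (↭-sym (Perm.shift _ (List.replicate i ℓ) _))
             (Perm.++⁺ˡ (List.replicate i ℓ) (expand-update (suc ℓ) c x)))

  letters-expand : ∀ {m n} (w : Vec (Fin m) n) →
                   map (λ i → suc (toℕ i)) (toList w) ↭ expand 1 (content w)
  letters-expand {m} [] = ↭-reflexive (sym (expand-zeros 1 m))
  letters-expand (x ∷ w) = ↭-trans (prep _ (letters-expand w)) (expand-update 1 (content w) x)

  expand-≥ : ∀ {m} ℓ (c : Vec ℕ m) → All (ℓ ℕ.≤_) (expand ℓ c)
  expand-≥ ℓ []      = []
  expand-≥ ℓ (i ∷ c) =
    All.++⁺ (All.replicate⁺ i ℕ.≤-refl) (All.map (ℕ.≤-trans (ℕ.n≤1+n ℓ)) (expand-≥ (suc ℓ) c))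

  expand-sorted : ∀ {m} ℓ (c : Vec ℕ m) → AllPairs ℕ._≤_ (expand ℓ c)
  expand-sorted ℓ []      = []
  expand-sorted ℓ (i ∷ c) = AllPairs.++⁺ (constant i) (expand-sorted (suc ℓ) c)
    (All.replicate⁺ i (All.map (ℕ.≤-trans (ℕ.n≤1+n ℓ)) (expand-≥ (suc ℓ) c)))
    where
    constant : ∀ i → AllPairs ℕ._≤_ (List.replicate i ℓ)
    constant zero    = []
    constant (suc i) = All.replicate⁺ i ℕ.≤-refl ∷ constant i

  -- A sorted list is determined by its multiset of entries, and both sides are sorted permutations
  -- of the letters.
  sort-letters : ∀ {n} (w : Word n) → sort (letters w) ≡ expand 1 (content w)
  sort-letters w = Pointwise.Pointwise-≡⇒≡
    (Sorted.↗↭↗⇒≋ ℕ.≤-totalOrder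
      (InsertionSort.sort-↗ ℕ.≤-decTotalOrder (letters w))
      (Linked.AllPairs⇒Linked (expand-sorted 1 (content w)))
      (↭⇒↭ₛ (↭-trans (InsertionSort.sort-↭ ℕ.≤-decTotalOrder (letters w)) (letters-expand w))))

  sum-zeros : ∀ m → Vec.sum (replicate m 0) ≡ 0
  sum-zeros zero    = refl
  sum-zeros (suc m) = sum-zeros m

  sum-update : ∀ {m} (c : Vec ℕ m) x → Vec.sum (updateAt c x suc) ≡ suc (Vec.sum c)
  sum-update (i ∷ c) zero    = refl
  sum-update (i ∷ c) (suc x) = ≡-trans (cong (i +_) (sum-update c x)) (ℕ.+-suc i (Vec.sum c))

  sum-content : ∀ {m n} (w : Vec (Fin m) n) → Vec.sum (content w) ≡ n
  sum-content {m} []  = sum-zeros m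
  sum-content (x ∷ w) = ≡-trans (sum-update (content w) x) (cong suc (sum-content w))

  range : ℕ → ℕ → List ℕ
  range d zero    = []
  range d (suc n) = d ∷ range (suc d) n

  applyUpTo-range : ∀ (f : ℕ → ℕ) d n → (∀ i → f i ≡ i + d) → applyUpTo f n ≡ range d n
  applyUpTo-range f d zero    f≗ = refl
  applyUpTo-range f d (suc n) f≗ = cong₂ _∷_ (f≗ 0)
    (applyUpTo-range (f ∘ suc) (suc d) n (λ i → ≡-trans (f≗ (suc i)) (sym (ℕ.+-suc i d))))

  -- With initial slack one, the slack before letter `ℓ` is one plus the number of smaller entries
  -- minus `ℓ − 1`. Its staying positive is the counting form of the parking condition: for every
  -- `ℓ`, at least `ℓ` entries are at most `ℓ`.
  data Parks : ∀ {m} → ℕ → Vec ℕ m → Set where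
    []  : ∀ {s} → Parks (suc s) []
    _∷_ : ∀ {m s} i {c : Vec ℕ m} → Parks (s + i) c → Parks (suc s) (i ∷ c)

  parkingWeight-Parks : ∀ {m a} k {c : Vec ℕ m} → Parks a c → parkingWeight a k c ≡ ⟦ ∣ support c ∣ ℕ.≟ k ⟧
  parkingWeight-Parks zero    []          = refl
  parkingWeight-Parks (suc k) []          = refl
  parkingWeight-Parks zero    (_∷_ {s = s} zero p) rewrite ℕ.+-identityʳ s = parkingWeight-Parks zero p
  parkingWeight-Parks (suc k) (_∷_ {s = s} zero p) rewrite ℕ.+-identityʳ s = parkingWeight-Parks (suc k) p
  parkingWeight-Parks zero    (suc i ∷ p) = refl
  parkingWeight-Parks (suc k) (suc i ∷ p) = parkingWeight-Parks k p

  parkingWeight-¬Parks : ∀ {m} a k (c : Vec ℕ m) → ¬ Parks a c → parkingWeight a k c ≡ 0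
  parkingWeight-¬Parks zero    k       c           ¬p = refl
  parkingWeight-¬Parks (suc s) k       []          ¬p = contradiction [] ¬p
  parkingWeight-¬Parks (suc s) zero    (zero ∷ c)  ¬p =
    parkingWeight-¬Parks s zero c (λ p → ¬p (zero ∷ subst (λ a → Parks a c) (sym (ℕ.+-identityʳ s)) p))
  parkingWeight-¬Parks (suc s) (suc k) (zero ∷ c)  ¬p =
    parkingWeight-¬Parks s (suc k) c (λ p → ¬p (zero ∷ subst (λ a → Parks a c) (sym (ℕ.+-identityʳ s)) p))
  parkingWeight-¬Parks (suc s) zero    (suc i ∷ c) ¬p = refl
  parkingWeight-¬Parks (suc s) (suc k) (suc i ∷ c) ¬p =
    parkingWeight-¬Parks (s + suc i) k c (λ p → ¬p (suc i ∷ p))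

  _≤*_ : List ℕ → List ℕ → Set
  _≤*_ = Pointwise ℕ._≤_

  drop-replicate : ∀ i {ℓ d t xs} → (List.replicate i ℓ ++ xs) ≤* range d (i + t) → xs ≤* range (d + i) t
  drop-replicate zero    {d = d} p rewrite ℕ.+-identityʳ d = p
  drop-replicate (suc i) {d = d} (_ ∷ p) rewrite ℕ.+-suc d i = drop-replicate i p

  add-replicate : ∀ i {ℓ d t xs} → ℓ ℕ.≤ d → xs ≤* range (d + i) t → (List.replicate i ℓ ++ xs) ≤* range d (i + t)
  add-replicate zero    {d = d} ℓ≤d p rewrite ℕ.+-identityʳ d = p
  add-replicate (suc i) {d = d} ℓ≤d p rewrite ℕ.+-suc d i =
    ℓ≤d ∷ add-replicate i (ℕ.≤-trans ℓ≤d (ℕ.n≤1+n d)) p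

  -- ℓ is the current letter and d the next position to fill.
  module _ {m} (s i : ℕ) (c : Vec ℕ m) where

    slack-∷ : Vec.sum (i ∷ c) + suc s ≡ suc (suc m) → Vec.sum c + (s + i) ≡ suc m
    slack-∷ eq = ℕ.suc-injective (≡-trans (rearrange (Vec.sum c) s i) eq)
      where
      rearrange : ∀ t s i → 1 + (t + (s + i)) ≡ (i + t) + (1 + s)
      rearrange = solve-∀

    position-∷ : ∀ {d ℓ} → suc d ≡ suc s + ℓ → suc (d + i) ≡ (s + i) + suc ℓ
    position-∷ {d} {ℓ} eq = ≡-trans (cong (_+ i) eq) (rearrange s ℓ i)
      where
      rearrange : ∀ s ℓ i → 1 + (s + ℓ) + i ≡ (s + i) + (1 + ℓ)
      rearrange = solve-∀

  -- By the invariant `suc d ≡ a + ℓ`, slack zero would mean `ℓ = d + 1`. The sum condition then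
  -- guarantees that some letter is left, and the smallest such letter is at least `ℓ`, too large
  -- for position `d`.
  expand-Parks : ∀ {m} a ℓ d (c : Vec ℕ m) → Vec.sum c + a ≡ suc m → suc d ≡ a + ℓ →
                 expand ℓ c ≤* range d (Vec.sum c) → Parks a c
  expand-Parks a       ℓ d []      refl refl p = []
  expand-Parks zero    ℓ d (i ∷ c) eq   refl p with Vec.sum (i ∷ c) | expand ℓ (i ∷ c) | expand-≥ ℓ (i ∷ c)
  expand-Parks zero    ℓ d (i ∷ c) eq   refl (x≤d ∷ _) | suc _ | x ∷ _ | ℓ≤x ∷ _ =
    contradiction (ℕ.≤-trans ℓ≤x x≤d) (ℕ.n≮n d)
  expand-Parks (suc s) ℓ d (i ∷ c) eq   eq′  p =
    i ∷ expand-Parks (s + i) (suc ℓ) (d + i) c (slack-∷ s i c eq) (position-∷ s i c eq′) (drop-replicate i p)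

  Parks-expand : ∀ {m a} ℓ d {c : Vec ℕ m} → Vec.sum c + a ≡ suc m → suc d ≡ a + ℓ →
                 Parks a c → expand ℓ c ≤* range d (Vec.sum c)
  Parks-expand ℓ d eq eq′ []                  = []
  Parks-expand ℓ d eq eq′ (_∷_ {s = s} i {c} p) =
    add-replicate i (ℕ.≤-trans (ℕ.m≤n+m ℓ s) (ℕ.≤-reflexive (sym (ℕ.suc-injective eq′))))
      (Parks-expand (suc ℓ) (d + i) (slack-∷ s i c eq) (position-∷ s i c eq′) p)

  IsParking⇔Parks : ∀ {n} (w : Word n) → IsParking w ⇔ Parks 1 (content w)
  IsParking⇔Parks {n} w = mk⇔
    (λ p → expand-Parks 1 1 1 (content w) total refl
      (subst (expand 1 (content w) ≤*_) bound (subst (_≤* applyUpTo suc n) (sort-letters w) p)))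
    (λ p → subst (_≤* applyUpTo suc n) (sym (sort-letters w))
      (subst (expand 1 (content w) ≤*_) (sym bound) (Parks-expand 1 1 total refl p)))
    where
    total : Vec.sum (content w) + 1 ≡ suc n
    total = ≡-trans (cong (_+ 1) (sum-content w)) (ℕ.+-comm n 1)
    bound : applyUpTo suc n ≡ range 1 (Vec.sum (content w))
    bound = ≡-trans (applyUpTo-range suc 1 n (λ i → ℕ.+-comm 1 i)) (cong (range 1) (sym (sum-content w)))

  -- Coefficients of the two polynomials

  coeff-⊕ : ∀ p q k → coeff (p ⊕ q) k ≡ coeff p k + coeff q k
  coeff-⊕ []      q       k       = refl
  coeff-⊕ (a ∷ p) []      k       = sym (ℕ.+-identityʳ _)
  coeff-⊕ (a ∷ p) (b ∷ q) zero    = refl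
  coeff-⊕ (a ∷ p) (b ∷ q) (suc k) = coeff-⊕ p q k

  coeff-sumPoly : (f : A → Poly) → ∀ xs k → coeff (sumPoly (map f xs)) k ≡ ∑ (λ x → coeff (f x) k) xs
  coeff-sumPoly f []       k = refl
  coeff-sumPoly f (x ∷ xs) k =
    ≡-trans (coeff-⊕ (f x) (sumPoly (map f xs)) k) (cong (coeff (f x) k +_) (coeff-sumPoly f xs k))

  coeff-monomial : ∀ c i k → coeff (monomial c i) k ≡ c * ⟦ i ℕ.≟ k ⟧
  coeff-monomial c zero    zero    = sym (ℕ.*-identityʳ c)
  coeff-monomial c zero    (suc k) = sym (ℕ.*-zeroʳ c)
  coeff-monomial c (suc i) zero    = sym (ℕ.*-zeroʳ c)
  coeff-monomial c (suc i) (suc k) = coeff-monomial c i k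

  ∑-upTo-suc : ∀ n (f : ℕ → ℕ) → ∑ f (upTo (suc n)) ≡ f 0 + ∑ (f ∘ suc) (upTo n)
  ∑-upTo-suc n f = cong (f 0 +_) (≡-trans (cong (∑ f) (sym (map-upTo suc n))) (∑-map f suc (upTo n)))

  ∑-upTo-select : ∀ n k (f : ℕ → ℕ) → (n ℕ.≤ k → f k ≡ 0) → ∑ (λ i → f i * ⟦ i ℕ.≟ k ⟧) (upTo n) ≡ f k
  ∑-upTo-select zero    k       f f0 = sym (f0 z≤n)
  ∑-upTo-select (suc n) zero    f f0 = begin
    ∑ (λ i → f i * ⟦ i ℕ.≟ 0 ⟧) (upTo (suc n))
      ≡⟨ ∑-upTo-suc n (λ i → f i * ⟦ i ℕ.≟ 0 ⟧) ⟩
    f 0 * 1 + ∑ (λ i → f (suc i) * 0) (upTo n)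
      ≡⟨ cong₂ _+_ (ℕ.*-identityʳ (f 0)) (∑-zero (λ i → ℕ.*-zeroʳ (f (suc i))) (upTo n)) ⟩
    f 0 + 0
      ≡⟨ ℕ.+-identityʳ (f 0) ⟩
    f 0 ∎
    where open ≡-Reasoning
  ∑-upTo-select (suc n) (suc k) f f0 = begin
    ∑ (λ i → f i * ⟦ i ℕ.≟ suc k ⟧) (upTo (suc n))
      ≡⟨ ∑-upTo-suc n (λ i → f i * ⟦ i ℕ.≟ suc k ⟧) ⟩
    f 0 * 0 + ∑ (λ i → f (suc i) * ⟦ i ℕ.≟ k ⟧) (upTo n)
      ≡⟨ cong₂ _+_ (ℕ.*-zeroʳ (f 0)) (∑-upTo-select n k (f ∘ suc) (f0 ∘ s≤s)) ⟩
    f (suc k) ∎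
    where open ≡-Reasoning

  stirling₂->≡0 : ∀ {n k} → n ℕ.< k → stirling₂ n k ≡ 0
  stirling₂->≡0 {zero}  {suc k} n<k = stirling₂-zero-suc k
  stirling₂->≡0 {suc n} {suc k} n<k = begin
    stirling₂ (suc n) (suc k)
      ≡⟨ stirling₂-suc-suc n k ⟩
    stirling₂ n k + suc k * stirling₂ n (suc k)
      ≡⟨ cong₂ (λ a b → a + suc k * b) (stirling₂->≡0 (ℕ.s<s⁻¹ n<k))
               (stirling₂->≡0 (ℕ.<-trans (ℕ.s<s⁻¹ n<k) (ℕ.n<1+n k))) ⟩
    suc k * 0
      ≡⟨ ℕ.*-zeroʳ (suc k) ⟩
    0 ∎
    where open ≡-Reasoning

  nCk*k!≡nP′k : ∀ {n k} → k ℕ.≤ n → (n C k) * k ! ≡ (n P′ k)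
  nCk*k!≡nP′k {n} {k} k≤n = begin
    (n C k) * k !
      ≡⟨ cong (_* k !) (≡-trans (nCk≡nPk/k! k≤n) (/-congˡ (≡-trans (nPk≡n!/[n∸k]! k≤n) (sym (nP′k≡n!/[n∸k]! k≤n))))) ⟩
    ((n P′ k) ℕ./ k !) * k !
      ≡⟨ m/n*n≡m (k!∣nP′k k≤n) ⟩
    (n P′ k) ∎
    where
    open ≡-Reasoning
    instance _ = k ℕ.!≢0

  -- The binomial coefficient and the factorial of the formula are merged into a falling factorial,
  -- the form in which the parking count arrives.
  imageCount : ℕ → ℕ → ℕ
  imageCount n j = (n P′ j) * stirling₂ n (suc j)

  coeff-imageSizeFormula : ∀ n j → coeff (imageSizeFormula n) j ≡ imageCount n j
  coeff-imageSizeFormula n j = begin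
    coeff (imageSizeFormula n) j
      ≡⟨ coeff-sumPoly (λ i → monomial (f i) i) (upTo n) j ⟩
    ∑ (λ i → coeff (monomial (f i) i) j) (upTo n)
      ≡⟨ ∑-cong (λ i → coeff-monomial (f i) i j) (upTo n) ⟩
    ∑ (λ i → f i * ⟦ i ℕ.≟ j ⟧) (upTo n)
      ≡⟨ ∑-upTo-select n j f vanish ⟩
    f j
      ≡⟨ closed (j ℕ.≤? n) ⟩
    imageCount n j ∎
    where
    open ≡-Reasoning
    f : ℕ → ℕ
    f i = (n C i) * stirling₂ n (suc i) * i !
    vanish : n ℕ.≤ j → f j ≡ 0
    vanish n≤j rewrite stirling₂->≡0 (s≤s n≤j) | ℕ.*-zeroʳ (n C j) = refl
    closed : Dec (j ℕ.≤ n) → f j ≡ imageCount n j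
    closed (no j≰n) = ≡-trans (vanish (ℕ.<⇒≤ (ℕ.≰⇒> j≰n))) (sym
      (cong (_* stirling₂ n (suc j)) (P′>≡0 (ℕ.≰⇒> j≰n))))
    closed (yes j≤n) = ≡-trans (rearrange (n C j) (stirling₂ n (suc j)) (j !))
      (cong (_* stirling₂ n (suc j)) (nCk*k!≡nP′k j≤n))
      where
      rearrange : ∀ a b c → a * b * c ≡ (a * c) * b
      rearrange = solve-∀

  -- Makes the truncated `∣ image w ∣ ∸ 1` in the exponent a true predecessor.
  image-nonempty : ∀ {n} (w : Word (suc n)) → ∃ λ i → ∣ image w ∣ ≡ suc i
  image-nonempty (x ∷ w) with ∣ image (x ∷ w) ∣ | Subset.∣p∣≤∣p∪q∣ ⁅ x ⁆ (⋃ (map ⁅_⁆ (toList w)))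
  ... | zero  | le with () ← ℕ.≤-trans (ℕ.≤-reflexive (sym (Subset.∣⁅x⁆∣≡1 x))) le
  ... | suc i | _  = i , refl

  coeff-M : ∀ n j → coeff (M (suc n)) j ≡ imageCount (suc n) j
  coeff-M n′ j = begin
    coeff (M n) j
      ≡⟨ coeff-sumPoly (λ w → monomial 1 (∣ image w ∣ ∸ 1)) (PF n) j ⟩
    ∑ (λ w → coeff (monomial 1 (∣ image w ∣ ∸ 1)) j) (PF n)
      ≡⟨ ∑-filter isParking? (λ w → coeff (monomial 1 (∣ image w ∣ ∸ 1)) j) (words n n) ⟩
    ∑ (λ w → ⟦ isParking? w ⟧ * coeff (monomial 1 (∣ image w ∣ ∸ 1)) j) (words n n)
      ≡⟨ ∑-cong (λ w → weight w (isParking? w)) (words n n) ⟩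
    parkingCount n 1 n (suc j)
      ≡⟨ parkingCount-formula n 1 n j (ℕ.+-comm n 1) ⟩
    1 * imageCount n j
      ≡⟨ ℕ.*-identityˡ _ ⟩
    imageCount n j ∎
    where
    open ≡-Reasoning
    n : ℕ
    n = suc n′
    weight : ∀ w (p? : Dec (IsParking w)) → ⟦ p? ⟧ * coeff (monomial 1 (∣ image w ∣ ∸ 1)) j ≡
                                            parkingWeight 1 (suc j) (content w)
    weight w (no ¬p) = sym (parkingWeight-¬Parks 1 (suc j) (content w)
      (¬p ∘ Equivalence.from (IsParking⇔Parks w)))
    weight w (yes p) = begin
      1 * coeff (monomial 1 (∣ image w ∣ ∸ 1)) j
        ≡⟨ ≡-trans (ℕ.*-identityˡ _) (≡-trans (coeff-monomial 1 (∣ image w ∣ ∸ 1) j) (ℕ.*-identityˡ _)) ⟩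
      ⟦ (∣ image w ∣ ∸ 1) ℕ.≟ j ⟧
        ≡⟨ shift (image-nonempty w) ⟩
      ⟦ ∣ image w ∣ ℕ.≟ suc j ⟧
        ≡⟨ cong (λ q → ⟦ ∣ q ∣ ℕ.≟ suc j ⟧) (support-content w) ⟩
      ⟦ ∣ support (content w) ∣ ℕ.≟ suc j ⟧
        ≡⟨ parkingWeight-Parks (suc j) (Equivalence.to (IsParking⇔Parks w) p) ⟨
      parkingWeight 1 (suc j) (content w) ∎
      where
      shift : (∃ λ i → ∣ image w ∣ ≡ suc i) → ⟦ (∣ image w ∣ ∸ 1) ℕ.≟ j ⟧ ≡ ⟦ ∣ image w ∣ ℕ.≟ suc j ⟧
      shift (i , eq) = ≡-trans (cong (λ k → ⟦ (k ∸ 1) ℕ.≟ j ⟧) eq) (cong (λ k → ⟦ k ℕ.≟ suc j ⟧) (sym eq))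

-- Polynomials over a commutative ring and their linear factors

module Polynomials (R : CommutativeRing 0ℓ 0ℓ) where

  open import Data.Fin.Base as Fin using (Fin; zero; suc)
  open import Data.List.Base using ([]; _∷_)
  open import Data.Nat.Base as ℕ using (ℕ; zero; suc; z≤n; s≤s)
  import Data.Nat.Properties as ℕ
  open import Data.Product.Base using (_×_; _,_; proj₁; proj₂)
  open import Function.Base using (_∘_)
  open import Relation.Binary.PropositionalEquality as ≡ using (_≡_)

  open CommutativeRing R hiding (zero)
  open import Algebra.Properties.Semiring.Mult semiring
    using (×-homo-+; ×1-homo-*) renaming (_×_ to _·_)
  open import Algebra.Solver.Ring.NaturalCoefficients.Default commutativeSemiring
    using (solve; _:=_; _:+_; _:*_; con)
  open import Relation.Binary.Reasoning.Setoid setoid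

  ι : ℕ → Carrier
  ι n = n · 1#

  -- A polynomial is kept as a coefficient function with a degree bound `m`, so that its leading
  -- coefficient is simply `a m`.
  ev : ℕ → (ℕ → Carrier) → Carrier → Carrier
  ev zero    a x = a 0
  ev (suc m) a x = a 0 + x * ev m (a ∘ suc) x

  ev′ : ℕ → (ℕ → Carrier) → Carrier → Carrier
  ev′ zero    a x = 0#
  ev′ (suc m) a x = ev m (a ∘ suc) x + x * ev′ m (a ∘ suc) x

  ev-cong : ∀ m {a b x y} → (∀ k → a k ≈ b k) → x ≈ y → ev m a x ≈ ev m b y
  ev-cong zero    a≈b x≈y = a≈b 0
  ev-cong (suc m) a≈b x≈y = +-cong (a≈b 0) (*-cong x≈y (ev-cong m (a≈b ∘ suc) x≈y))

  ev-+ : ∀ m a b x → ev m (λ k → a k + b k) x ≈ ev m a x + ev m b x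
  ev-+ zero    a b x = refl
  ev-+ (suc m) a b x = begin
    (a 0 + b 0) + x * ev m (λ k → a (suc k) + b (suc k)) x
      ≈⟨ +-congˡ (*-congˡ (ev-+ m (a ∘ suc) (b ∘ suc) x)) ⟩
    (a 0 + b 0) + x * (ev m (a ∘ suc) x + ev m (b ∘ suc) x)
      ≈⟨ solve 5 (λ a b x p q → (a :+ b) :+ x :* (p :+ q) := (a :+ x :* p) :+ (b :+ x :* q)) refl
           (a 0) (b 0) x (ev m (a ∘ suc) x) (ev m (b ∘ suc) x) ⟩
    (a 0 + x * ev m (a ∘ suc) x) + (b 0 + x * ev m (b ∘ suc) x) ∎

  ev-*ˡ : ∀ m c a x → ev m (λ k → c * a k) x ≈ c * ev m a x
  ev-*ˡ zero    c a x = refl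
  ev-*ˡ (suc m) c a x = begin
    c * a 0 + x * ev m (λ k → c * a (suc k)) x
      ≈⟨ +-congˡ (*-congˡ (ev-*ˡ m c (a ∘ suc) x)) ⟩
    c * a 0 + x * (c * ev m (a ∘ suc) x)
      ≈⟨ solve 4 (λ c a x p → c :* a :+ x :* (c :* p) := c :* (a :+ x :* p)) refl c (a 0) x _ ⟩
    c * (a 0 + x * ev m (a ∘ suc) x) ∎

  -- This is the Euler operator: multiplying the `k`-th coefficient by `k` amounts to
  -- differentiating and multiplying by the variable.
  ev-θ : ∀ m a x → ev m (λ k → ι k * a k) x ≈ x * ev′ m a x
  ev-θ zero    a x = trans (zeroˡ (a 0)) (sym (zeroʳ x))
  ev-θ (suc m) a x = begin
    0# * a 0 + x * ev m (λ k → (1# + ι k) * a (suc k)) x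
      ≈⟨ +-cong (zeroˡ (a 0)) (*-congˡ (ev-cong m
           (λ k → trans (distribʳ (a (suc k)) 1# (ι k)) (+-congʳ (*-identityˡ (a (suc k))))) refl)) ⟩
    0# + x * ev m (λ k → a (suc k) + ι k * a (suc k)) x
      ≈⟨ trans (+-identityˡ _) (*-congˡ (ev-+ m (a ∘ suc) _ x)) ⟩
    x * (ev m (a ∘ suc) x + ev m (λ k → ι k * a (suc k)) x)
      ≈⟨ *-congˡ (+-congˡ (ev-θ m (a ∘ suc) x)) ⟩
    x * ev′ (suc m) a x ∎

  ev-extend : ∀ m a x → a (suc m) ≈ 0# → ev (suc m) a x ≈ ev m a x
  ev-extend zero    a x a≈0 = trans (+-congˡ (trans (*-congˡ a≈0) (zeroʳ x))) (+-identityʳ (a 0))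
  ev-extend (suc m) a x a≈0 = +-congˡ (*-congˡ (ev-extend m (a ∘ suc) x a≈0))

  shift : (ℕ → Carrier) → ℕ → Carrier
  shift a zero    = 0#
  shift a (suc k) = a k

  -- The coefficients of the quotient of a polynomial of degree suc m by t − α.
  horner : ℕ → (ℕ → Carrier) → Carrier → ℕ → Carrier
  horner m       a α zero    = ev m (a ∘ suc) α
  horner zero    a α (suc k) = 0#
  horner (suc m) a α (suc k) = horner m (a ∘ suc) α k

  horner-leading : ∀ m a α → horner m a α m ≡ a (suc m)
  horner-leading zero    a α = ≡.refl
  horner-leading (suc m) a α = horner-leading m (a ∘ suc) α

  private
    -- The semiring solver sees `- α` as an independent variable. Adding this vanishing term first
    -- supplies the only relation between `α` and `- α` that the division identity uses.
    cancel : ∀ z α v → z ≈ z + (α + - α) * v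
    cancel z α v = sym (trans (+-congˡ (trans (*-congʳ (-‿inverseʳ α)) (zeroˡ v))) (+-identityʳ z))

  ev-horner : ∀ m a α x → ev (suc m) a x ≈ ev (suc m) a α + (x - α) * ev m (horner m a α) x
  ev-horner zero    a α x = begin
    a 0 + x * a 1
      ≈⟨ cancel _ α (a 1) ⟩
    (a 0 + x * a 1) + (α + - α) * a 1
      ≈⟨ solve 5 (λ a x α β v → (a :+ x :* v) :+ (α :+ β) :* v := (a :+ α :* v) :+ (x :+ β) :* v) refl
           (a 0) x α (- α) (a 1) ⟩
    (a 0 + α * a 1) + (x - α) * a 1 ∎
  ev-horner (suc m) a α x = begin
    a 0 + x * ev (suc m) (a ∘ suc) x
      ≈⟨ +-congˡ (*-congˡ (ev-horner m (a ∘ suc) α x)) ⟩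
    a 0 + x * (v + (x - α) * q)
      ≈⟨ cancel _ α v ⟩
    (a 0 + x * (v + (x - α) * q)) + (α + - α) * v
      ≈⟨ solve 6 (λ a x α β v q → (a :+ x :* (v :+ (x :+ β) :* q)) :+ (α :+ β) :* v :=
                                  (a :+ α :* v) :+ (x :+ β) :* (v :+ x :* q)) refl
           (a 0) x α (- α) v q ⟩
    (a 0 + α * v) + (x - α) * (v + x * q) ∎
    where
    v = ev (suc m) (a ∘ suc) α
    q = ev m (horner m (a ∘ suc) α) x

  -- The product rule applied to `ev-horner`, where the remainder is a constant.
  ev′-horner : ∀ m a α x →
    ev′ (suc m) a x ≈ ev m (horner m a α) x + (x - α) * ev′ m (horner m a α) x
  ev′-horner zero    a α x = +-congˡ (trans (zeroʳ x) (sym (zeroʳ (x - α))))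
  ev′-horner (suc m) a α x = begin
    ev (suc m) (a ∘ suc) x + x * ev′ (suc m) (a ∘ suc) x
      ≈⟨ +-cong (ev-horner m (a ∘ suc) α x) (*-congˡ (ev′-horner m (a ∘ suc) α x)) ⟩
    (v + (x - α) * q) + x * (q + (x - α) * q′)
      ≈⟨ solve 5 (λ v y x q r → (v :+ y :* q) :+ x :* (q :+ y :* r) :=
                                (v :+ x :* q) :+ y :* (q :+ x :* r)) refl v (x - α) x q q′ ⟩
    (v + x * q) + (x - α) * (q + x * q′) ∎
    where
    v = ev (suc m) (a ∘ suc) α
    q = ev m (horner m (a ∘ suc) α) x
    q′ = ev′ m (horner m (a ∘ suc) α) x

  -- A non-zero-divisor. Over the real and complex numbers this follows from apartness, and it is
  -- what the factorisation asks of differences of roots.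
  Cancellable : Carrier → Set
  Cancellable y = ∀ z → y * z ≈ 0# → z ≈ 0#

  ∏ : ∀ m → (Fin m → Carrier) → Carrier → Carrier
  ∏ zero    α x = 1#
  ∏ (suc m) α x = (x - α zero) * ∏ m (α ∘ suc) x

  ∏′ : ∀ m → (Fin m → Carrier) → Carrier → Carrier
  ∏′ zero    α x = 0#
  ∏′ (suc m) α x = ∏ m (α ∘ suc) x + (x - α zero) * ∏′ m (α ∘ suc) x

  -- The quotient by the first linear factor vanishes at the other roots, because their differences
  -- to the first root can be cancelled, and it has the same leading coefficient. The derivative is
  -- carried along, since the value at the single point `x` does not determine it.
  factorisation : ∀ m a (α : Fin m → Carrier) →
    (∀ i j → i Fin.< j → Cancellable (α j - α i)) → (∀ i → ev m a (α i) ≈ 0#) →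
    ∀ x → ev m a x ≈ a m * ∏ m α x × ev′ m a x ≈ a m * ∏′ m α x
  factorisation zero    a α apart root x = sym (*-identityʳ (a 0)) , sym (zeroʳ (a 0))
  factorisation (suc m) a α apart root x = product , product′
    where
    b : ℕ → Carrier
    b = horner m a (α zero)
    b-root : ∀ i → ev m b (α (suc i)) ≈ 0#
    b-root i = apart zero (suc i) (s≤s z≤n) _ (begin
      (α (suc i) - α zero) * ev m b (α (suc i))
        ≈⟨ +-identityˡ _ ⟨
      0# + (α (suc i) - α zero) * ev m b (α (suc i))
        ≈⟨ +-congʳ (root zero) ⟨
      ev (suc m) a (α zero) + (α (suc i) - α zero) * ev m b (α (suc i))
        ≈⟨ ev-horner m a (α zero) (α (suc i)) ⟨
      ev (suc m) a (α (suc i))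
        ≈⟨ root (suc i) ⟩
      0# ∎)
    ih : ev m b x ≈ b m * ∏ m (α ∘ suc) x × ev′ m b x ≈ b m * ∏′ m (α ∘ suc) x
    ih = factorisation m b (α ∘ suc) (λ i j i<j → apart (suc i) (suc j) (s≤s i<j)) b-root x
    ih₁ : ev m b x ≈ a (suc m) * ∏ m (α ∘ suc) x
    ih₁ = trans (proj₁ ih) (*-congʳ (reflexive (horner-leading m a (α zero))))
    ih₂ : ev′ m b x ≈ a (suc m) * ∏′ m (α ∘ suc) x
    ih₂ = trans (proj₂ ih) (*-congʳ (reflexive (horner-leading m a (α zero))))
    product : ev (suc m) a x ≈ a (suc m) * ∏ (suc m) α x
    product = begin
      ev (suc m) a x
        ≈⟨ ev-horner m a (α zero) x ⟩
      ev (suc m) a (α zero) + (x - α zero) * ev m b x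
        ≈⟨ +-cong (root zero) (*-congˡ ih₁) ⟩
      0# + (x - α zero) * (a (suc m) * ∏ m (α ∘ suc) x)
        ≈⟨ solve 3 (λ y c p → con 0 :+ y :* (c :* p) := c :* (y :* p)) refl _ _ _ ⟩
      a (suc m) * ∏ (suc m) α x ∎
    product′ : ev′ (suc m) a x ≈ a (suc m) * ∏′ (suc m) α x
    product′ = begin
      ev′ (suc m) a x
        ≈⟨ ev′-horner m a (α zero) x ⟩
      ev m b x + (x - α zero) * ev′ m b x
        ≈⟨ +-cong ih₁ (*-congˡ ih₂) ⟩
      a (suc m) * ∏ m (α ∘ suc) x + (x - α zero) * (a (suc m) * ∏′ m (α ∘ suc) x)
        ≈⟨ solve 4 (λ y c p r → c :* p :+ y :* (c :* r) := c :* (p :+ y :* r)) refl _ _ _ _ ⟩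
      a (suc m) * ∏′ (suc m) α x ∎

  -- From coefficient lists to coefficient functions

  eval-⊕ : ∀ p q x → eval rawRing (p ⊕ q) x ≈ eval rawRing p x + eval rawRing q x
  eval-⊕ []      q       x = sym (+-identityˡ _)
  eval-⊕ (a ∷ p) []      x = sym (+-identityʳ _)
  eval-⊕ (a ∷ p) (b ∷ q) x = begin
    ι (a ℕ.+ b) + x * eval rawRing (p ⊕ q) x
      ≈⟨ +-cong (×-homo-+ 1# a b) (*-congˡ (eval-⊕ p q x)) ⟩
    (ι a + ι b) + x * (eval rawRing p x + eval rawRing q x)
      ≈⟨ solve 5 (λ a b x p q → (a :+ b) :+ x :* (p :+ q) := (a :+ x :* p) :+ (b :+ x :* q)) refl
           (ι a) (ι b) x _ _ ⟩
    (ι a + x * eval rawRing p x) + (ι b + x * eval rawRing q x) ∎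

  eval-derivative-∷ : ∀ a p x → eval rawRing (derivative (a ∷ p)) x ≈
                                eval rawRing p x + x * eval rawRing (derivative p) x
  eval-derivative-∷ a p x = trans (eval-⊕ p (0 ∷ derivative p) x) (+-congˡ (+-identityˡ _))

  eval-zero : ∀ p x → (∀ k → coeff p k ≡ 0) → eval rawRing p x ≈ 0#
  eval-zero []      x p≡0 = refl
  eval-zero (a ∷ p) x p≡0 = begin
    ι a + x * eval rawRing p x
      ≈⟨ +-cong (reflexive (≡.cong ι (p≡0 0))) (*-congˡ (eval-zero p x (p≡0 ∘ suc))) ⟩
    0# + x * 0#
      ≈⟨ trans (+-identityˡ _) (zeroʳ x) ⟩
    0# ∎

  eval-derivative-zero : ∀ p x → (∀ k → coeff p k ≡ 0) → eval rawRing (derivative p) x ≈ 0#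
  eval-derivative-zero []      x p≡0 = refl
  eval-derivative-zero (a ∷ p) x p≡0 = begin
    eval rawRing (derivative (a ∷ p)) x
      ≈⟨ eval-derivative-∷ a p x ⟩
    eval rawRing p x + x * eval rawRing (derivative p) x
      ≈⟨ +-cong (eval-zero p x (p≡0 ∘ suc)) (*-congˡ (eval-derivative-zero p x (p≡0 ∘ suc))) ⟩
    0# + x * 0#
      ≈⟨ trans (+-identityˡ _) (zeroʳ x) ⟩
    0# ∎

  ev-zero : ∀ m a x → (∀ k → a k ≡ 0) → ev m (ι ∘ a) x ≈ 0#
  ev-zero zero    a x a≡0 = reflexive (≡.cong ι (a≡0 0))
  ev-zero (suc m) a x a≡0 = trans (+-cong (reflexive (≡.cong ι (a≡0 0)))
    (trans (*-congˡ (ev-zero m (a ∘ suc) x (a≡0 ∘ suc))) (zeroʳ x))) (+-identityˡ 0#)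

  ev′-zero : ∀ m a x → (∀ k → a k ≡ 0) → ev′ m (ι ∘ a) x ≈ 0#
  ev′-zero zero    a x a≡0 = refl
  ev′-zero (suc m) a x a≡0 = trans (+-cong (ev-zero m (a ∘ suc) x (a≡0 ∘ suc))
    (trans (*-congˡ (ev′-zero m (a ∘ suc) x (a≡0 ∘ suc))) (zeroʳ x))) (+-identityˡ 0#)

  -- The list may be longer or shorter than the degree bound suggests; in both cases the excess
  -- coefficients are zero.
  eval-ev : ∀ m p a x → (∀ k → coeff p k ≡ a k) → (∀ k → m ℕ.< k → a k ≡ 0) →
            eval rawRing p x ≈ ev m (ι ∘ a) x
  eval-ev m       []      a x p≡a a≡0 = sym (ev-zero m a x (λ k → ≡.sym (p≡a k)))
  eval-ev zero    (b ∷ p) a x p≡a a≡0 = begin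
    ι b + x * eval rawRing p x
      ≈⟨ +-cong (reflexive (≡.cong ι (p≡a 0)))
           (*-congˡ (eval-zero p x (λ k → ≡.trans (p≡a (suc k)) (a≡0 (suc k) (s≤s z≤n))))) ⟩
    ι (a 0) + x * 0#
      ≈⟨ trans (+-congˡ (zeroʳ x)) (+-identityʳ _) ⟩
    ι (a 0) ∎
  eval-ev (suc m) (b ∷ p) a x p≡a a≡0 = +-cong (reflexive (≡.cong ι (p≡a 0)))
    (*-congˡ (eval-ev m p (a ∘ suc) x (p≡a ∘ suc) (λ k m<k → a≡0 (suc k) (s≤s m<k))))

  eval-derivative-ev′ : ∀ m p a x → (∀ k → coeff p k ≡ a k) → (∀ k → m ℕ.< k → a k ≡ 0) →
                        eval rawRing (derivative p) x ≈ ev′ m (ι ∘ a) x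
  eval-derivative-ev′ m       []      a x p≡a a≡0 = sym (ev′-zero m a x (λ k → ≡.sym (p≡a k)))
  eval-derivative-ev′ zero    (b ∷ p) a x p≡a a≡0 = trans (eval-derivative-∷ b p x)
    (trans (+-cong (eval-zero p x p≡0) (trans (*-congˡ (eval-derivative-zero p x p≡0)) (zeroʳ x)))
           (+-identityˡ 0#))
    where
    p≡0 : ∀ k → coeff p k ≡ 0
    p≡0 k = ≡.trans (p≡a (suc k)) (a≡0 (suc k) (s≤s z≤n))
  eval-derivative-ev′ (suc m) (b ∷ p) a x p≡a a≡0 = trans (eval-derivative-∷ b p x)
    (+-cong (eval-ev m p (a ∘ suc) x (p≡a ∘ suc) bound)
            (*-congˡ (eval-derivative-ev′ m p (a ∘ suc) x (p≡a ∘ suc) bound)))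
    where
    bound : ∀ k → m ℕ.< k → a (suc k) ≡ 0
    bound k m<k = a≡0 (suc k) (s≤s m<k)

  -- With p = Σ b k t^k and W = t p the hypotheses say that b⁺ lists the coefficients of
  -- (1 − t) W′ + (1 + n) W.
  ev-recurrence : ∀ m n b b⁺ → b⁺ 0 ≡ b 0 → b (suc m) ≡ 0 →
    (∀ k → b⁺ (suc k) ℕ.+ k ℕ.* b k ≡ n ℕ.* b k ℕ.+ (2 ℕ.+ k) ℕ.* b (suc k)) →
    ∀ x → ev (suc m) (shift (ι ∘ b)) x ≈ 0# →
    ev (suc m) (ι ∘ b⁺) x ≈ (1# - x) * ev′ (suc m) (shift (ι ∘ b)) x
  ev-recurrence m n b b⁺ b⁺0 b≡0 rec x W≈0 = begin
    P⁺
      ≈⟨ trans (cancel P⁺ x W′) (solve 4 (λ P x y W → P :+ (x :+ y) :* W := (P :+ x :* W) :+ y :* W) refl P⁺ x (- x) W′) ⟩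
    (P⁺ + x * W′) + - x * W′
      ≈⟨ +-congʳ P⁺+xW′≈W′ ⟩
    W′ + - x * W′
      ≈⟨ +-congʳ (*-identityˡ W′) ⟨
    1# * W′ + - x * W′
      ≈⟨ distribʳ W′ 1# (- x) ⟨
    (1# - x) * W′ ∎
    where
    P⁺ = ev (suc m) (ι ∘ b⁺) x
    p  = ev m (ι ∘ b) x
    p′ = ev′ m (ι ∘ b) x
    W′ = ev′ (suc m) (shift (ι ∘ b)) x
    θb : ℕ → Carrier
    θb k = ι k * ι (b k)
    xp≈0 : x * p ≈ 0#
    xp≈0 = trans (sym (+-identityˡ _)) W≈0
    -- The negative term is moved to the left. As `t W′ = W + t · t p′` and `W′ = p + t p′`, the
    -- hypotheses say `b⁺ + t · t p′ = n W + p + t p′`, coefficient by coefficient.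
    coefficients : ∀ k → ι (b⁺ k) + shift θb k ≈ (ι n * shift (ι ∘ b) k + ι (b k)) + θb k
    coefficients zero    = begin
      ι (b⁺ 0) + 0#                       ≈⟨ +-congʳ (reflexive (≡.cong ι b⁺0)) ⟩
      ι (b 0) + 0#                        ≈⟨ solve 2 (λ b n → b :+ con 0 := (n :* con 0 :+ b) :+ con 0 :* b) refl (ι (b 0)) (ι n) ⟩
      (ι n * 0# + ι (b 0)) + 0# * ι (b 0) ∎
    coefficients (suc k) = begin
      ι (b⁺ (suc k)) + ι k * ι (b k)
        ≈⟨ +-congˡ (×1-homo-* k (b k)) ⟨
      ι (b⁺ (suc k)) + ι (k ℕ.* b k)
        ≈⟨ ×-homo-+ 1# (b⁺ (suc k)) (k ℕ.* b k) ⟨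
      ι (b⁺ (suc k) ℕ.+ k ℕ.* b k)
        ≈⟨ reflexive (≡.cong ι (rec k)) ⟩
      ι (n ℕ.* b k ℕ.+ (2 ℕ.+ k) ℕ.* b (suc k))
        ≈⟨ ×-homo-+ 1# (n ℕ.* b k) _ ⟩
      ι (n ℕ.* b k) + ι ((2 ℕ.+ k) ℕ.* b (suc k))
        ≈⟨ +-cong (×1-homo-* n (b k)) (×1-homo-* (2 ℕ.+ k) (b (suc k))) ⟩
      ι n * ι (b k) + (1# + ι (suc k)) * ι (b (suc k))
        ≈⟨ solve 4 (λ n b k c → n :* b :+ (con 1 :+ k) :* c := (n :* b :+ c) :+ k :* c) refl
             (ι n) (ι (b k)) (ι (suc k)) (ι (b (suc k))) ⟩
      (ι n * ι (b k) + ι (b (suc k))) + ι (suc k) * ι (b (suc k)) ∎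
    polynomials : P⁺ + x * (x * p′) ≈ (ι n * (x * p) + p) + x * p′
    polynomials = begin
      P⁺ + x * (x * p′)
        ≈⟨ +-congˡ (trans (+-identityˡ _) (*-congˡ (ev-θ m (ι ∘ b) x))) ⟨
      P⁺ + ev (suc m) (shift θb) x
        ≈⟨ ev-+ (suc m) (ι ∘ b⁺) (shift θb) x ⟨
      ev (suc m) (λ k → ι (b⁺ k) + shift θb k) x
        ≈⟨ ev-cong (suc m) coefficients refl ⟩
      ev (suc m) (λ k → (ι n * shift (ι ∘ b) k + ι (b k)) + θb k) x
        ≈⟨ ev-+ (suc m) (λ k → ι n * shift (ι ∘ b) k + ι (b k)) θb x ⟩
      ev (suc m) (λ k → ι n * shift (ι ∘ b) k + ι (b k)) x + ev (suc m) θb x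
        ≈⟨ +-cong (ev-+ (suc m) (λ k → ι n * shift (ι ∘ b) k) (ι ∘ b) x)
                  (ev-extend m θb x (trans (*-congˡ (reflexive (≡.cong ι b≡0))) (zeroʳ _))) ⟩
      (ev (suc m) (λ k → ι n * shift (ι ∘ b) k) x + ev (suc m) (ι ∘ b) x) + ev m θb x
        ≈⟨ +-cong (+-cong (trans (ev-*ˡ (suc m) (ι n) (shift (ι ∘ b)) x) (*-congˡ (+-identityˡ _)))
                          (ev-extend m (ι ∘ b) x (reflexive (≡.cong ι b≡0))))
                  (ev-θ m (ι ∘ b) x) ⟩
      (ι n * (x * p) + p) + x * p′ ∎
    P⁺+xW′≈W′ : P⁺ + x * W′ ≈ W′
    P⁺+xW′≈W′ = begin
      P⁺ + x * (p + x * p′)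
        ≈⟨ solve 4 (λ P x p r → P :+ x :* (p :+ x :* r) := (P :+ x :* (x :* r)) :+ x :* p) refl P⁺ x p p′ ⟩
      (P⁺ + x * (x * p′)) + x * p
        ≈⟨ +-cong polynomials xp≈0 ⟩
      ((ι n * (x * p) + p) + x * p′) + 0#
        ≈⟨ +-congʳ (+-congʳ (+-congʳ (*-congˡ xp≈0))) ⟩
      ((ι n * 0# + p) + x * p′) + 0#
        ≈⟨ solve 4 (λ n p x r → ((n :* con 0 :+ p) :+ x :* r) :+ con 0 := p :+ x :* r) refl (ι n) p x p′ ⟩
      W′ ∎

module Zeros where

  open Counting using (stirling₂-suc-suc; stirling₂-suc-zero; stirling₂->≡0; P′-suc-suc; [m∸k]*mP′k+k*mP′k)
  import Algebra.Properties.Group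
  open import Algebra.Bundles.Raw using (RawRing)
  open import Data.Fin.Base as Fin using (Fin; zero; suc; toℕ; inject₁)
  import Data.Fin.Properties as Fin
  import Data.Integer.Base as ℤ
  import Data.Integer.Properties as ℤ
  open import Data.Nat.Base as ℕ using (zero; suc; z≤n; s≤s; _⊔_)
  open import Data.Nat.Combinatorics.Base using (_P′_)
  import Data.Nat.Properties as ℕ
  open import Data.Nat.Tactic.RingSolver using (solve-∀)
  open import Data.Product.Base using (∃; _,_; proj₁; proj₂)
  open import Data.Rational.Base as ℚ using (ℚ; mkℚ; 0ℚ; 1ℚ; ½; positive; nonNegative)
  import Data.Rational.Properties as ℚ
  open import Data.Rational.Solver using (module +-*-Solver)
  import Data.Rational.Unnormalised.Base as ℚᵘ
  import Data.Rational.Unnormalised.Properties as ℚᵘ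
  open import Data.Sum.Base as ⊎ using (_⊎_; inj₁; inj₂)
  open import Function.Base using (_∘_)
  open import Relation.Binary.Definitions using (tri<; tri≈; tri>)
  open import Relation.Binary.PropositionalEquality as ≡ using (_≡_; _≢_; cong; cong₂; subst; subst₂)
  open import Relation.Nullary using (¬_; Dec; contradiction; yes; no)

  open +-*-Solver

  private
    variable
      P Q : ℕ → Set

  -- Rational inequalities and eventual properties of sequences

  p<q⇒0<q-p : ∀ {p q} → p ℚ.< q → 0ℚ ℚ.< q ℚ.- p
  p<q⇒0<q-p {p} {q} p<q = subst (ℚ._< q ℚ.- p) (ℚ.+-inverseʳ p) (ℚ.+-monoˡ-< (ℚ.- p) p<q)

  0<q-p⇒p<q : ∀ {p q} → 0ℚ ℚ.< q ℚ.- p → p ℚ.< q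
  0<q-p⇒p<q {p} {q} 0<q-p = subst₂ ℚ._<_ (ℚ.+-identityˡ p)
    (solve 2 (λ p q → (q :- p) :+ p := q) ≡.refl p q) (ℚ.+-monoˡ-< p 0<q-p)

  p≤q⇒0≤q-p : ∀ {p q} → p ℚ.≤ q → 0ℚ ℚ.≤ q ℚ.- p
  p≤q⇒0≤q-p {p} {q} p≤q = subst (ℚ._≤ q ℚ.- p) (ℚ.+-inverseʳ p) (ℚ.+-monoˡ-≤ (ℚ.- p) p≤q)

  0≤q-p⇒p≤q : ∀ {p q} → 0ℚ ℚ.≤ q ℚ.- p → p ℚ.≤ q
  0≤q-p⇒p≤q {p} {q} 0≤q-p = subst₂ ℚ._≤_ (ℚ.+-identityˡ p)
    (solve 2 (λ p q → (q :- p) :+ p := q) ≡.refl p q) (ℚ.+-monoˡ-≤ p 0≤q-p)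

  *-pos : ∀ {p q} → 0ℚ ℚ.< p → 0ℚ ℚ.< q → 0ℚ ℚ.< p ℚ.* q
  *-pos {p} {q} 0<p 0<q = subst (ℚ._< p ℚ.* q) (ℚ.*-zeroʳ p) (ℚ.*-monoʳ-<-pos p {{positive 0<p}} 0<q)

  *-mono-<-pos : ∀ {p q r s} → 0ℚ ℚ.< p → 0ℚ ℚ.< s → p ℚ.< q → r ℚ.< s → p ℚ.* r ℚ.< q ℚ.* s
  *-mono-<-pos {p} {q} {r} {s} 0<p 0<s p<q r<s =
    ℚ.<-trans (ℚ.*-monoʳ-<-pos p {{positive 0<p}} r<s) (ℚ.*-monoˡ-<-pos s {{positive 0<s}} p<q)

  p≤∣p∣ : ∀ p → p ℚ.≤ ℚ.∣ p ∣
  p≤∣p∣ p with ℚ.≤-total 0ℚ p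
  ... | inj₁ 0≤p = ℚ.≤-reflexive (≡.sym (ℚ.0≤p⇒∣p∣≡p 0≤p))
  ... | inj₂ p≤0 = ℚ.≤-trans p≤0 (ℚ.0≤∣p∣ p)

  -p≤∣p∣ : ∀ p → ℚ.- p ℚ.≤ ℚ.∣ p ∣
  -p≤∣p∣ p = subst (ℚ.- p ℚ.≤_) (ℚ.∣-p∣≡∣p∣ p) (p≤∣p∣ (ℚ.- p))

  ∣p-q∣≡∣q-p∣ : ∀ p q → ℚ.∣ p ℚ.- q ∣ ≡ ℚ.∣ q ℚ.- p ∣
  ∣p-q∣≡∣q-p∣ p q = ≡.trans (cong ℚ.∣_∣ (solve 2 (λ p q → p :- q := :- (q :- p)) ≡.refl p q)) (ℚ.∣-p∣≡∣p∣ (q ℚ.- p))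

  -- Equality, order and apartness of reals all unfold to this shape, so a few combinators replace
  -- the bookkeeping of thresholds.
  Eventually : (ℕ → Set) → Set
  Eventually P = ∃ λ N → ∀ n → N ℕ.≤ n → P n

  always : (∀ n → P n) → Eventually P
  always p = 0 , λ n _ → p n

  mapE : (∀ n → P n → Q n) → Eventually P → Eventually Q
  mapE f (N , p) = N , λ n N≤n → f n (p n N≤n)

  infixr 4 _&_
  _&_ : Eventually P → Eventually Q → Eventually (λ n → P n × Q n)
  (N , p) & (N′ , q) = N ⊔ N′ , λ n le → p n (ℕ.m⊔n≤o⇒m≤o N N′ le) , q n (ℕ.m⊔n≤o⇒n≤o N N′ le)

  Eventually-∀ : ∀ {m} {P : Fin m → ℕ → Set} → (∀ i → Eventually (P i)) → Eventually (λ n → ∀ i → P i n)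
  Eventually-∀ {zero}  p = 0 , λ _ _ ()
  Eventually-∀ {suc m} p =
    mapE (λ { n (p₀ , ps) zero → p₀ ; n (p₀ , ps) (suc i) → ps i }) (p zero & Eventually-∀ (p ∘ suc))

  -- The real and the complex numbers as commutative rings

  ≗⇒≃ : ∀ x y → (∀ n → seq x n ≡ seq y n) → x ≃ y
  ≗⇒≃ x y x≗y ε 0<ε = always λ n → subst (λ z → ℚ.∣ seq x n ℚ.- z ∣ ℚ.< ε) (x≗y n)
    (subst (λ z → ℚ.∣ z ∣ ℚ.< ε) (≡.sym (ℚ.+-inverseʳ (seq x n))) 0<ε)

  ≃-sym : ∀ {x y} → x ≃ y → y ≃ x
  ≃-sym {x} {y} x≃y ε 0<ε = mapE (λ n → subst (ℚ._< ε) (∣p-q∣≡∣q-p∣ (seq x n) (seq y n))) (x≃y ε 0<ε)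

  ∣p-r∣<ε : ∀ p q r ε → ℚ.∣ p ℚ.- q ∣ ℚ.< ε ℚ.* ½ → ℚ.∣ q ℚ.- r ∣ ℚ.< ε ℚ.* ½ → ℚ.∣ p ℚ.- r ∣ ℚ.< ε
  ∣p-r∣<ε p q r ε p-q q-r = begin-strict
    ℚ.∣ p ℚ.- r ∣                        ≡⟨ cong ℚ.∣_∣ (solve 3 (λ p q r → p :- r := (p :- q) :+ (q :- r)) ≡.refl p q r) ⟩
    ℚ.∣ (p ℚ.- q) ℚ.+ (q ℚ.- r) ∣        ≤⟨ ℚ.∣p+q∣≤∣p∣+∣q∣ (p ℚ.- q) (q ℚ.- r) ⟩
    ℚ.∣ p ℚ.- q ∣ ℚ.+ ℚ.∣ q ℚ.- r ∣      <⟨ ℚ.+-mono-< p-q q-r ⟩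
    ε ℚ.* ½ ℚ.+ ε ℚ.* ½                  ≡⟨ half+half ε ⟩
    ε                                    ∎
    where open ℚ.≤-Reasoning

  ≃-trans : ∀ {x y z} → x ≃ y → y ≃ z → x ≃ z
  ≃-trans {x} {y} {z} x≃y y≃z ε 0<ε =
    mapE (λ n (p , q) → ∣p-r∣<ε (seq x n) (seq y n) (seq z n) ε p q)
      (x≃y (ε ℚ.* ½) (half-pos 0<ε) & y≃z (ε ℚ.* ½) (half-pos 0<ε))

  private module Raw = RawRing ℝ-rawRing

  +-≃ : ∀ {x x′ y y′} → x ≃ x′ → y ≃ y′ → (x Raw.+ y) ≃ (x′ Raw.+ y′)
  +-≃ {x} {x′} {y} {y′} x≃x′ y≃y′ ε 0<ε = mapE step (x≃x′ (ε ℚ.* ½) (half-pos 0<ε) & y≃y′ (ε ℚ.* ½) (half-pos 0<ε))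
    where
    open ℚ.≤-Reasoning
    step : ∀ n → ℚ.∣ seq x n ℚ.- seq x′ n ∣ ℚ.< ε ℚ.* ½ × ℚ.∣ seq y n ℚ.- seq y′ n ∣ ℚ.< ε ℚ.* ½ →
           ℚ.∣ (seq x n ℚ.+ seq y n) ℚ.- (seq x′ n ℚ.+ seq y′ n) ∣ ℚ.< ε
    step n (p , q) = begin-strict
      ℚ.∣ (seq x n ℚ.+ seq y n) ℚ.- (seq x′ n ℚ.+ seq y′ n) ∣
        ≡⟨ cong ℚ.∣_∣ (solve 4 (λ a b c d → (a :+ c) :- (b :+ d) := (a :- b) :+ (c :- d)) ≡.refl
             (seq x n) (seq x′ n) (seq y n) (seq y′ n)) ⟩
      ℚ.∣ (seq x n ℚ.- seq x′ n) ℚ.+ (seq y n ℚ.- seq y′ n) ∣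
        ≤⟨ ℚ.∣p+q∣≤∣p∣+∣q∣ (seq x n ℚ.- seq x′ n) (seq y n ℚ.- seq y′ n) ⟩
      ℚ.∣ seq x n ℚ.- seq x′ n ∣ ℚ.+ ℚ.∣ seq y n ℚ.- seq y′ n ∣
        <⟨ ℚ.+-mono-< p q ⟩
      ε ℚ.* ½ ℚ.+ ε ℚ.* ½
        ≡⟨ half+half ε ⟩
      ε ∎

  neg-≃ : ∀ {x y} → x ≃ y → (Raw.- x) ≃ (Raw.- y)
  neg-≃ {x} {y} x≃y ε 0<ε = mapE (λ n → subst (ℚ._< ε)
    (≡.trans (∣p-q∣≡∣q-p∣ (seq x n) (seq y n))
             (cong ℚ.∣_∣ (solve 2 (λ a b → b :- a := (:- a) :- (:- b)) ≡.refl (seq x n) (seq y n)))))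
    (x≃y ε 0<ε)

  Bounded : ℝ → Set
  Bounded x = ∃ λ B → 0ℚ ℚ.< B × Eventually (λ n → ℚ.∣ seq x n ∣ ℚ.< B)

  bound : ∀ x → Bounded x
  bound x = bounded {seq x} (cauchy x)

  *-≃ : ∀ {x x′ y y′} → x ≃ x′ → y ≃ y′ → (x Raw.* y) ≃ (x′ Raw.* y′)
  *-≃ {x} {x′} {y} {y′} x≃x′ y≃y′ ε 0<ε =
    -- In the splitting `x (y − y′) + y′ (x − x′)` the outer factors are `x` and `y′`, so these two
    -- are bounded.
    let B  , 0<B  , b  = bound x
        B′ , 0<B′ , b′ = bound y′
        δ  , 0<δ  , e  = quotient (half-pos 0<ε) 0<B
        δ′ , 0<δ′ , e′ = quotient (half-pos 0<ε) 0<B′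
    in mapE (λ n (xB , yB , yδ , xδ) →
              close 0<B 0<B′ e e′ (seq x n) (seq x′ n) (seq y n) (seq y′ n) xB yB yδ xδ)
            (b & b′ & y≃y′ δ 0<δ & x≃x′ δ′ 0<δ′)
    where
    open ℚ.≤-Reasoning
    close : ∀ {B B′ δ δ′} → 0ℚ ℚ.< B → 0ℚ ℚ.< B′ → B ℚ.* δ ≡ ε ℚ.* ½ → B′ ℚ.* δ′ ≡ ε ℚ.* ½ →
      ∀ x x′ y y′ → ℚ.∣ x ∣ ℚ.< B → ℚ.∣ y′ ∣ ℚ.< B′ → ℚ.∣ y ℚ.- y′ ∣ ℚ.< δ → ℚ.∣ x ℚ.- x′ ∣ ℚ.< δ′ →
      ℚ.∣ x ℚ.* y ℚ.- x′ ℚ.* y′ ∣ ℚ.< ε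
    close {B} {B′} {δ} {δ′} 0<B 0<B′ e e′ x x′ y y′ xB yB yδ xδ = begin-strict
      ℚ.∣ x ℚ.* y ℚ.- x′ ℚ.* y′ ∣
        ≡⟨ cong ℚ.∣_∣ (*-split x y x′ y′) ⟩
      ℚ.∣ x ℚ.* (y ℚ.- y′) ℚ.+ y′ ℚ.* (x ℚ.- x′) ∣
        ≤⟨ ℚ.∣p+q∣≤∣p∣+∣q∣ (x ℚ.* (y ℚ.- y′)) (y′ ℚ.* (x ℚ.- x′)) ⟩
      ℚ.∣ x ℚ.* (y ℚ.- y′) ∣ ℚ.+ ℚ.∣ y′ ℚ.* (x ℚ.- x′) ∣
        <⟨ ℚ.+-mono-< (*-bound 0<B x (y ℚ.- y′) xB yδ) (*-bound 0<B′ y′ (x ℚ.- x′) yB xδ) ⟩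
      B ℚ.* δ ℚ.+ B′ ℚ.* δ′
        ≡⟨ cong₂ ℚ._+_ e e′ ⟩
      ε ℚ.* ½ ℚ.+ ε ℚ.* ½
        ≡⟨ half+half ε ⟩
      ε ∎

  -- The operations act termwise on approximants, so the ring laws are inherited termwise from the
  -- rationals; estimates enter through the equivalence and the congruences.
  ℝ-commutativeRing : CommutativeRing 0ℓ 0ℓ
  ℝ-commutativeRing = record
    { Carrier = ℝ
    ; _≈_     = _≃_
    ; _+_     = Raw._+_
    ; _*_     = Raw._*_
    ; -_      = Raw.-_
    ; 0#      = 0ℝ
    ; 1#      = 1ℝ
    ; isCommutativeRing = record
      { isRing = record
        { +-isAbelianGroup = record
          { isGroup = record
            { isMonoid = record
              { isSemigroup = record
                { isMagma = record
                  { isEquivalence = record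
                    { refl  = λ {x} → ≗⇒≃ x x (λ _ → ≡.refl)
                    ; sym   = λ {x y} → ≃-sym {x} {y}
                    ; trans = λ {x y z} → ≃-trans {x} {y} {z}
                    }
                  ; ∙-cong = λ {x x′ y y′} → +-≃ {x} {x′} {y} {y′}
                  }
                ; assoc = λ x y z → ≗⇒≃ ((x Raw.+ y) Raw.+ z) (x Raw.+ (y Raw.+ z)) (λ n → ℚ.+-assoc (seq x n) (seq y n) (seq z n))
                }
              ; identity = (λ x → ≗⇒≃ (Raw.0# Raw.+ x) (x) (λ n → ℚ.+-identityˡ (seq x n))) ,
                           (λ x → ≗⇒≃ (x Raw.+ Raw.0#) (x) (λ n → ℚ.+-identityʳ (seq x n)))
              }
            ; inverse = (λ x → ≗⇒≃ ((Raw.- x) Raw.+ x) (Raw.0#) (λ n → ℚ.+-inverseˡ (seq x n))) ,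
                        (λ x → ≗⇒≃ (x Raw.+ (Raw.- x)) (Raw.0#) (λ n → ℚ.+-inverseʳ (seq x n)))
            ; ⁻¹-cong = λ {x y} → neg-≃ {x} {y}
            }
          ; comm = λ x y → ≗⇒≃ (x Raw.+ y) (y Raw.+ x) (λ n → ℚ.+-comm (seq x n) (seq y n))
          }
        ; *-cong     = λ {x x′ y y′} → *-≃ {x} {x′} {y} {y′}
        ; *-assoc    = λ x y z → ≗⇒≃ ((x Raw.* y) Raw.* z) (x Raw.* (y Raw.* z)) (λ n → ℚ.*-assoc (seq x n) (seq y n) (seq z n))
        ; *-identity = (λ x → ≗⇒≃ (Raw.1# Raw.* x) (x) (λ n → ℚ.*-identityˡ (seq x n))) ,
                       (λ x → ≗⇒≃ (x Raw.* Raw.1#) (x) (λ n → ℚ.*-identityʳ (seq x n)))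
        ; distrib    = (λ x y z → ≗⇒≃ (x Raw.* (y Raw.+ z)) ((x Raw.* y) Raw.+ (x Raw.* z)) (λ n → ℚ.*-distribˡ-+ (seq x n) (seq y n) (seq z n))) ,
                       (λ x y z → ≗⇒≃ ((y Raw.+ z) Raw.* x) ((y Raw.* x) Raw.+ (z Raw.* x)) (λ n → ℚ.*-distribʳ-+ (seq x n) (seq y n) (seq z n)))
        }
      ; *-comm = λ x y → ≗⇒≃ (x Raw.* y) (y Raw.* x) (λ n → ℚ.*-comm (seq x n) (seq y n))
      }
    }

  private module C = RawRing ℂ-rawRing

  module Re = CommutativeRing ℝ-commutativeRing

  -- An identity between complex expressions holds once it holds in ℚ for both parts of every
  -- pair of approximants.
  re≗⇒≈ : ∀ z w → (∀ n → seq (re z) n ≡ seq (re w) n) → (∀ n → seq (im z) n ≡ seq (im w) n) → z C.≈ w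
  re≗⇒≈ z w p q = ≗⇒≃ (re z) (re w) p , ≗⇒≃ (im z) (im w) q

  ℂ-commutativeRing : CommutativeRing 0ℓ 0ℓ
  ℂ-commutativeRing = record
    { Carrier = ℂ
    ; _≈_     = C._≈_
    ; _+_     = C._+_
    ; _*_     = C._*_
    ; -_      = C.-_
    ; 0#      = C.0#
    ; 1#      = C.1#
    ; isCommutativeRing = record
      { isRing = record
        { +-isAbelianGroup = record
          { isGroup = record
            { isMonoid = record
              { isSemigroup = record
                { isMagma = record
                  { isEquivalence = record
                    { refl  = λ {z} → Re.refl {re z} , Re.refl {im z}
                    ; sym   = λ {z w} (p , q) → Re.sym {re z} {re w} p , Re.sym {im z} {im w} q
                    ; trans = λ {z w v} (p , q) (p′ , q′) →
                        Re.trans {re z} {re w} {re v} p p′ , Re.trans {im z} {im w} {im v} q q′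
                    }
                  ; ∙-cong = λ {z z′ w w′} (p , q) (p′ , q′) →
                      +-≃ {re z} {re z′} {re w} {re w′} p p′ , +-≃ {im z} {im z′} {im w} {im w′} q q′
                  }
                ; assoc = λ z w v → re≗⇒≈ ((z C.+ w) C.+ v) (z C.+ (w C.+ v))
                    (λ n → ℚ.+-assoc (seq (re z) n) (seq (re w) n) (seq (re v) n))
                    (λ n → ℚ.+-assoc (seq (im z) n) (seq (im w) n) (seq (im v) n))
                }
              ; identity = (λ z → re≗⇒≈ (C.0# C.+ z) (z) (λ n → ℚ.+-identityˡ (seq (re z) n)) (λ n → ℚ.+-identityˡ (seq (im z) n))) ,
                           (λ z → re≗⇒≈ (z C.+ C.0#) (z) (λ n → ℚ.+-identityʳ (seq (re z) n)) (λ n → ℚ.+-identityʳ (seq (im z) n)))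
              }
            ; inverse = (λ z → re≗⇒≈ ((C.- z) C.+ z) (C.0#) (λ n → ℚ.+-inverseˡ (seq (re z) n)) (λ n → ℚ.+-inverseˡ (seq (im z) n))) ,
                        (λ z → re≗⇒≈ (z C.+ (C.- z)) (C.0#) (λ n → ℚ.+-inverseʳ (seq (re z) n)) (λ n → ℚ.+-inverseʳ (seq (im z) n)))
            ; ⁻¹-cong = λ {z w} (p , q) → neg-≃ {re z} {re w} p , neg-≃ {im z} {im w} q
            }
          ; comm = λ z w → re≗⇒≈ (z C.+ w) (w C.+ z) (λ n → ℚ.+-comm (seq (re z) n) (seq (re w) n))
                                 (λ n → ℚ.+-comm (seq (im z) n) (seq (im w) n))
          }
        ; *-cong     = λ {z z′ w w′} (p , q) (p′ , q′) →
            +-≃ {re z Raw.* re w} {re z′ Raw.* re w′} {Raw.- (im z Raw.* im w)} {Raw.- (im z′ Raw.* im w′)}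
              (*-≃ {re z} {re z′} {re w} {re w′} p p′)
              (neg-≃ {im z Raw.* im w} {im z′ Raw.* im w′} (*-≃ {im z} {im z′} {im w} {im w′} q q′)) ,
            +-≃ {re z Raw.* im w} {re z′ Raw.* im w′} {im z Raw.* re w} {im z′ Raw.* re w′}
              (*-≃ {re z} {re z′} {im w} {im w′} p q′)
              (*-≃ {im z} {im z′} {re w} {re w′} q p′)
        ; *-assoc    = λ z w v → re≗⇒≈ ((z C.* w) C.* v) (z C.* (w C.* v))
            (λ n → solve 6 (λ a b c d e f → (a :* c :- b :* d) :* e :- (a :* d :+ b :* c) :* f :=
                                            a :* (c :* e :- d :* f) :- b :* (c :* f :+ d :* e)) ≡.refl
                     (seq (re z) n) (seq (im z) n) (seq (re w) n) (seq (im w) n) (seq (re v) n) (seq (im v) n))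
            (λ n → solve 6 (λ a b c d e f → (a :* c :- b :* d) :* f :+ (a :* d :+ b :* c) :* e :=
                                            a :* (c :* f :+ d :* e) :+ b :* (c :* e :- d :* f)) ≡.refl
                     (seq (re z) n) (seq (im z) n) (seq (re w) n) (seq (im w) n) (seq (re v) n) (seq (im v) n))
        ; *-identity =
            (λ z → re≗⇒≈ (C.1# C.* z) (z)
              (λ n → solve 2 (λ a b → con 1ℚ :* a :- con 0ℚ :* b := a) ≡.refl (seq (re z) n) (seq (im z) n))
              (λ n → solve 2 (λ a b → con 1ℚ :* b :+ con 0ℚ :* a := b) ≡.refl (seq (re z) n) (seq (im z) n))) ,
            (λ z → re≗⇒≈ (z C.* C.1#) (z)
              (λ n → solve 2 (λ a b → a :* con 1ℚ :- b :* con 0ℚ := a) ≡.refl (seq (re z) n) (seq (im z) n))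
              (λ n → solve 2 (λ a b → a :* con 0ℚ :+ b :* con 1ℚ := b) ≡.refl (seq (re z) n) (seq (im z) n)))
        ; distrib    =
            (λ z w v → re≗⇒≈ (z C.* (w C.+ v)) ((z C.* w) C.+ (z C.* v))
              (λ n → solve 6 (λ a b c d e f → a :* (c :+ e) :- b :* (d :+ f) :=
                                              (a :* c :- b :* d) :+ (a :* e :- b :* f)) ≡.refl
                       (seq (re z) n) (seq (im z) n) (seq (re w) n) (seq (im w) n) (seq (re v) n) (seq (im v) n))
              (λ n → solve 6 (λ a b c d e f → a :* (d :+ f) :+ b :* (c :+ e) :=
                                              (a :* d :+ b :* c) :+ (a :* f :+ b :* e)) ≡.refl
                       (seq (re z) n) (seq (im z) n) (seq (re w) n) (seq (im w) n) (seq (re v) n) (seq (im v) n))) ,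
            (λ z w v → re≗⇒≈ ((w C.+ v) C.* z) ((w C.* z) C.+ (v C.* z))
              (λ n → solve 6 (λ a b c d e f → (c :+ e) :* a :- (d :+ f) :* b :=
                                              (c :* a :- d :* b) :+ (e :* a :- f :* b)) ≡.refl
                       (seq (re z) n) (seq (im z) n) (seq (re w) n) (seq (im w) n) (seq (re v) n) (seq (im v) n))
              (λ n → solve 6 (λ a b c d e f → (c :+ e) :* b :+ (d :+ f) :* a :=
                                              (c :* b :+ d :* a) :+ (e :* b :+ f :* a)) ≡.refl
                       (seq (re z) n) (seq (im z) n) (seq (re w) n) (seq (im w) n) (seq (re v) n) (seq (im v) n)))
        }
      ; *-comm = λ z w → re≗⇒≈ (z C.* w) (w C.* z)
          (λ n → solve 4 (λ a b c d → a :* c :- b :* d := c :* a :- d :* b) ≡.refl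
                   (seq (re z) n) (seq (im z) n) (seq (re w) n) (seq (im w) n))
          (λ n → solve 4 (λ a b c d → a :* d :+ b :* c := c :* b :+ d :* a) ≡.refl
                   (seq (re z) n) (seq (im z) n) (seq (re w) n) (seq (im w) n))
      }
    }

  -- Positivity and apartness of reals

  module Polyℝ = Polynomials ℝ-commutativeRing
  module Polyℚ = Polynomials ℚ.+-*-commutativeRing
  open Re using () renaming (_+_ to _+ᴿ_; _*_ to _*ᴿ_; _-_ to _-ᴿ_; -_ to -ᴿ_)

  Pos : ℝ → Set
  Pos x = ∃ λ ε → 0ℚ ℚ.< ε × Eventually (λ n → ε ℚ.< seq x n)

  -- A lower bound for the absolute value leaves the sign open. Estimates for products and factors
  -- come out in this form, and the sign is added where it is known termwise.
  Apart : ℝ → Set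
  Apart x = ∃ λ ε → 0ℚ ℚ.< ε × Eventually (λ n → ε ℚ.< ℚ.∣ seq x n ∣)

  close-pos : ∀ {ε} p q → ε ℚ.< p → ℚ.∣ p ℚ.- q ∣ ℚ.< ε ℚ.* ½ → ε ℚ.* ½ ℚ.< q
  close-pos {ε} p q ε<p p-q = begin-strict
    ε ℚ.* ½                         ≡⟨ solve 2 (λ h q → h := (h :+ h) :- h) ≡.refl (ε ℚ.* ½) q ⟩
    (ε ℚ.* ½ ℚ.+ ε ℚ.* ½) ℚ.- ε ℚ.* ½ ≡⟨ cong (ℚ._- ε ℚ.* ½) (half+half ε) ⟩
    ε ℚ.- ε ℚ.* ½                   <⟨ ℚ.+-mono-< ε<p (ℚ.neg-antimono-< (ℚ.≤-<-trans (p≤∣p∣ (p ℚ.- q)) p-q)) ⟩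
    p ℚ.- (p ℚ.- q)                 ≡⟨ solve 2 (λ p q → p :- (p :- q) := q) ≡.refl p q ⟩
    q                               ∎
    where open ℚ.≤-Reasoning

  ∣p∣-∣q∣≤∣p-q∣ : ∀ p q → ℚ.∣ p ∣ ℚ.- ℚ.∣ q ∣ ℚ.≤ ℚ.∣ p ℚ.- q ∣
  ∣p∣-∣q∣≤∣p-q∣ p q = begin
    ℚ.∣ p ∣ ℚ.- ℚ.∣ q ∣
      ≡⟨ cong (λ z → ℚ.∣ z ∣ ℚ.- ℚ.∣ q ∣) (solve 2 (λ p q → p := (p :- q) :+ q) ≡.refl p q) ⟩
    ℚ.∣ (p ℚ.- q) ℚ.+ q ∣ ℚ.- ℚ.∣ q ∣
      ≤⟨ ℚ.+-monoˡ-≤ (ℚ.- ℚ.∣ q ∣) (ℚ.∣p+q∣≤∣p∣+∣q∣ (p ℚ.- q) q) ⟩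
    (ℚ.∣ p ℚ.- q ∣ ℚ.+ ℚ.∣ q ∣) ℚ.- ℚ.∣ q ∣
      ≡⟨ solve 2 (λ a b → (a :+ b) :- b := a) ≡.refl ℚ.∣ p ℚ.- q ∣ ℚ.∣ q ∣ ⟩
    ℚ.∣ p ℚ.- q ∣ ∎
    where open ℚ.≤-Reasoning

  ∣∣p∣-∣q∣∣≤∣p-q∣ : ∀ p q → ℚ.∣ ℚ.∣ p ∣ ℚ.- ℚ.∣ q ∣ ∣ ℚ.≤ ℚ.∣ p ℚ.- q ∣
  ∣∣p∣-∣q∣∣≤∣p-q∣ p q with ℚ.∣p∣≡p∨∣p∣≡-p (ℚ.∣ p ∣ ℚ.- ℚ.∣ q ∣)
  ... | inj₁ eq = subst (ℚ._≤ ℚ.∣ p ℚ.- q ∣) (≡.sym eq) (∣p∣-∣q∣≤∣p-q∣ p q)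
  ... | inj₂ eq = subst₂ ℚ._≤_
    (≡.trans (solve 2 (λ a b → b :- a := :- (a :- b)) ≡.refl ℚ.∣ p ∣ ℚ.∣ q ∣) (≡.sym eq))
    (∣p-q∣≡∣q-p∣ q p) (∣p∣-∣q∣≤∣p-q∣ q p)

  pos-resp-≃ : ∀ {x y} → x ≃ y → Pos x → Pos y
  pos-resp-≃ {x} {y} x≃y (ε , 0<ε , p) = ε ℚ.* ½ , half-pos 0<ε ,
    mapE (λ n (ε<x , x-y) → close-pos (seq x n) (seq y n) ε<x x-y) (p & x≃y (ε ℚ.* ½) (half-pos 0<ε))

  apart-resp-≃ : ∀ {x y} → x ≃ y → Apart x → Apart y
  apart-resp-≃ {x} {y} x≃y (ε , 0<ε , p) = ε ℚ.* ½ , half-pos 0<ε ,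
    mapE (λ n (ε<x , x-y) → close-pos ℚ.∣ seq x n ∣ ℚ.∣ seq y n ∣ ε<x
           (ℚ.≤-<-trans (∣∣p∣-∣q∣∣≤∣p-q∣ (seq x n) (seq y n)) x-y))
         (p & x≃y (ε ℚ.* ½) (half-pos 0<ε))

  pos-* : ∀ {x y} → Pos x → Pos y → Pos (x *ᴿ y)
  pos-* (ε , 0<ε , p) (ε′ , 0<ε′ , q) = ε ℚ.* ε′ , *-pos 0<ε 0<ε′ ,
    mapE (λ n (ε<x , ε′<y) → *-mono-<-pos 0<ε (ℚ.<-trans 0<ε′ ε′<y) ε<x ε′<y) (p & q)

  pos⇒apart : ∀ {x} → Pos x → Apart x
  pos⇒apart {x} (ε , 0<ε , p) = ε , 0<ε , mapE (λ n ε<x → ℚ.<-≤-trans ε<x (p≤∣p∣ (seq x n))) p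

  neg⇒apart : ∀ {x} → Pos (-ᴿ x) → Apart x
  neg⇒apart {x} (ε , 0<ε , p) = ε , 0<ε , mapE (λ n ε<-x → ℚ.<-≤-trans ε<-x (-p≤∣p∣ (seq x n))) p

  <⇒pos : ∀ {x y} → x < y → Pos (y -ᴿ x)
  <⇒pos {x} {y} (ε , 0<ε , p) = ε , 0<ε , mapE (λ n x+ε<y → 0<q-p⇒p<q
    (subst (0ℚ ℚ.<_) (solve 3 (λ x y ε → y :- (x :+ ε) := (y :- x) :- ε) ≡.refl (seq x n) (seq y n) ε)
      (p<q⇒0<q-p x+ε<y))) p

  pos⇒< : ∀ {x y} → Pos (y -ᴿ x) → x < y
  pos⇒< {x} {y} (ε , 0<ε , p) = ε , 0<ε , mapE (λ n ε<y-x → 0<q-p⇒p<q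
    (subst (0ℚ ℚ.<_) (solve 3 (λ x y ε → (y :- x) :- ε := y :- (x :+ ε)) ≡.refl (seq x n) (seq y n) ε)
      (p<q⇒0<q-p ε<y-x))) p

  <-eventually : ∀ {x y} → x < y → Eventually (λ n → seq x n ℚ.< seq y n)
  <-eventually {x} (ε , 0<ε , p) = mapE (λ n x+ε<y →
    ℚ.<-trans (subst (ℚ._< seq x n ℚ.+ ε) (ℚ.+-identityʳ (seq x n)) (ℚ.+-monoʳ-< (seq x n) 0<ε)) x+ε<y) p

  <-≤-transᴿ : ∀ {x y z} → x < y → (∀ n → seq y n ℚ.≤ seq z n) → x < z
  <-≤-transᴿ (ε , 0<ε , p) y≤z = ε , 0<ε , mapE (λ n x+ε<y → ℚ.<-≤-trans x+ε<y (y≤z n)) p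

  <-transᴿ : ∀ {x y z} → x < y → y < z → x < z
  <-transᴿ {x} {y} x<y (ε , 0<ε , q) = ε , 0<ε ,
    mapE (λ n (x<y , y+ε<z) → ℚ.<-trans (ℚ.+-monoˡ-< ε x<y) y+ε<z) (<-eventually {x} {y} x<y & q)

  -- An approximant of `y` of size at least `ε` would make the product at least `δ * ε` in absolute
  -- value, against the smallness of `x * y` at that tolerance.
  apart-cancel : ∀ {x} → Apart x → Polyℝ.Cancellable x
  apart-cancel {x} (δ , 0<δ , p) y xy≃0 ε 0<ε =
    mapE (λ n (δ<x , xy) → ℚ.≰⇒> (λ ε≤y → ℚ.<-irrefl ≡.refl (ℚ.<-≤-trans (small xy) (large n δ<x ε≤y))))
         (p & xy≃0 (δ ℚ.* ε) (*-pos 0<δ 0<ε))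
    where
    open ℚ.≤-Reasoning
    small : ∀ {p} → ℚ.∣ p ℚ.- 0ℚ ∣ ℚ.< δ ℚ.* ε → ℚ.∣ p ∣ ℚ.< δ ℚ.* ε
    small {p} = subst (λ z → ℚ.∣ z ∣ ℚ.< δ ℚ.* ε) (ℚ.+-identityʳ p)
    large : ∀ n → δ ℚ.< ℚ.∣ seq x n ∣ → ε ℚ.≤ ℚ.∣ seq y n ℚ.- 0ℚ ∣ → δ ℚ.* ε ℚ.≤ ℚ.∣ seq x n ℚ.* seq y n ∣
    large n δ<x ε≤y = begin
      δ ℚ.* ε
        ≤⟨ ℚ.*-monoˡ-≤-nonNeg δ {{nonNegative (ℚ.<⇒≤ 0<δ)}} ε≤y ⟩
      δ ℚ.* ℚ.∣ seq y n ℚ.- 0ℚ ∣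
        ≡⟨ cong (λ z → δ ℚ.* ℚ.∣ z ∣) (ℚ.+-identityʳ (seq y n)) ⟩
      δ ℚ.* ℚ.∣ seq y n ∣
        ≤⟨ ℚ.*-monoʳ-≤-nonNeg ℚ.∣ seq y n ∣ {{ℚ.∣-∣-nonNeg (seq y n)}} (ℚ.<⇒≤ δ<x) ⟩
      ℚ.∣ seq x n ∣ ℚ.* ℚ.∣ seq y n ∣
        ≡⟨ ℚ.∣p*q∣≡∣p∣*∣q∣ (seq x n) (seq y n) ⟨
      ℚ.∣ seq x n ℚ.* seq y n ∣ ∎

  -- The other factor is bounded by some `B`, so a product that stays above `ε` keeps this factor
  -- above `ε / B`.
  apart-factor : ∀ {x y} → Apart (x *ᴿ y) → Apart x
  apart-factor {x} {y} (ε , 0<ε , p) =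
    let B , 0<B , b = bound y
        δ , 0<δ , e = quotient 0<ε 0<B
    in δ , 0<δ , mapE (λ n (ε<xy , y<B) → ℚ.≰⇒> (λ x≤δ →
         ℚ.<-irrefl ≡.refl (ℚ.<-≤-trans ε<xy (small B 0<B δ e n y<B x≤δ)))) (p & b)
    where
    open ℚ.≤-Reasoning
    small : ∀ B → 0ℚ ℚ.< B → ∀ δ → B ℚ.* δ ≡ ε → ∀ n → ℚ.∣ seq y n ∣ ℚ.< B → ℚ.∣ seq x n ∣ ℚ.≤ δ →
            ℚ.∣ seq x n ℚ.* seq y n ∣ ℚ.≤ ε
    small B 0<B δ e n y<B x≤δ = begin
      ℚ.∣ seq x n ℚ.* seq y n ∣
        ≡⟨ ℚ.∣p*q∣≡∣p∣*∣q∣ (seq x n) (seq y n) ⟩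
      ℚ.∣ seq x n ∣ ℚ.* ℚ.∣ seq y n ∣
        ≤⟨ ℚ.*-monoˡ-≤-nonNeg ℚ.∣ seq x n ∣ {{ℚ.∣-∣-nonNeg (seq x n)}} (ℚ.<⇒≤ y<B) ⟩
      ℚ.∣ seq x n ∣ ℚ.* B
        ≤⟨ ℚ.*-monoʳ-≤-nonNeg B {{nonNegative (ℚ.<⇒≤ 0<B)}} x≤δ ⟩
      δ ℚ.* B
        ≡⟨ ≡.trans (ℚ.*-comm δ B) e ⟩
      ε ∎

  -- Bisection yields weak termwise inequalities between a root and the ends of its interval; with
  -- apartness they become strict.
  apart-≥0 : ∀ {x} → Apart x → (∀ n → 0ℚ ℚ.≤ seq x n) → Pos x
  apart-≥0 (ε , 0<ε , p) 0≤x = ε , 0<ε , mapE (λ n → subst (ε ℚ.<_) (ℚ.0≤p⇒∣p∣≡p (0≤x n))) p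

  apart-≤0 : ∀ {x} → Apart x → (∀ n → seq x n ℚ.≤ 0ℚ) → Pos (-ᴿ x)
  apart-≤0 {x} (ε , 0<ε , p) x≤0 = ε , 0<ε , mapE (λ n → subst (ε ℚ.<_)
    (≡.trans (≡.sym (ℚ.∣-p∣≡∣p∣ (seq x n))) (ℚ.0≤p⇒∣p∣≡p (ℚ.neg-antimono-≤ (x≤0 n))))) p

  ½<1 : ½ ℚ.< 1ℚ
  ½<1 = subst (½ ℚ.<_) (half+half 1ℚ) (subst (ℚ._< ½ ℚ.+ ½) (ℚ.+-identityʳ ½) (ℚ.+-monoʳ-< ½ (ℚ.positive⁻¹ ½)))

  pos-1 : Pos 1ℝ
  pos-1 = ½ , ℚ.positive⁻¹ ½ , always λ _ → ½<1

  pos⇒≄0 : ∀ {x} → Pos x → ¬ (x ≃ 0ℝ)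
  pos⇒≄0 {x} px x≃0 =
    let ε , 0<ε , N , p = pos-resp-≃ {x} {0ℝ} x≃0 px in ℚ.<-asym 0<ε (p N ℕ.≤-refl)

  -- Approximants of values and their signs

  0≤ι : ∀ k → 0ℚ ℚ.≤ Polyℚ.ι k
  0≤ι zero    = ℚ.≤-refl
  0≤ι (suc k) = ℚ.+-mono-≤ (ℚ.nonNegative⁻¹ 1ℚ) (0≤ι k)

  seq-ι : ∀ k n → seq (Polyℝ.ι k) n ≡ Polyℚ.ι k
  seq-ι zero    n = ≡.refl
  seq-ι (suc k) n = cong (1ℚ ℚ.+_) (seq-ι k n)

  1≤ι : ∀ {k} → 1 ℕ.≤ k → 1ℚ ℚ.≤ Polyℚ.ι k
  1≤ι {suc k} _ = subst (ℚ._≤ 1ℚ ℚ.+ Polyℚ.ι k) (ℚ.+-identityʳ 1ℚ) (ℚ.+-monoʳ-≤ 1ℚ (0≤ι k))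

  pos-ι : ∀ {k} → 1 ℕ.≤ k → Pos (Polyℝ.ι k)
  pos-ι {k} 1≤k = let ε , 0<ε , p = pos-1 in ε , 0<ε , mapE (λ n ε<1 → ℚ.<-≤-trans ε<1
    (subst (1ℚ ℚ.≤_) (≡.sym (seq-ι k n)) (1≤ι 1≤k))) p

  -- Because of this, the sign of a polynomial at a real can be read off at rational points.
  seq-ev : ∀ m b x n → seq (Polyℝ.ev m (Polyℝ.ι ∘ b) x) n ≡ Polyℚ.ev m (Polyℚ.ι ∘ b) (seq x n)
  seq-ev zero    b x n = seq-ι (b 0) n
  seq-ev (suc m) b x n = cong₂ (λ c p → c ℚ.+ seq x n ℚ.* p) (seq-ι (b 0) n) (seq-ev m (b ∘ suc) x n)

  -- Multiplication by `(−1)^i`, as iterated negation.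
  sgnℚ : ℕ → ℚ → ℚ
  sgnℚ zero    p = p
  sgnℚ (suc i) p = sgnℚ i (ℚ.- p)

  sgnℝ : ℕ → ℝ → ℝ
  sgnℝ zero    x = x
  sgnℝ (suc i) x = sgnℝ i (-ᴿ x)

  seq-sgn : ∀ i x n → seq (sgnℝ i x) n ≡ sgnℚ i (seq x n)
  seq-sgn zero    x n = ≡.refl
  seq-sgn (suc i) x n = seq-sgn i (-ᴿ x) n

  sgnℚ-* : ∀ i p q → sgnℚ i (p ℚ.* q) ≡ p ℚ.* sgnℚ i q
  sgnℚ-* zero    p q = ≡.refl
  sgnℚ-* (suc i) p q = ≡.trans (cong (sgnℚ i) (ℚ.neg-distribʳ-* p q)) (sgnℚ-* i p (ℚ.- q))

  sgnℚ-+ : ∀ i p q → sgnℚ i (p ℚ.+ q) ≡ sgnℚ i p ℚ.+ sgnℚ i q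
  sgnℚ-+ zero    p q = ≡.refl
  sgnℚ-+ (suc i) p q = ≡.trans (cong (sgnℚ i) (ℚ.neg-distrib-+ p q)) (sgnℚ-+ i (ℚ.- p) (ℚ.- q))

  sgnℚ-neg : ∀ i p → sgnℚ i (ℚ.- p) ≡ ℚ.- sgnℚ i p
  sgnℚ-neg zero    p = ≡.refl
  sgnℚ-neg (suc i) p = sgnℚ-neg i (ℚ.- p)

  ∣sgnℚ∣ : ∀ i p → ℚ.∣ sgnℚ i p ∣ ≡ ℚ.∣ p ∣
  ∣sgnℚ∣ zero    p = ≡.refl
  ∣sgnℚ∣ (suc i) p = ≡.trans (∣sgnℚ∣ i (ℚ.- p)) (ℚ.∣-p∣≡∣p∣ p)

  sgnℝ-≃ : ∀ i {x y} → x ≃ y → sgnℝ i x ≃ sgnℝ i y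
  sgnℝ-≃ zero    x≃y = x≃y
  sgnℝ-≃ (suc i) {x} {y} x≃y = sgnℝ-≃ i { -ᴿ x} { -ᴿ y} (neg-≃ {x} {y} x≃y)

  sgnℝ-* : ∀ i x y → (x *ᴿ sgnℝ i y) ≃ sgnℝ i (x *ᴿ y)
  sgnℝ-* i x y = ≗⇒≃ (x *ᴿ sgnℝ i y) (sgnℝ i (x *ᴿ y)) λ n →
    ≡.trans (cong (seq x n ℚ.*_) (seq-sgn i y n))
      (≡.trans (≡.sym (sgnℚ-* i (seq x n) (seq y n))) (≡.sym (seq-sgn i (x *ᴿ y) n)))

  pos-sgn-* : ∀ i {x y} → Pos x → Pos (sgnℝ i y) → Pos (sgnℝ i (x *ᴿ y))
  pos-sgn-* i {x} {y} px py =
    pos-resp-≃ {x *ᴿ sgnℝ i y} {sgnℝ i (x *ᴿ y)} (sgnℝ-* i x y) (pos-* {x} {sgnℝ i y} px py)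

  pos-sgn⇒apart : ∀ i {x} → Pos (sgnℝ i x) → Apart x
  pos-sgn⇒apart i {x} (ε , 0<ε , p) = ε , 0<ε , mapE (λ n ε<sx →
    subst (ε ℚ.<_) (∣sgnℚ∣ i (seq x n)) (ℚ.<-≤-trans (subst (ε ℚ.<_) (seq-sgn i x n) ε<sx)
      (p≤∣p∣ (sgnℚ i (seq x n))))) p

  pos-sgn⇒# : ∀ i {x} → Pos (sgnℝ i x) → x # 0ℝ
  pos-sgn⇒# zero    {x} px = inj₂ (pos⇒< {0ℝ} {x} (pos-resp-≃ {x} {x -ᴿ 0ℝ}
    (≗⇒≃ x (x -ᴿ 0ℝ) (λ n → ≡.sym (ℚ.+-identityʳ (seq x n)))) px))
  pos-sgn⇒# (suc i) {x} px with pos-sgn⇒# i { -ᴿ x} px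
  ... | inj₁ -x<0 = inj₂ (pos⇒< {0ℝ} {x} (pos-resp-≃ {0ℝ -ᴿ (-ᴿ x)} {x -ᴿ 0ℝ}
    (≗⇒≃ (0ℝ -ᴿ (-ᴿ x)) (x -ᴿ 0ℝ) (λ n → solve 1 (λ x → con 0ℚ :- (:- x) := x :- con 0ℚ) ≡.refl (seq x n)))
    (<⇒pos { -ᴿ x} {0ℝ} -x<0)))
  ... | inj₂ 0<-x = inj₁ (pos⇒< {x} {0ℝ} (pos-resp-≃ {(-ᴿ x) -ᴿ 0ℝ} {0ℝ -ᴿ x}
    (≗⇒≃ ((-ᴿ x) -ᴿ 0ℝ) (0ℝ -ᴿ x) (λ n → solve 1 (λ x → (:- x) :- con 0ℚ := con 0ℚ :- x) ≡.refl (seq x n)))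
    (<⇒pos {0ℝ} { -ᴿ x} 0<-x)))

  -- The derivative of a product of linear factors at its roots

  Decreasing : ∀ {m} → (Fin m → ℝ) → Set
  Decreasing α = ∀ i j → i Fin.< j → α j < α i

  ∏-pos : ∀ m α x → (∀ i → Pos (x -ᴿ α i)) → Pos (Polyℝ.∏ m α x)
  ∏-pos zero    α x pos = pos-1
  ∏-pos (suc m) α x pos = pos-* {x -ᴿ α zero} {Polyℝ.∏ m (α ∘ suc) x} (pos zero) (∏-pos m (α ∘ suc) x (pos ∘ suc))

  ∏-root : ∀ m α i → Polyℝ.∏ m α (α i) ≃ 0ℝ
  ∏-root (suc m) α zero    = Re.trans {(α zero -ᴿ α zero) *ᴿ p} {0ℝ *ᴿ p} {0ℝ}
    (Re.*-congʳ {p} {α zero -ᴿ α zero} {0ℝ} (Re.-‿inverseʳ (α zero))) (Re.zeroˡ p)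
    where p = Polyℝ.∏ m (α ∘ suc) (α zero)
  ∏-root (suc m) α (suc i) = Re.trans {d *ᴿ p} {d *ᴿ 0ℝ} {0ℝ}
    (Re.*-congˡ {d} {p} {0ℝ} (∏-root m (α ∘ suc) i)) (Re.zeroʳ d)
    where
    p = Polyℝ.∏ m (α ∘ suc) (α (suc i))
    d = α (suc i) -ᴿ α zero

  -- At a root only the product of the differences to the other roots survives, and in a decreasing
  -- family exactly `toℕ i` of them are negative. In the induction the factor belonging to `α zero`
  -- accounts for one change of sign.
  ∏′-sign : ∀ m α → Decreasing α → ∀ i → Pos (sgnℝ (toℕ i) (Polyℝ.∏′ m α (α i)))
  ∏′-sign (suc m) α dec zero    = pos-resp-≃ {p} {p +ᴿ (α zero -ᴿ α zero) *ᴿ p′}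
    (Re.sym {p +ᴿ (α zero -ᴿ α zero) *ᴿ p′} {p}
      (Re.trans {p +ᴿ (α zero -ᴿ α zero) *ᴿ p′} {p +ᴿ 0ℝ} {p}
        (Re.+-congˡ {p} {(α zero -ᴿ α zero) *ᴿ p′} {0ℝ}
          (Re.trans {(α zero -ᴿ α zero) *ᴿ p′} {0ℝ *ᴿ p′} {0ℝ}
            (Re.*-congʳ {p′} {α zero -ᴿ α zero} {0ℝ} (Re.-‿inverseʳ (α zero))) (Re.zeroˡ p′)))
        (Re.+-identityʳ p)))
    (∏-pos m (α ∘ suc) (α zero) (λ i → <⇒pos {α (suc i)} {α zero} (dec zero (suc i) (s≤s z≤n))))
    where
    p  = Polyℝ.∏ m (α ∘ suc) (α zero)
    p′ = Polyℝ.∏′ m (α ∘ suc) (α zero)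
  ∏′-sign (suc m) α dec (suc i) = pos-resp-≃ {sgnℝ (toℕ i) ((α zero -ᴿ α (suc i)) *ᴿ p′)} {sgnℝ (suc (toℕ i)) (p +ᴿ d *ᴿ p′)}
    (sgnℝ-≃ (toℕ i) {(α zero -ᴿ α (suc i)) *ᴿ p′} { -ᴿ (p +ᴿ d *ᴿ p′)}
      (Re.trans {(α zero -ᴿ α (suc i)) *ᴿ p′} { -ᴿ (0ℝ +ᴿ d *ᴿ p′)} { -ᴿ (p +ᴿ d *ᴿ p′)}
        (≗⇒≃ ((α zero -ᴿ α (suc i)) *ᴿ p′) (-ᴿ (0ℝ +ᴿ d *ᴿ p′))
          (λ n → solve 3 (λ a b p → (a :- b) :* p := :- (con 0ℚ :+ (b :- a) :* p)) ≡.refl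
                   (seq (α zero) n) (seq (α (suc i)) n) (seq p′ n)))
        (neg-≃ {0ℝ +ᴿ d *ᴿ p′} {p +ᴿ d *ᴿ p′}
          (Re.+-congʳ {d *ᴿ p′} {0ℝ} {p} (Re.sym {p} {0ℝ} (∏-root m (α ∘ suc) i))))))
    (pos-sgn-* (toℕ i) {α zero -ᴿ α (suc i)} {p′} (<⇒pos {α (suc i)} {α zero} (dec zero (suc i) (s≤s z≤n)))
      (∏′-sign m (α ∘ suc) (λ i j i<j → dec (suc i) (suc j) (s≤s i<j)) i))
    where
    d  = α (suc i) -ᴿ α zero
    p  = Polyℝ.∏ m (α ∘ suc) (α (suc i))
    p′ = Polyℝ.∏′ m (α ∘ suc) (α (suc i))

  -- The Archimedean property and bisection

  open Polyℚ using (ι)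

  toℚᵘ-ι : ∀ k → ℚ.toℚᵘ (ι k) ℚᵘ.≃ ℚᵘ.mkℚᵘ (ℤ.+ k) 0
  toℚᵘ-ι zero    = ℚᵘ.≃-refl
  toℚᵘ-ι (suc k) = ℚᵘ.≃-trans (ℚ.toℚᵘ-homo-+ 1ℚ (ι k))
    (ℚᵘ.≃-trans (ℚᵘ.+-congʳ (ℚ.toℚᵘ 1ℚ) (toℚᵘ-ι k))
      (ℚᵘ.*≡* (cong (ℤ._* (ℤ.+ 1)) (cong (λ z → (ℤ.+ 1) ℤ.+ z) (ℤ.*-identityʳ (ℤ.+ k))))))

  -- Since the denominator is at least one, a fraction lies below one plus the absolute value of its
  -- numerator.
  <ι : ∀ q → q ℚ.< ι (suc ℤ.∣ ℚ.↥ q ∣)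
  <ι q@(mkℚ n d _) = ℚ.toℚᵘ-cancel-<
    (ℚᵘ.<-respʳ-≃ (ℚᵘ.≃-sym (toℚᵘ-ι (suc ℤ.∣ n ∣))) (ℚᵘ.*<* (below n)))
    where
    below : ∀ n → n ℤ.* ℤ.+ 1 ℤ.< ℤ.+ suc ℤ.∣ n ∣ ℤ.* ℤ.+ suc d
    below (ℤ.+ k)      = subst₂ ℤ._<_ (≡.sym (ℤ.*-identityʳ (ℤ.+ k))) (ℤ.pos-* (suc k) (suc d))
      (ℤ.+<+ (ℕ.m≤m*n (suc k) (suc d)))
    below ℤ.-[1+ k ]   = subst₂ ℤ._<_ (≡.sym (ℤ.*-identityʳ ℤ.-[1+ k ])) (ℤ.pos-* (suc (suc k)) (suc d)) ℤ.-<+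

  ι-mono : ∀ {k l} → k ℕ.≤ l → ι k ℚ.≤ ι l
  ι-mono {l = l} z≤n = 0≤ι l
  ι-mono (s≤s k≤l)   = ℚ.+-monoʳ-≤ 1ℚ (ι-mono k≤l)

  archimedean : ∀ q → Eventually (λ k → q ℚ.< ι k)
  archimedean q = suc ℤ.∣ ℚ.↥ q ∣ , λ k le → ℚ.<-≤-trans (<ι q) (ι-mono le)

  ½^ : ℕ → ℚ
  ½^ zero    = 1ℚ
  ½^ (suc n) = ½^ n ℚ.* ½

  0<½^ : ∀ n → 0ℚ ℚ.< ½^ n
  0<½^ zero    = ℚ.positive⁻¹ 1ℚ
  0<½^ (suc n) = *-pos (0<½^ n) (ℚ.positive⁻¹ ½)

  *½-mono : ∀ {p q} → p ℚ.≤ q → p ℚ.* ½ ℚ.≤ q ℚ.* ½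
  *½-mono = ℚ.*-monoʳ-≤-nonNeg ½

  ½^≤1 : ∀ n → ½^ n ℚ.≤ 1ℚ
  ½^≤1 zero    = ℚ.≤-refl
  ½^≤1 (suc n) = ℚ.≤-trans (*½-mono (½^≤1 n)) (ℚ.<⇒≤ (subst (ℚ._< 1ℚ) (≡.sym (ℚ.*-identityˡ ½)) ½<1))

  -- This is `n ≤ 2^n`; with the Archimedean property it makes the interval widths tend to zero.
  ι*½^≤1 : ∀ n → ι n ℚ.* ½^ n ℚ.≤ 1ℚ
  ι*½^≤1 zero    = subst (ℚ._≤ 1ℚ) (≡.sym (ℚ.*-zeroˡ 1ℚ)) (ℚ.nonNegative⁻¹ 1ℚ)
  ι*½^≤1 (suc n) = begin
    (1ℚ ℚ.+ ι n) ℚ.* (½^ n ℚ.* ½)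
      ≡⟨ solve 3 (λ k p h → (con 1ℚ :+ k) :* (p :* h) := p :* h :+ (k :* p) :* h) ≡.refl (ι n) (½^ n) ½ ⟩
    ½^ n ℚ.* ½ ℚ.+ (ι n ℚ.* ½^ n) ℚ.* ½
      ≤⟨ ℚ.+-mono-≤ (*½-mono (½^≤1 n)) (*½-mono (ι*½^≤1 n)) ⟩
    1ℚ ℚ.* ½ ℚ.+ 1ℚ ℚ.* ½
      ≡⟨ half+half 1ℚ ⟩
    1ℚ ∎
    where open ℚ.≤-Reasoning

  *½^-small : ∀ {w} → 0ℚ ℚ.≤ w → ∀ {ε} → 0ℚ ℚ.< ε → Eventually (λ n → w ℚ.* ½^ n ℚ.< ε)
  *½^-small {w} 0≤w {ε} 0<ε =
    -- Here `r` is `(w + 1) / ε`; the added one keeps the numerator positive for an interval of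
    -- width zero.
    let r , _ , e = quotient 0<w+1 0<ε
    in mapE (λ n r<n → small n r e r<n) (archimedean r)
    where
    open ℚ.≤-Reasoning
    w<w+1 : w ℚ.< w ℚ.+ 1ℚ
    w<w+1 = subst (ℚ._< w ℚ.+ 1ℚ) (ℚ.+-identityʳ w) (ℚ.+-monoʳ-< w (ℚ.positive⁻¹ 1ℚ))
    0<w+1 : 0ℚ ℚ.< w ℚ.+ 1ℚ
    0<w+1 = ℚ.≤-<-trans 0≤w w<w+1
    small : ∀ n r → ε ℚ.* r ≡ w ℚ.+ 1ℚ → r ℚ.< ι n → w ℚ.* ½^ n ℚ.< ε
    small n r e r<n = begin-strict
      w ℚ.* ½^ n
        <⟨ ℚ.*-monoˡ-<-pos (½^ n) {{positive (0<½^ n)}} w<w+1 ⟩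
      (w ℚ.+ 1ℚ) ℚ.* ½^ n
        ≡⟨ cong (ℚ._* ½^ n) e ⟨
      (ε ℚ.* r) ℚ.* ½^ n
        <⟨ ℚ.*-monoˡ-<-pos (½^ n) {{positive (0<½^ n)}} (ℚ.*-monoʳ-<-pos ε {{positive 0<ε}} r<n) ⟩
      (ε ℚ.* ι n) ℚ.* ½^ n
        ≡⟨ ℚ.*-assoc ε (ι n) (½^ n) ⟩
      ε ℚ.* (ι n ℚ.* ½^ n)
        ≤⟨ ℚ.*-monoˡ-≤-nonNeg ε {{nonNegative (ℚ.<⇒≤ 0<ε)}} (ι*½^≤1 n) ⟩
      ε ℚ.* 1ℚ
        ≡⟨ ℚ.*-identityʳ ε ⟩
      ε ∎

  module Bisection (f : ℚ → ℚ) where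

    -- The values of `f` are rational, so its sign at a midpoint is decidable. With weak
    -- inequalities a midpoint where `f` vanishes can serve as an end.
    record Interval : Set where
      constructor interval
      field
        lo hi : ℚ
        lo≤hi : lo ℚ.≤ hi
        f-lo  : f lo ℚ.≤ 0ℚ
        f-hi  : 0ℚ ℚ.≤ f hi

    open Interval

    width : Interval → ℚ
    width s = hi s ℚ.- lo s

    middle : Interval → ℚ
    middle s = (lo s ℚ.+ hi s) ℚ.* ½

    private
      0≤½width : ∀ s → 0ℚ ℚ.≤ width s ℚ.* ½
      0≤½width s = subst (ℚ._≤ width s ℚ.* ½) (ℚ.*-zeroˡ ½) (*½-mono (p≤q⇒0≤q-p (lo≤hi s)))

      middle-lo : ∀ s → middle s ℚ.- lo s ≡ width s ℚ.* ½
      middle-lo s = begin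
        middle s ℚ.- lo s
          ≡⟨ cong (λ z → middle s ℚ.- z) (half+half (lo s)) ⟨
        middle s ℚ.- (lo s ℚ.* ½ ℚ.+ lo s ℚ.* ½)
          ≡⟨ solve 3 (λ a b h → (a :+ b) :* h :- (a :* h :+ a :* h) := (b :- a) :* h) ≡.refl (lo s) (hi s) ½ ⟩
        width s ℚ.* ½ ∎
        where open ≡.≡-Reasoning

      hi-middle : ∀ s → hi s ℚ.- middle s ≡ width s ℚ.* ½
      hi-middle s = begin
        hi s ℚ.- middle s
          ≡⟨ cong (ℚ._- middle s) (half+half (hi s)) ⟨
        (hi s ℚ.* ½ ℚ.+ hi s ℚ.* ½) ℚ.- middle s
          ≡⟨ solve 3 (λ a b h → (b :* h :+ b :* h) :- (a :+ b) :* h := (b :- a) :* h) ≡.refl (lo s) (hi s) ½ ⟩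
        width s ℚ.* ½ ∎
        where open ≡.≡-Reasoning

      lo≤middle : ∀ s → lo s ℚ.≤ middle s
      lo≤middle s = 0≤q-p⇒p≤q (subst (0ℚ ℚ.≤_) (≡.sym (middle-lo s)) (0≤½width s))

      middle≤hi : ∀ s → middle s ℚ.≤ hi s
      middle≤hi s = 0≤q-p⇒p≤q (subst (0ℚ ℚ.≤_) (≡.sym (hi-middle s)) (0≤½width s))

      Side : Interval → Set
      Side s = f (middle s) ℚ.≤ 0ℚ ⊎ 0ℚ ℚ.≤ f (middle s)

      side : ∀ s → Side s
      side s = ℚ.≤-total (f (middle s)) 0ℚ

      half : ∀ s → Side s → Interval
      half s (inj₁ ≤0) = interval (middle s) (hi s) (middle≤hi s) ≤0 (f-hi s)
      half s (inj₂ 0≤) = interval (lo s) (middle s) (lo≤middle s) (f-lo s) 0≤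

      half-lo : ∀ s c → lo s ℚ.≤ lo (half s c)
      half-lo s (inj₁ _) = lo≤middle s
      half-lo s (inj₂ _) = ℚ.≤-refl

      half-hi : ∀ s c → hi (half s c) ℚ.≤ hi s
      half-hi s (inj₁ _) = ℚ.≤-refl
      half-hi s (inj₂ _) = middle≤hi s

      half-width : ∀ s c → width (half s c) ≡ width s ℚ.* ½
      half-width s (inj₁ _) = hi-middle s
      half-width s (inj₂ _) = middle-lo s

    bisect : Interval → ℕ → Interval
    bisect s zero    = s
    bisect s (suc n) = half (bisect s n) (side (bisect s n))

    bisect-width : ∀ s n → width (bisect s n) ≡ width s ℚ.* ½^ n
    bisect-width s zero    = ≡.sym (ℚ.*-identityʳ (width s))
    bisect-width s (suc n) = ≡.trans (half-width (bisect s n) (side (bisect s n)))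
      (≡.trans (cong (ℚ._* ½) (bisect-width s n)) (ℚ.*-assoc (width s) (½^ n) ½))

    bisect-lo : ∀ s {m n} → m ℕ.≤′ n → lo (bisect s m) ℚ.≤ lo (bisect s n)
    bisect-lo s (ℕ.≤′-reflexive ≡.refl) = ℚ.≤-refl
    bisect-lo s (ℕ.≤′-step {n} m≤n)     = ℚ.≤-trans (bisect-lo s m≤n) (half-lo (bisect s n) (side (bisect s n)))

    bisect-hi : ∀ s {m n} → m ℕ.≤′ n → hi (bisect s n) ℚ.≤ hi (bisect s m)
    bisect-hi s (ℕ.≤′-reflexive ≡.refl) = ℚ.≤-refl
    bisect-hi s (ℕ.≤′-step {n} m≤n)     = ℚ.≤-trans (half-hi (bisect s n) (side (bisect s n))) (bisect-hi s m≤n)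

    width-small : ∀ s {ε} → 0ℚ ℚ.< ε → Eventually (λ n → width (bisect s n) ℚ.< ε)
    width-small s {ε} 0<ε = mapE (λ n → subst (ℚ._< ε) (≡.sym (bisect-width s n)))
      (*½^-small (p≤q⇒0≤q-p (lo≤hi s)) 0<ε)

    private
      ∣p-q∣≤width : ∀ {l h p q} → l ℚ.≤ p → p ℚ.≤ h → l ℚ.≤ q → q ℚ.≤ h → ℚ.∣ p ℚ.- q ∣ ℚ.≤ h ℚ.- l
      ∣p-q∣≤width {p = p} {q} l≤p p≤h l≤q q≤h with ℚ.∣p∣≡p∨∣p∣≡-p (p ℚ.- q)
      ... | inj₁ eq = subst (ℚ._≤ _) (≡.sym eq) (ℚ.+-mono-≤ p≤h (ℚ.neg-antimono-≤ l≤q))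
      ... | inj₂ eq = subst (ℚ._≤ _) (≡.sym (≡.trans eq (solve 2 (λ p q → :- (p :- q) := q :- p) ≡.refl p q)))
                        (ℚ.+-mono-≤ q≤h (ℚ.neg-antimono-≤ l≤p))

      cauchy-inside : ∀ s (x : ℕ → ℚ) →
        (∀ n → lo (bisect s n) ℚ.≤ x n) → (∀ n → x n ℚ.≤ hi (bisect s n)) → IsCauchy x
      cauchy-inside s x lo≤x x≤hi ε 0<ε =
        let N , small = width-small s 0<ε
        in N , λ m n N≤m N≤n → ℚ.≤-<-trans
             (∣p-q∣≤width (ℚ.≤-trans (bisect-lo s (ℕ.≤⇒≤′ N≤m)) (lo≤x m)) (ℚ.≤-trans (x≤hi m) (bisect-hi s (ℕ.≤⇒≤′ N≤m)))
                          (ℚ.≤-trans (bisect-lo s (ℕ.≤⇒≤′ N≤n)) (lo≤x n)) (ℚ.≤-trans (x≤hi n) (bisect-hi s (ℕ.≤⇒≤′ N≤n))))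
             (small N ℕ.≤-refl)

    -- Both sequences describe the same real, but `f` is nonpositive along the one and nonnegative
    -- along the other. Comparing the two shows that the limit is a root.
    lower upper : Interval → ℝ
    lower s = mkℝ (λ n → lo (bisect s n)) (cauchy-inside s _ (λ _ → ℚ.≤-refl) (λ n → lo≤hi (bisect s n)))
    upper s = mkℝ (λ n → hi (bisect s n)) (cauchy-inside s _ (λ n → lo≤hi (bisect s n)) (λ _ → ℚ.≤-refl))

    lower≃upper : ∀ s → lower s ≃ upper s
    lower≃upper s ε 0<ε = mapE (λ n small → ℚ.≤-<-trans
      (∣p-q∣≤width ℚ.≤-refl (lo≤hi (bisect s n)) (lo≤hi (bisect s n)) ℚ.≤-refl) small) (width-small s 0<ε)

  -- Real roots between sign changes of a polynomial

  pos-constant : ∀ {x p} → 0ℚ ℚ.< p → (∀ n → p ≡ seq x n) → Pos x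
  pos-constant {x} {p} 0<p x≗p = p ℚ.* ½ , half-pos 0<p , always λ n → subst (p ℚ.* ½ ℚ.<_) (x≗p n)
    (subst₂ ℚ._<_ (ℚ.+-identityʳ (p ℚ.* ½)) (half+half p) (ℚ.+-monoʳ-< (p ℚ.* ½) (half-pos 0<p)))

  evℝ : ℕ → (ℕ → ℕ) → ℝ → ℝ
  evℝ m b = Polyℝ.ev m (Polyℝ.ι ∘ b)

  evℚ : ℕ → (ℕ → ℕ) → ℚ → ℚ
  evℚ m b = Polyℚ.ev m (ι ∘ b)

  evℝ-cong : ∀ m b {x y} → x ≃ y → evℝ m b x ≃ evℝ m b y
  evℝ-cong m b {x} {y} = Polyℝ.ev-cong m {Polyℝ.ι ∘ b} {Polyℝ.ι ∘ b} {x} {y} (λ k → Re.refl {Polyℝ.ι (b k)})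

  apart-neg : ∀ {x} → Apart x → Apart (-ᴿ x)
  apart-neg {x} (ε , 0<ε , p) = ε , 0<ε , mapE (λ n → subst (ε ℚ.<_) (≡.sym (ℚ.∣-p∣≡∣p∣ (seq x n)))) p

  -- p(α) − p(q) is divisible by α − q.
  root-apart : ∀ m b α q → evℝ (suc m) b α ≃ 0ℝ → Apart (evℝ (suc m) b q) → Apart (α -ᴿ q)
  root-apart m b α q root apart = apart-factor {α -ᴿ q} {h}
    (apart-resp-≃ { -ᴿ evℝ (suc m) b q} {(α -ᴿ q) *ᴿ h}
      (Re.sym {(α -ᴿ q) *ᴿ h} { -ᴿ evℝ (suc m) b q}
        (Algebra.Properties.Group.inverseʳ-unique Re.+-group (evℝ (suc m) b q) ((α -ᴿ q) *ᴿ h)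
          (Re.trans {evℝ (suc m) b q +ᴿ (α -ᴿ q) *ᴿ h} {evℝ (suc m) b α} {0ℝ}
            (Re.sym {evℝ (suc m) b α} {evℝ (suc m) b q +ᴿ (α -ᴿ q) *ᴿ h}
              (Polyℝ.ev-horner m (Polyℝ.ι ∘ b) q α)) root)))
      (apart-neg {evℝ (suc m) b q} apart))
    where
    h : ℝ
    h = Polyℝ.ev m (Polyℝ.horner m (Polyℝ.ι ∘ b) q) α

  sign⇒apart : ∀ i m b q → 0ℚ ℚ.< sgnℚ i (evℚ m b q) → Apart (evℝ m b (fromℚ q))
  sign⇒apart i m b q 0<s = pos-sgn⇒apart i {evℝ m b (fromℚ q)}
    (pos-constant {sgnℝ i (evℝ m b (fromℚ q))} 0<s
      (λ n → ≡.sym (≡.trans (seq-sgn i (evℝ m b (fromℚ q)) n) (cong (sgnℚ i) (seq-ev m b (fromℚ q) n)))))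

  -- The values along `lower` and `upper` have opposite weak signs and approach each other, as the
  -- two reals are equal; hence each is bounded by their difference and tends to zero. At the given
  -- ends the polynomial is apart from zero, so by `root-apart` the root is strictly inside.
  root-between : ∀ i m b lo hi → lo ℚ.≤ hi →
    0ℚ ℚ.< sgnℚ (suc i) (evℚ (suc m) b lo) → 0ℚ ℚ.< sgnℚ i (evℚ (suc m) b hi) →
    ∃ λ α → fromℚ lo < α × α < fromℚ hi × evℝ (suc m) b α ≃ 0ℝ
  root-between i m b lo hi lo≤hi sign-lo sign-hi = α , lo<α , α<hi , root
    where
    f : ℚ → ℚ
    f = sgnℚ i ∘ evℚ (suc m) b
    open Bisection f
    s : Interval
    s = interval lo hi lo≤hi
      (ℚ.<⇒≤ (subst (ℚ._< 0ℚ) (≡.trans (cong ℚ.-_ (sgnℚ-neg i (evℚ (suc m) b lo)))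
                (solve 1 (λ x → :- (:- x) := x) ≡.refl (f lo))) (ℚ.neg-antimono-< sign-lo)))
      (ℚ.<⇒≤ sign-hi)
    α : ℝ
    α = lower s
    small : ∀ {ε} n → ℚ.∣ seq (evℝ (suc m) b α) n ℚ.- seq (evℝ (suc m) b (upper s)) n ∣ ℚ.< ε →
            ℚ.∣ seq (evℝ (suc m) b α) n ℚ.- 0ℚ ∣ ℚ.< ε
    small {ε} n = helper (seq (evℝ (suc m) b α) n) (seq (evℝ (suc m) b (upper s)) n)
      (subst (λ z → sgnℚ i z ℚ.≤ 0ℚ) (≡.sym (seq-ev (suc m) b α n)) (Interval.f-lo (bisect s n)))
      (subst (λ z → 0ℚ ℚ.≤ sgnℚ i z) (≡.sym (seq-ev (suc m) b (upper s) n)) (Interval.f-hi (bisect s n)))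
      where
      open ℚ.≤-Reasoning
      helper : ∀ u v → sgnℚ i u ℚ.≤ 0ℚ → 0ℚ ℚ.≤ sgnℚ i v → ℚ.∣ u ℚ.- v ∣ ℚ.< ε → ℚ.∣ u ℚ.- 0ℚ ∣ ℚ.< ε
      helper u v u≤0 0≤v u-v = begin-strict
        ℚ.∣ u ℚ.- 0ℚ ∣
          ≡⟨ cong ℚ.∣_∣ (ℚ.+-identityʳ u) ⟩
        ℚ.∣ u ∣
          ≡⟨ ≡.trans (≡.sym (∣sgnℚ∣ i u)) (≡.sym (ℚ.∣-p∣≡∣p∣ (sgnℚ i u))) ⟩
        ℚ.∣ ℚ.- sgnℚ i u ∣
          ≡⟨ ℚ.0≤p⇒∣p∣≡p (ℚ.neg-antimono-≤ u≤0) ⟩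
        ℚ.- sgnℚ i u
          ≡⟨ ℚ.+-identityˡ (ℚ.- sgnℚ i u) ⟨
        0ℚ ℚ.+ ℚ.- sgnℚ i u
          ≤⟨ ℚ.+-monoˡ-≤ (ℚ.- sgnℚ i u) 0≤v ⟩
        sgnℚ i v ℚ.+ ℚ.- sgnℚ i u
          ≡⟨ ≡.trans (cong (sgnℚ i v ℚ.+_) (≡.sym (sgnℚ-neg i u))) (≡.sym (sgnℚ-+ i v (ℚ.- u))) ⟩
        sgnℚ i (v ℚ.- u)
          ≤⟨ p≤∣p∣ (sgnℚ i (v ℚ.- u)) ⟩
        ℚ.∣ sgnℚ i (v ℚ.- u) ∣
          ≡⟨ ≡.trans (∣sgnℚ∣ i (v ℚ.- u)) (∣p-q∣≡∣q-p∣ v u) ⟩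
        ℚ.∣ u ℚ.- v ∣
          <⟨ u-v ⟩
        ε ∎
    root : evℝ (suc m) b α ≃ 0ℝ
    root ε 0<ε = mapE small (evℝ-cong (suc m) b {α} {upper s} (lower≃upper s) ε 0<ε)
    lo<α : fromℚ lo < α
    lo<α = pos⇒< {fromℚ lo} {α} (apart-≥0 {α -ᴿ fromℚ lo}
      (root-apart m b α (fromℚ lo) root (sign⇒apart (suc i) (suc m) b lo sign-lo))
      (λ n → p≤q⇒0≤q-p (bisect-lo s {0} {n} (ℕ.≤⇒≤′ z≤n))))
    α<hi : α < fromℚ hi
    α<hi = pos⇒< {α} {fromℚ hi} (pos-resp-≃ { -ᴿ (α -ᴿ fromℚ hi)} {fromℚ hi -ᴿ α}
      (≗⇒≃ (-ᴿ (α -ᴿ fromℚ hi)) (fromℚ hi -ᴿ α)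
        (λ n → solve 2 (λ a h → :- (a :- h) := h :- a) ≡.refl (seq α n) hi))
      (apart-≤0 {α -ᴿ fromℚ hi} (root-apart m b α (fromℚ hi) root (sign⇒apart i (suc m) b hi sign-hi))
        (λ n → subst (seq α n ℚ.- hi ℚ.≤_) (ℚ.+-inverseʳ hi)
          (ℚ.+-monoˡ-≤ (ℚ.- hi) (ℚ.≤-trans (Interval.lo≤hi (bisect s n)) (bisect-hi s {0} {n} (ℕ.≤⇒≤′ z≤n)))))))

  -a≤sgn : ∀ m {a} → 0ℚ ℚ.≤ a → ℚ.- a ℚ.≤ sgnℚ m a
  -a≤sgn m {a} 0≤a = begin
    ℚ.- a                     ≡⟨ cong ℚ.-_ (≡.trans (∣sgnℚ∣ m a) (ℚ.0≤p⇒∣p∣≡p 0≤a)) ⟨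
    ℚ.- ℚ.∣ sgnℚ m a ∣        ≤⟨ ℚ.neg-antimono-≤ (-p≤∣p∣ (sgnℚ m a)) ⟩
    ℚ.- (ℚ.- sgnℚ m a)        ≡⟨ solve 1 (λ x → :- (:- x) := x) ≡.refl (sgnℚ m a) ⟩
    sgnℚ m a                  ∎
    where open ℚ.≤-Reasoning

  -- In Horner form the value at `−K` is `a − K p`, and `K ≥ a + 1` lets the second term win once
  -- `p` has absolute value at least one. The bound `1ℚ`, stronger than positivity, is what carries
  -- the induction.
  sign-at-−∞ : ∀ m b → 1 ℕ.≤ b m → Eventually (λ K → 1ℚ ℚ.≤ sgnℚ m (evℚ m b (ℚ.- ι K)))
  sign-at-−∞ zero    b 1≤b = always λ K → 1≤ι 1≤b
  sign-at-−∞ (suc m) b 1≤b =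
    mapE (λ K (ih , large) → step (ι K) (evℚ m (b ∘ suc) (ℚ.- ι K)) (0≤ι K) ih (ℚ.<⇒≤ large))
         (sign-at-−∞ m (b ∘ suc) 1≤b & archimedean (a ℚ.+ 1ℚ))
    where
    open ℚ.≤-Reasoning
    a : ℚ
    a = ι (b 0)
    step : ∀ K p → 0ℚ ℚ.≤ K → 1ℚ ℚ.≤ sgnℚ m p → a ℚ.+ 1ℚ ℚ.≤ K →
           1ℚ ℚ.≤ sgnℚ m (ℚ.- (a ℚ.+ (ℚ.- K) ℚ.* p))
    step K p 0≤K 1≤p a+1≤K = begin
      1ℚ
        ≡⟨ solve 1 (λ a → con 1ℚ := (:- a) :+ (a :+ con 1ℚ)) ≡.refl a ⟩
      ℚ.- a ℚ.+ (a ℚ.+ 1ℚ)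
        ≤⟨ ℚ.+-monoʳ-≤ (ℚ.- a) a+1≤K ⟩
      ℚ.- a ℚ.+ K
        ≡⟨ cong (ℚ.- a ℚ.+_) (ℚ.*-identityʳ K) ⟨
      ℚ.- a ℚ.+ K ℚ.* 1ℚ
        ≤⟨ ℚ.+-mono-≤ (-a≤sgn (suc m) (0≤ι (b 0))) (ℚ.*-monoˡ-≤-nonNeg K {{nonNegative 0≤K}} 1≤p) ⟩
      sgnℚ m (ℚ.- a) ℚ.+ K ℚ.* sgnℚ m p
        ≡⟨ cong (sgnℚ m (ℚ.- a) ℚ.+_) (sgnℚ-* m K p) ⟨
      sgnℚ m (ℚ.- a) ℚ.+ sgnℚ m (K ℚ.* p)
        ≡⟨ sgnℚ-+ m (ℚ.- a) (K ℚ.* p) ⟨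
      sgnℚ m (ℚ.- a ℚ.+ K ℚ.* p)
        ≡⟨ cong (sgnℚ m) (solve 3 (λ a K p → (:- a) :+ K :* p := :- (a :+ (:- K) :* p)) ≡.refl a K p) ⟩
      sgnℚ m (ℚ.- (a ℚ.+ (ℚ.- K) ℚ.* p)) ∎

  -- Sign brackets and the induction step from row to row

  snoc : ∀ {m} {A : Set} → (Fin m → A) → A → Fin (suc m) → A
  snoc {zero}  f x _       = x
  snoc {suc m} f x zero    = f zero
  snoc {suc m} f x (suc i) = snoc (f ∘ suc) x i

  snoc-elim : ∀ {m} {A : Set} (P : ℕ → A → Set) {f : Fin m → A} {x} →
              (∀ i → P (toℕ i) (f i)) → P m x → ∀ i → P (toℕ i) (snoc f x i)
  snoc-elim {zero}  P pf px zero    = px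
  snoc-elim {suc m} P pf px zero    = pf zero
  snoc-elim {suc m} P pf px (suc i) = snoc-elim (P ∘ suc) (pf ∘ suc) px i

  Decreasingℚ : ∀ {m} → (Fin m → ℚ) → Set
  Decreasingℚ q = ∀ i j → i Fin.< j → q j ℚ.< q i

  snoc-decreasing : ∀ {m} {f : Fin m → ℚ} {x} → Decreasingℚ f → (∀ i → x ℚ.< f i) → Decreasingℚ (snoc f x)
  snoc-decreasing {zero}  dec x<f zero    zero    ()
  snoc-decreasing {suc m} dec x<f zero    (suc j) _ =
    snoc-elim (λ _ y → y ℚ.< _) (λ i → dec zero (suc i) (s≤s z≤n)) (x<f zero) j
  snoc-decreasing {suc m} dec x<f (suc i) (suc j) (s≤s i<j) =
    snoc-decreasing (λ i j i<j → dec (suc i) (suc j) (s≤s i<j)) (x<f ∘ suc) i j i<j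

  -- Between consecutive points the polynomial changes sign. The points are rational, so that
  -- bisection can start from them, and the largest is zero, which forces the enclosed roots to be
  -- negative.
  record Brackets (m : ℕ) (b : ℕ → ℕ) : Set where
    field
      point      : Fin (suc m) → ℚ
      decreasing : Decreasingℚ point
      start      : point zero ≡ 0ℚ
      sign       : ∀ i → 0ℚ ℚ.< sgnℚ (toℕ i) (evℚ m b (point i))

  record Roots (m : ℕ) (b : ℕ → ℕ) : Set where
    field
      α          : Fin m → ℝ
      decreasing : Decreasing α
      negative   : ∀ i → α i < 0ℝ
      root       : ∀ i → evℝ m b (α i) ≃ 0ℝ

  brackets⇒roots : ∀ m b → Brackets m b → Roots m b
  brackets⇒roots zero    b bs = record
    { α = λ () ; decreasing = λ () ; negative = λ () ; root = λ () }
  brackets⇒roots (suc m) b bs = record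
    { α          = λ i → proj₁ (between i)
    -- Neighbouring intervals may share an end; since each root lies strictly inside its interval,
    -- that rational point still separates them.
    ; decreasing = λ i j i<j → <-transᴿ {proj₁ (between j)} {fromℚ (point (suc i))} {proj₁ (between i)}
        (<-≤-transᴿ {proj₁ (between j)} {fromℚ (point (inject₁ j))} {fromℚ (point (suc i))}
          (proj₁ (proj₂ (proj₂ (between j))))
          (λ _ → antitone (suc i) (inject₁ j) (subst (suc (toℕ i) ℕ.≤_) (≡.sym (Fin.toℕ-inject₁ j)) i<j)))
        (proj₁ (proj₂ (between i)))
    ; negative   = λ i → <-≤-transᴿ {proj₁ (between i)} {fromℚ (point (inject₁ i))} {0ℝ}
        (proj₁ (proj₂ (proj₂ (between i))))
        (λ _ → subst (point (inject₁ i) ℚ.≤_) start (antitone zero (inject₁ i) z≤n))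
    ; root       = λ i → proj₂ (proj₂ (proj₂ (between i)))
    }
    where
    open Brackets bs
    antitone : ∀ i j → toℕ i ℕ.≤ toℕ j → point j ℚ.≤ point i
    antitone i j i≤j with ℕ.m≤n⇒m<n∨m≡n i≤j
    ... | inj₁ i<j = ℚ.<⇒≤ (decreasing i j i<j)
    ... | inj₂ i≡j = ℚ.≤-reflexive (cong point (≡.sym (Fin.toℕ-injective i≡j)))
    between : ∀ i → ∃ λ x → fromℚ (point (suc i)) < x × x < fromℚ (point (inject₁ i)) × evℝ (suc m) b x ≃ 0ℝ
    between i = root-between (toℕ i) m b (point (suc i)) (point (inject₁ i))
      (antitone (inject₁ i) (suc i) (subst (ℕ._≤ suc (toℕ i)) (≡.sym (Fin.toℕ-inject₁ i)) (ℕ.n≤1+n (toℕ i))))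
      (sign (suc i))
      (subst (λ k → 0ℚ ℚ.< sgnℚ k (evℚ (suc m) b (point (inject₁ i)))) (Fin.toℕ-inject₁ i) (sign (inject₁ i)))

  decreasing⇒apart : ∀ {m} {α : Fin m → ℝ} → Decreasing α → ∀ i j → i Fin.< j → Apart (α j -ᴿ α i)
  decreasing⇒apart {α = α} dec i j i<j = neg⇒apart {α j -ᴿ α i}
    (pos-resp-≃ {α i -ᴿ α j} { -ᴿ (α j -ᴿ α i)}
      (≗⇒≃ (α i -ᴿ α j) (-ᴿ (α j -ᴿ α i))
        (λ n → solve 2 (λ a b → a :- b := :- (b :- a)) ≡.refl (seq (α i) n) (seq (α j) n)))
      (<⇒pos {α j} {α i} (dec i j i<j)))

  decreasing⇒cancellable : ∀ {m} {α : Fin m → ℝ} → Decreasing α →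
                           ∀ i j → i Fin.< j → Polyℝ.Cancellable (α j -ᴿ α i)
  decreasing⇒cancellable {α = α} dec i j i<j =
    apart-cancel {α j -ᴿ α i} (decreasing⇒apart {α = α} dec i j i<j)

  module _ (m n : ℕ) (b b⁺ : ℕ → ℕ) (b⁺0 : b⁺ 0 ≡ b 0) (b-bound : b (suc m) ≡ 0)
           (rec : ∀ k → b⁺ (suc k) ℕ.+ k ℕ.* b k ≡ n ℕ.* b k ℕ.+ (2 ℕ.+ k) ℕ.* b (suc k))
           (1≤b : 1 ℕ.≤ b m) (1≤b⁺ : 1 ℕ.≤ b⁺ (suc m)) (roots : Roots m b) where

    private
      open Roots roots

      W : ℕ → ℝ
      W = Polyℝ.shift (Polyℝ.ι ∘ b)

      -- These are the roots of `W = t p`: the factor `t` adds the root zero, which comes first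
      -- because the others are negative.
      β : Fin (suc m) → ℝ
      β zero    = 0ℝ
      β (suc i) = α i

      β<1 : ∀ i → β i < 1ℝ
      β<1 zero    = pos⇒< {0ℝ} {1ℝ} (pos-constant {1ℝ -ᴿ 0ℝ} (ℚ.positive⁻¹ 1ℚ) (λ _ → ≡.refl))
      β<1 (suc i) = <-transᴿ {α i} {0ℝ} {1ℝ} (negative i) (β<1 zero)

      β-decreasing : Decreasing β
      β-decreasing zero    (suc j) _         = negative j
      β-decreasing (suc i) (suc j) (s≤s i<j) = decreasing i j i<j

      β-root : ∀ i → Polyℝ.ev (suc m) W (β i) ≃ 0ℝ
      β-root zero    = ≗⇒≃ (0ℝ +ᴿ 0ℝ *ᴿ evℝ m b 0ℝ) 0ℝ
        (λ k → solve 1 (λ p → con 0ℚ :+ con 0ℚ :* p := con 0ℚ) ≡.refl (seq (evℝ m b 0ℝ) k))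
      β-root (suc i) = Re.trans {0ℝ +ᴿ α i *ᴿ evℝ m b (α i)} {α i *ᴿ evℝ m b (α i)} {0ℝ}
        (Re.+-identityˡ (α i *ᴿ evℝ m b (α i)))
        (Re.trans {α i *ᴿ evℝ m b (α i)} {α i *ᴿ 0ℝ} {0ℝ}
          (Re.*-congˡ {α i} {evℝ m b (α i)} {0ℝ} (root i)) (Re.zeroʳ (α i)))

      value : ∀ i → evℝ (suc m) b⁺ (β i) ≃
                    ((1ℝ -ᴿ β i) *ᴿ (Polyℝ.ι (b m) *ᴿ Polyℝ.∏′ (suc m) β (β i)))
      value i = Re.trans {evℝ (suc m) b⁺ (β i)} {(1ℝ -ᴿ β i) *ᴿ W′} {(1ℝ -ᴿ β i) *ᴿ D}
        (Polyℝ.ev-recurrence m n b b⁺ b⁺0 b-bound rec (β i) (β-root i))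
        (Re.*-congˡ {1ℝ -ᴿ β i} {W′} {D}
          (proj₂ (Polyℝ.factorisation (suc m) W β (decreasing⇒cancellable {α = β} β-decreasing) β-root (β i))))
        where
        W′ D : ℝ
        W′ = Polyℝ.ev′ (suc m) W (β i)
        D = Polyℝ.ι (b m) *ᴿ Polyℝ.∏′ (suc m) β (β i)

      value-sign : ∀ i → Pos (sgnℝ (toℕ i) (evℝ (suc m) b⁺ (β i)))
      value-sign i = pos-resp-≃ {sgnℝ (toℕ i) ((1ℝ -ᴿ β i) *ᴿ D)} {sgnℝ (toℕ i) (evℝ (suc m) b⁺ (β i))}
        (sgnℝ-≃ (toℕ i) {(1ℝ -ᴿ β i) *ᴿ D} {evℝ (suc m) b⁺ (β i)}
          (Re.sym {evℝ (suc m) b⁺ (β i)} {(1ℝ -ᴿ β i) *ᴿ D} (value i)))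
        (pos-sgn-* (toℕ i) {1ℝ -ᴿ β i} {D} (<⇒pos {β i} {1ℝ} (β<1 i))
          (pos-sgn-* (toℕ i) {Polyℝ.ι (b m)} {Polyℝ.∏′ (suc m) β (β i)} (pos-ι 1≤b)
            (∏′-sign (suc m) β β-decreasing i)))
        where
        D : ℝ
        D = Polyℝ.ι (b m) *ᴿ Polyℝ.∏′ (suc m) β (β i)

      -- A late approximant of a positive real is positive, and by `seq-ev` an approximant of the
      -- value is the value at the approximant. So rational approximants can stand in for the `β i`
      -- as sample points.
      approximant-sign : Eventually (λ k → ∀ i → 0ℚ ℚ.< sgnℚ (toℕ i) (evℚ (suc m) b⁺ (seq (β i) k)))
      approximant-sign = Eventually-∀ λ i →
        let ε , 0<ε , p = value-sign i
        in mapE (λ k ε<s → ℚ.<-trans 0<ε (subst (ε ℚ.<_)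
             (≡.trans (seq-sgn (toℕ i) (evℝ (suc m) b⁺ (β i)) k) (cong (sgnℚ (toℕ i)) (seq-ev (suc m) b⁺ (β i) k)))
             ε<s)) p

      approximant-decreasing : Eventually (λ k → Decreasingℚ (λ i → seq (β i) k))
      approximant-decreasing = Eventually-∀ λ i → Eventually-∀ λ j → pair i j (i Fin.<? j)
        where
        pair : ∀ i j → Dec (i Fin.< j) → Eventually (λ k → i Fin.< j → seq (β j) k ℚ.< seq (β i) k)
        pair i j (yes i<j) = mapE (λ _ lt _ → lt) (<-eventually {β j} {β i} (β-decreasing i j i<j))
        pair i j (no i≮j)  = always (λ _ i<j → contradiction i<j i≮j)

      eventually-below : ∀ (q : Fin (suc m) → ℚ) → Eventually (λ K → ∀ i → ℚ.- ι K ℚ.< q i)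
      eventually-below q = Eventually-∀ λ i → mapE (λ K -q<K →
        subst (ℚ.- ι K ℚ.<_) (solve 1 (λ x → :- (:- x) := x) ≡.refl (q i)) (ℚ.neg-antimono-< -q<K))
        (archimedean (ℚ.- q i))

    roots⇒brackets : Brackets (suc m) b⁺
    roots⇒brackets = 
      -- A single index `N` serves for all signs and for the order of the approximants; only
      -- afterwards is `K` chosen, beyond all of them.
      let N , good = approximant-sign & approximant-decreasing
          signs , decs = good N ℕ.≤-refl
          K , far = eventually-below (λ i → seq (β i) N) & sign-at-−∞ (suc m) b⁺ 1≤b⁺
          below , last = far K ℕ.≤-refl
      in record
        { point      = snoc (λ i → seq (β i) N) (ℚ.- ι K)
        ; decreasing = snoc-decreasing decs below
        -- All approximants of `β zero` are `0ℚ`, so the first point is exactly zero.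
        ; start      = ≡.refl
        ; sign       = snoc-elim (λ k y → 0ℚ ℚ.< sgnℚ k (evℚ (suc m) b⁺ y)) signs
                         (ℚ.<-≤-trans (ℚ.positive⁻¹ 1ℚ) last)
        }

  -- Complex zeros

  module Co = CommutativeRing ℂ-commutativeRing
  module Polyℂ = Polynomials ℂ-commutativeRing

  -- (a² + b²) u and (a² + b²) v are combinations of the two parts of (a + i b)(u + i v).
  cancellable-ℂ : ∀ w → Apart (re w) → Polyℂ.Cancellable w
  cancellable-ℂ w apart z (re≃0 , im≃0) =
    apart-cancel {N} N-apart u (Re.trans {N *ᴿ u} {a *ᴿ p +ᴿ b *ᴿ q} {0ℝ}
      (≗⇒≃ (N *ᴿ u) (a *ᴿ p +ᴿ b *ᴿ q) (λ n → solve 4 (λ a b u v →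
        (a :* a :+ b :* b) :* u := a :* (a :* u :- b :* v) :+ b :* (a :* v :+ b :* u)) ≡.refl
        (seq a n) (seq b n) (seq u n) (seq v n)))
      (combination a b)) ,
    apart-cancel {N} N-apart v (Re.trans {N *ᴿ v} {(-ᴿ b) *ᴿ p +ᴿ a *ᴿ q} {0ℝ}
      (≗⇒≃ (N *ᴿ v) ((-ᴿ b) *ᴿ p +ᴿ a *ᴿ q) (λ n → solve 4 (λ a b u v →
        (a :* a :+ b :* b) :* v := (:- b) :* (a :* u :- b :* v) :+ a :* (a :* v :+ b :* u)) ≡.refl
        (seq a n) (seq b n) (seq u n) (seq v n)))
      (combination (-ᴿ b) a))
    where
    a b u v p q N : ℝ
    a = re w
    b = im w
    u = re z
    v = im z
    p = re (w Co.* z)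
    q = im (w Co.* z)
    N = a *ᴿ a +ᴿ b *ᴿ b
    combination : ∀ c d → (c *ᴿ p +ᴿ d *ᴿ q) ≃ 0ℝ
    combination c d = Re.trans {c *ᴿ p +ᴿ d *ᴿ q} {c *ᴿ 0ℝ +ᴿ d *ᴿ 0ℝ} {0ℝ}
      (+-≃ {c *ᴿ p} {c *ᴿ 0ℝ} {d *ᴿ q} {d *ᴿ 0ℝ}
        (Re.*-congˡ {c} {p} {0ℝ} re≃0) (Re.*-congˡ {d} {q} {0ℝ} im≃0))
      (≗⇒≃ (c *ᴿ 0ℝ +ᴿ d *ᴿ 0ℝ) 0ℝ (λ n →
        solve 2 (λ c d → c :* con 0ℚ :+ d :* con 0ℚ := con 0ℚ) ≡.refl (seq c n) (seq d n)))
    open ℚ.≤-Reasoning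
    ∣p∣²≡p² : ∀ p → ℚ.∣ p ∣ ℚ.* ℚ.∣ p ∣ ≡ p ℚ.* p
    ∣p∣²≡p² p with ℚ.∣p∣≡p∨∣p∣≡-p p
    ... | inj₁ eq = cong₂ ℚ._*_ eq eq
    ... | inj₂ eq = ≡.trans (cong₂ ℚ._*_ eq eq) (solve 1 (λ p → (:- p) :* (:- p) := p :* p) ≡.refl p)
    large : ∀ {ε} → 0ℚ ℚ.< ε → ∀ p q → ε ℚ.< ℚ.∣ p ∣ → ε ℚ.* ε ℚ.< p ℚ.* p ℚ.+ q ℚ.* q
    large {ε} 0<ε p q ε<p = begin-strict
      ε ℚ.* ε                ≡⟨ ℚ.+-identityʳ (ε ℚ.* ε) ⟨
      ε ℚ.* ε ℚ.+ 0ℚ         <⟨ ℚ.+-mono-<-≤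
                                  (subst (ε ℚ.* ε ℚ.<_) (∣p∣²≡p² p) (*-mono-<-pos 0<ε (ℚ.<-trans 0<ε ε<p) ε<p ε<p))
                                  (subst₂ ℚ._≤_ (ℚ.*-zeroˡ ℚ.∣ q ∣) (∣p∣²≡p² q)
                                    (ℚ.*-monoʳ-≤-nonNeg ℚ.∣ q ∣ {{ℚ.∣-∣-nonNeg q}} (ℚ.0≤∣p∣ q))) ⟩
      p ℚ.* p ℚ.+ q ℚ.* q    ∎
    N-apart : Apart N
    N-apart = let ε , 0<ε , far = apart in
      pos⇒apart {N} (ε ℚ.* ε , *-pos 0<ε 0<ε , mapE (λ n → large 0<ε (seq a n) (seq b n)) far)

  -- One approximant of `x` far enough along decides: either it exceeds `ε / 2` in absolute value,
  -- or that of `y` does. Later terms move by less than `ε / 4`, so a margin of `ε / 4` remains.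
  apart-+ : ∀ x y → Apart (x +ᴿ y) → Apart x ⊎ Apart y
  apart-+ x y (ε , 0<ε , N , far) =
    let d  = ε ℚ.* ½
        Nx , close-x = cauchy x (d ℚ.* ½) (half-pos (half-pos 0<ε))
        Ny , close-y = cauchy y (d ℚ.* ½) (half-pos (half-pos 0<ε))
        K = N ℕ.⊔ (Nx ℕ.⊔ Ny)
        N≤K  = ℕ.m≤m⊔n N (Nx ℕ.⊔ Ny)
        Nx≤K = ℕ.≤-trans (ℕ.m≤m⊔n Nx Ny) (ℕ.m≤n⊔m N (Nx ℕ.⊔ Ny))
        Ny≤K = ℕ.≤-trans (ℕ.m≤n⊔m Nx Ny) (ℕ.m≤n⊔m N (Nx ℕ.⊔ Ny))
    in decide K (far K N≤K) (d ℚ.<? ℚ.∣ seq x K ∣)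
         (K , λ n K≤n → close-x K n Nx≤K (ℕ.≤-trans Nx≤K K≤n))
         (K , λ n K≤n → close-y K n Ny≤K (ℕ.≤-trans Ny≤K K≤n))
    where
    open ℚ.≤-Reasoning
    stays : ∀ z K → ε ℚ.* ½ ℚ.< ℚ.∣ seq z K ∣ →
            Eventually (λ n → ℚ.∣ seq z K ℚ.- seq z n ∣ ℚ.< ε ℚ.* ½ ℚ.* ½) → Apart z
    stays z K d<z close = ε ℚ.* ½ ℚ.* ½ , half-pos (half-pos 0<ε) ,
      mapE (λ n near → close-pos ℚ.∣ seq z K ∣ ℚ.∣ seq z n ∣ d<z
             (ℚ.≤-<-trans (∣∣p∣-∣q∣∣≤∣p-q∣ (seq z K) (seq z n)) near)) close
    other : ∀ p q → ε ℚ.< ℚ.∣ p ℚ.+ q ∣ → ℚ.∣ p ∣ ℚ.≤ ε ℚ.* ½ → ε ℚ.* ½ ℚ.< ℚ.∣ q ∣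
    other p q ε<p+q p≤d = begin-strict
      ε ℚ.* ½
        ≡⟨ solve 1 (λ d → d := (d :+ d) :- d) ≡.refl (ε ℚ.* ½) ⟩
      (ε ℚ.* ½ ℚ.+ ε ℚ.* ½) ℚ.- ε ℚ.* ½
        ≡⟨ cong (ℚ._- ε ℚ.* ½) (half+half ε) ⟩
      ε ℚ.- ε ℚ.* ½
        <⟨ ℚ.+-mono-<-≤ (ℚ.<-≤-trans ε<p+q (ℚ.∣p+q∣≤∣p∣+∣q∣ p q)) (ℚ.neg-antimono-≤ p≤d) ⟩
      (ℚ.∣ p ∣ ℚ.+ ℚ.∣ q ∣) ℚ.- ℚ.∣ p ∣
        ≡⟨ solve 2 (λ a b → (a :+ b) :- a := b) ≡.refl ℚ.∣ p ∣ ℚ.∣ q ∣ ⟩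
      ℚ.∣ q ∣ ∎
    decide : ∀ K → ε ℚ.< ℚ.∣ seq x K ℚ.+ seq y K ∣ → Dec (ε ℚ.* ½ ℚ.< ℚ.∣ seq x K ∣) →
      Eventually (λ n → ℚ.∣ seq x K ℚ.- seq x n ∣ ℚ.< ε ℚ.* ½ ℚ.* ½) →
      Eventually (λ n → ℚ.∣ seq y K ℚ.- seq y n ∣ ℚ.< ε ℚ.* ½ ℚ.* ½) → Apart x ⊎ Apart y
    decide K far (yes d<x) cx cy = inj₁ (stays x K d<x cx)
    decide K far (no d≮x)  cx cy = inj₂ (stays y K (other (seq x K) (seq y K) far (ℚ.≮⇒≥ d≮x)) cy)

  ⊎-∀ : ∀ {m} {P : Set} {Q : Fin m → Set} → (∀ i → P ⊎ Q i) → P ⊎ (∀ i → Q i)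
  ⊎-∀ {zero}  f = inj₂ λ ()
  ⊎-∀ {suc m} f with f zero | ⊎-∀ (f ∘ suc)
  ... | inj₁ p | _      = inj₁ p
  ... | inj₂ q | inj₁ p = inj₁ p
  ... | inj₂ q | inj₂ r = inj₂ λ { zero → q ; (suc i) → r i }

  ∏-cancellable : ∀ m γ z → (∀ i → Polyℂ.Cancellable (z Co.- γ i)) → Polyℂ.Cancellable (Polyℂ.∏ m γ z)
  ∏-cancellable zero    γ z cancel w eq = Co.trans {w} {Co.1# Co.* w} {Co.0#}
    (Co.sym {Co.1# Co.* w} {w} (Co.*-identityˡ w)) eq
  ∏-cancellable (suc m) γ z cancel w eq = ∏-cancellable m (γ ∘ suc) z (cancel ∘ suc) w
    (cancel zero (p Co.* w) (Co.trans {d Co.* (p Co.* w)} {(d Co.* p) Co.* w} {Co.0#}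
      (Co.sym {(d Co.* p) Co.* w} {d Co.* (p Co.* w)} (Co.*-assoc d p w)) eq))
    where
    d = z Co.- γ zero
    p = Polyℂ.∏ m (γ ∘ suc) z

  -- As the roots are apart, `re z` is apart from `α zero` or from any given other root. If it is
  -- apart from `α zero`, the first linear factor is cancelled and the induction continues; if it is
  -- apart from all the others, their product is cancelled and `z` equals the first root.
  ∏-zero : ∀ m (α : Fin m → ℝ) → Decreasing α → ∀ z →
           Polyℂ.∏ m (fromℝ ∘ α) z Co.≈ Co.0# → ∃ λ i → z Co.≈ fromℝ (α i)
  ∏-zero zero    α dec z (1≃0 , _) = contradiction 1≃0 (pos⇒≄0 {1ℝ} pos-1)
  ∏-zero (suc m) α dec z eq = by-cases (⊎-∀ separate)
    where
    d p : ℂ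
    d = z Co.- fromℝ (α zero)
    p = Polyℂ.∏ m (fromℝ ∘ α ∘ suc) z
    unsign : Apart (-ᴿ (re z -ᴿ α zero)) → Apart (re z -ᴿ α zero)
    unsign apart = apart-resp-≃ { -ᴿ (-ᴿ (re z -ᴿ α zero))} {re z -ᴿ α zero}
      (≗⇒≃ (-ᴿ (-ᴿ (re z -ᴿ α zero))) (re z -ᴿ α zero)
        (λ n → solve 1 (λ x → :- (:- x) := x) ≡.refl (seq (re z) n ℚ.- seq (α zero) n)))
      (apart-neg { -ᴿ (re z -ᴿ α zero)} apart)
    separate : ∀ i → Apart (re z -ᴿ α zero) ⊎ Apart (re z -ᴿ α (suc i))
    separate i = ⊎.map unsign (λ apart → apart) (apart-+ (-ᴿ (re z -ᴿ α zero)) (re z -ᴿ α (suc i))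
      (apart-resp-≃ {α zero -ᴿ α (suc i)} {(-ᴿ (re z -ᴿ α zero)) +ᴿ (re z -ᴿ α (suc i))}
        (≗⇒≃ (α zero -ᴿ α (suc i)) ((-ᴿ (re z -ᴿ α zero)) +ᴿ (re z -ᴿ α (suc i)))
          (λ n → solve 3 (λ x a b → a :- b := (:- (x :- a)) :+ (x :- b)) ≡.refl
                   (seq (re z) n) (seq (α zero) n) (seq (α (suc i)) n)))
        (pos⇒apart {α zero -ᴿ α (suc i)} (<⇒pos {α (suc i)} {α zero} (dec zero (suc i) (s≤s z≤n))))))
    z≈α : d Co.≈ Co.0# → z Co.≈ fromℝ (α zero)
    z≈α d≈0 = Co.trans {z} {d Co.+ a} {a}
      (re≗⇒≈ z (d Co.+ a)
        (λ n → solve 2 (λ x a → x := (x :- a) :+ a) ≡.refl (seq (re z) n) (seq (α zero) n))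
        (λ n → solve 1 (λ y → y := (y :- con 0ℚ) :+ con 0ℚ) ≡.refl (seq (im z) n)))
      (Co.trans {d Co.+ a} {Co.0# Co.+ a} {a} (Co.+-congʳ {a} {d} {Co.0#} d≈0) (Co.+-identityˡ a))
      where a = fromℝ (α zero)
    by-cases : Apart (re z -ᴿ α zero) ⊎ (∀ i → Apart (re z -ᴿ α (suc i))) → ∃ λ i → z Co.≈ fromℝ (α i)
    by-cases (inj₁ apart) =
      let i , z≈ = ∏-zero m (α ∘ suc) (λ i j i<j → dec (suc i) (suc j) (s≤s i<j)) z (cancellable-ℂ d apart p eq)
      in suc i , z≈
    by-cases (inj₂ apart) = zero , z≈α
      (∏-cancellable m (fromℝ ∘ α ∘ suc) z (λ i → cancellable-ℂ (z Co.- fromℝ (α (suc i))) (apart i)) d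
        (Co.trans {p Co.* d} {d Co.* p} {Co.0#} (Co.*-comm p d) eq))

  seq-re-ι : ∀ k n → seq (re (Polyℂ.ι k)) n ≡ seq (Polyℝ.ι k) n
  seq-re-ι zero    n = ≡.refl
  seq-re-ι (suc k) n = cong (1ℚ ℚ.+_) (seq-re-ι k n)

  seq-im-ι : ∀ k n → seq (im (Polyℂ.ι k)) n ≡ 0ℚ
  seq-im-ι zero    n = ≡.refl
  seq-im-ι (suc k) n = ≡.trans (ℚ.+-identityˡ _) (seq-im-ι k n)

  evℂ : ℕ → (ℕ → ℕ) → ℂ → ℂ
  evℂ m b = Polyℂ.ev m (Polyℂ.ι ∘ b)

  seq-evℂ : ∀ m b x n → seq (re (evℂ m b (fromℝ x))) n ≡ seq (evℝ m b x) n ×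
                        seq (im (evℂ m b (fromℝ x))) n ≡ 0ℚ
  seq-evℂ zero    b x n = seq-re-ι (b 0) n , seq-im-ι (b 0) n
  seq-evℂ (suc m) b x n =
    let ih-re , ih-im = seq-evℂ m (b ∘ suc) x n
    in ≡.trans (cong₂ (λ c z → c ℚ.+ z) (seq-re-ι (b 0) n)
                  (cong₂ (λ p q → seq x n ℚ.* p ℚ.- 0ℚ ℚ.* q) ih-re ih-im))
         (solve 3 (λ c x p → c :+ (x :* p :- con 0ℚ :* con 0ℚ) := c :+ x :* p) ≡.refl
           (seq (Polyℝ.ι (b 0)) n) (seq x n) (seq (evℝ m (b ∘ suc) x) n)) ,
       ≡.trans (cong₂ (λ c z → c ℚ.+ z) (seq-im-ι (b 0) n)
                  (cong₂ (λ p q → seq x n ℚ.* q ℚ.+ 0ℚ ℚ.* p) ih-re ih-im))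
         (solve 2 (λ x p → con 0ℚ :+ (x :* con 0ℚ :+ con 0ℚ :* p) := con 0ℚ) ≡.refl
           (seq x n) (seq (evℝ m (b ∘ suc) x) n))

  evℂ-fromℝ : ∀ m b x → evℂ m b (fromℝ x) Co.≈ fromℝ (evℝ m b x)
  evℂ-fromℝ m b x = re≗⇒≈ (evℂ m b (fromℝ x)) (fromℝ (evℝ m b x))
    (λ n → proj₁ (seq-evℂ m b x n)) (λ n → proj₂ (seq-evℂ m b x n))

  complex-zeros : ∀ m b → 1 ≤ b m → (roots : Roots m b) → ∀ z → evℂ m b z Co.≈ Co.0# →
                  ∃ λ i → z Co.≈ fromℝ (Roots.α roots i)
  complex-zeros m b 1≤b roots z eq = ∏-zero m α decreasing z
    (cancellable-ℂ c (apart-resp-≃ {Polyℝ.ι (b m)} {re c}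
        (≗⇒≃ (Polyℝ.ι (b m)) (re c) (λ n → ≡.sym (seq-re-ι (b m) n)))
        (pos⇒apart {Polyℝ.ι (b m)} (pos-ι 1≤b)))
      p (Co.trans {c Co.* p} {evℂ m b z} {Co.0#}
          (Co.sym {evℂ m b z} {c Co.* p}
            (proj₁ (Polyℂ.factorisation m (Polyℂ.ι ∘ b) (fromℝ ∘ α) cancel zeros z))) eq))
    where
    open Roots roots
    c p : ℂ
    c = Polyℂ.ι (b m)
    p = Polyℂ.∏ m (fromℝ ∘ α) z
    cancel : ∀ i j → i Fin.< j → Polyℂ.Cancellable (fromℝ (α j) Co.- fromℝ (α i))
    cancel i j i<j = cancellable-ℂ (fromℝ (α j) Co.- fromℝ (α i)) (decreasing⇒apart {α = α} decreasing i j i<j)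
    zeros : ∀ i → evℂ m b (fromℝ (α i)) Co.≈ Co.0#
    zeros i = Co.trans {evℂ m b (fromℝ (α i))} {fromℝ (evℝ m b (α i))} {Co.0#}
      (evℂ-fromℝ m b (α i)) (root i , Re.refl {0ℝ})

  simpleNegativeZeros : ∀ m b p → (∀ k → coeff p k ≡ b k) → (∀ k → m ℕ.< k → b k ≡ 0) → 1 ≤ b m →
                        Roots m b → HasSimpleNegativeZeros m p
  simpleNegativeZeros m b p p≡b bound 1≤b roots =
    α , apart , (λ i → zeros i , simple i) , negative , complex
    where
    open Roots roots
    apart : ∀ i j → i ≢ j → α i # α j
    apart i j i≢j with Fin.<-cmp i j
    ... | tri< i<j _ _ = inj₂ (decreasing i j i<j)
    ... | tri≈ _ i≡j _ = contradiction i≡j i≢j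
    ... | tri> _ _ j<i = inj₁ (decreasing j i j<i)
    zeros : ∀ i → eval ℝ-rawRing p (α i) ≃ 0ℝ
    zeros i = Re.trans {eval ℝ-rawRing p (α i)} {evℝ m b (α i)} {0ℝ}
      (Polyℝ.eval-ev m p b (α i) p≡b bound) (root i)
    simple : ∀ i → eval ℝ-rawRing (derivative p) (α i) # 0ℝ
    -- By the factorisation the derivative at a root is the positive leading coefficient times `∏′`,
    -- whose sign is known.
    simple i = pos-sgn⇒# (toℕ i) {eval ℝ-rawRing (derivative p) (α i)}
      (pos-resp-≃ {sgnℝ (toℕ i) v} {sgnℝ (toℕ i) (eval ℝ-rawRing (derivative p) (α i))}
        (sgnℝ-≃ (toℕ i) {v} {eval ℝ-rawRing (derivative p) (α i)}
          (Re.sym {eval ℝ-rawRing (derivative p) (α i)} {v}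
            (Re.trans {eval ℝ-rawRing (derivative p) (α i)} {Polyℝ.ev′ m (Polyℝ.ι ∘ b) (α i)} {v}
              (Polyℝ.eval-derivative-ev′ m p b (α i) p≡b bound)
              (proj₂ (Polyℝ.factorisation m (Polyℝ.ι ∘ b) α (decreasing⇒cancellable {α = α} decreasing) root (α i))))))
        (pos-sgn-* (toℕ i) {Polyℝ.ι (b m)} {Polyℝ.∏′ m α (α i)} (pos-ι 1≤b) (∏′-sign m α decreasing i)))
      where
      v : ℝ
      v = Polyℝ.ι (b m) *ᴿ Polyℝ.∏′ m α (α i)
    complex : ∀ z → eval ℂ-rawRing p z Co.≈ Co.0# → ∃ λ i → z Co.≈ fromℝ (α i)
    complex z eq = complex-zeros m b 1≤b roots z
      (Co.trans {evℂ m b z} {eval ℂ-rawRing p z} {Co.0#}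
        (Co.sym {eval ℂ-rawRing p z} {evℂ m b z} (Polyℂ.eval-ev m p b z p≡b bound)) eq)

  -- The rows of coefficients and their roots

  -- rows n r lists the coefficients of the image-size polynomial of the words of length r over an
  -- alphabet with n + 1 letters, divided by n + 1.
  rows : ℕ → ℕ → ℕ → ℕ
  rows n r j = (n P′ j) ℕ.* stirling₂ r (suc j)

  1≤P′ : ∀ {n k} → k ≤ n → 1 ≤ (n P′ k)
  1≤P′ {n}     {zero}  _         = ℕ.≤-refl
  1≤P′ {suc n} {suc k} (s≤s k≤n) = subst (1 ≤_) (≡.sym (P′-suc-suc n k)) (ℕ.*-mono-≤ {1} {suc n} (s≤s z≤n) (1≤P′ k≤n))

  stirling₂-diagonal : ∀ n → stirling₂ n n ≡ 1
  stirling₂-diagonal zero    = ≡.refl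
  stirling₂-diagonal (suc n) = ≡.trans (stirling₂-suc-suc n n)
    (cong₂ ℕ._+_ (stirling₂-diagonal n)
      (≡.trans (cong (suc n ℕ.*_) (stirling₂->≡0 (ℕ.n<1+n n))) (ℕ.*-zeroʳ (suc n))))

  -- The diagonal Stirling number is one, so the leading coefficient is `n P′ m`. It vanishes for
  -- `m > n`, which is why the induction on rows runs under `m ≤ n`.
  1≤rows : ∀ {n m} → m ≤ n → 1 ≤ rows n (suc m) m
  1≤rows {n} {m} m≤n = ℕ.*-mono-≤ (1≤P′ m≤n) (ℕ.≤-reflexive (≡.sym (stirling₂-diagonal (suc m))))

  rows-bound : ∀ n r {k} → r ≤ k → rows n r k ≡ 0
  rows-bound n r {k} r≤k = ≡.trans (cong ((n P′ k) ℕ.*_) (stirling₂->≡0 (s≤s r≤k))) (ℕ.*-zeroʳ (n P′ k))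

  rows-zero : ∀ n r → rows n (suc (suc r)) 0 ≡ rows n (suc r) 0
  rows-zero n r = cong (1 ℕ.*_) (≡.trans (stirling₂-suc-suc (suc r) 0)
    (≡.trans (cong (ℕ._+ 1 ℕ.* stirling₂ (suc r) 1) (stirling₂-suc-zero r)) (ℕ.*-identityˡ _)))

  -- The Stirling recursion multiplied by the falling factorial, whose last factor is `n ∸ k`. The
  -- part with `k` stands on the left, so that the equation holds in the natural numbers.
  rows-suc : ∀ n r k → rows n (suc r) (suc k) ℕ.+ k ℕ.* rows n r k ≡
                       n ℕ.* rows n r k ℕ.+ (2 ℕ.+ k) ℕ.* rows n r (suc k)
  rows-suc n r k = begin
    ((n ∸ k) ℕ.* p) ℕ.* stirling₂ (suc r) (2 ℕ.+ k) ℕ.+ k ℕ.* (p ℕ.* s)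
      ≡⟨ cong (λ z → ((n ∸ k) ℕ.* p) ℕ.* z ℕ.+ k ℕ.* (p ℕ.* s)) (stirling₂-suc-suc r (suc k)) ⟩
    ((n ∸ k) ℕ.* p) ℕ.* (s ℕ.+ (2 ℕ.+ k) ℕ.* t) ℕ.+ k ℕ.* (p ℕ.* s)
      ≡⟨ expand (n ∸ k) p s k t ⟩
    ((n ∸ k) ℕ.* p ℕ.+ k ℕ.* p) ℕ.* s ℕ.+ (2 ℕ.+ k) ℕ.* (((n ∸ k) ℕ.* p) ℕ.* t)
      ≡⟨ cong (λ z → z ℕ.* s ℕ.+ (2 ℕ.+ k) ℕ.* (((n ∸ k) ℕ.* p) ℕ.* t)) ([m∸k]*mP′k+k*mP′k n k) ⟩
    (n ℕ.* p) ℕ.* s ℕ.+ (2 ℕ.+ k) ℕ.* (((n ∸ k) ℕ.* p) ℕ.* t)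
      ≡⟨ cong (ℕ._+ (2 ℕ.+ k) ℕ.* (((n ∸ k) ℕ.* p) ℕ.* t)) (ℕ.*-assoc n p s) ⟩
    n ℕ.* (p ℕ.* s) ℕ.+ (2 ℕ.+ k) ℕ.* (((n ∸ k) ℕ.* p) ℕ.* t) ∎
    where
    open ≡.≡-Reasoning
    p = n P′ k
    s = stirling₂ r (suc k)
    t = stirling₂ r (2 ℕ.+ k)
    expand : ∀ d p s k t → (d ℕ.* p) ℕ.* (s ℕ.+ (2 ℕ.+ k) ℕ.* t) ℕ.+ k ℕ.* (p ℕ.* s) ≡
                           (d ℕ.* p ℕ.+ k ℕ.* p) ℕ.* s ℕ.+ (2 ℕ.+ k) ℕ.* ((d ℕ.* p) ℕ.* t)
    expand = solve-∀

  rows-roots : ∀ n m → m ≤ n → Roots m (rows n (suc m))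
  rows-roots n zero    _   = record { α = λ () ; decreasing = λ () ; negative = λ () ; root = λ () }
  rows-roots n (suc m) m<n = brackets⇒roots (suc m) (rows n (suc (suc m)))
    (roots⇒brackets m n (rows n (suc m)) (rows n (suc (suc m)))
      (rows-zero n m) (rows-bound n (suc m) ℕ.≤-refl) (rows-suc n (suc m))
      (1≤rows (ℕ.<⇒≤ m<n)) (1≤rows m<n) (rows-roots n m (ℕ.<⇒≤ m<n)))

open Counting using (coeff-M; coeff-imageSizeFormula)
open Zeros using (simpleNegativeZeros; rows; rows-bound; rows-roots; 1≤rows)

theorem9p1 : (n : ℕ) → 1 ≤ n →
    M n ≋ imageSizeFormula n × HasSimpleNegativeZeros (n ∸ 1) (M n)
theorem9p1 (suc m) _ =
  (λ k → ≡.trans (coeff-M m k) (≡.sym (coeff-imageSizeFormula (suc m) k))) ,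
  simpleNegativeZeros m (rows (suc m) (suc m)) (M (suc m)) (coeff-M m)
    (λ k m<k → rows-bound (suc m) (suc m) m<k) (1≤rows (ℕ.n≤1+n m)) (rows-roots (suc m) m (ℕ.n≤1+n m))
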